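{- Let $d\ge1$ be an integer and let $$\lambda=\frac{d+2+\sqrt{d(d+4)}}{2}.$$ Let $\alpha$ be defined by any one of the constructions (E), (P1), (P2) described in the context, where the sequence $(u_n)_{n\ge1}$ of positive integers is specified by $$u_n=\sum_{j=0}^{d-1}v_n^{(j)}\,x_n^{d-1-j},\qquad n\ge1,$$ where for each $j\in\{0,\dots,d-1\}$ the sequence $(v_n^{(j)})_{n\ge1}$ is an integer sequence, $v_n^{(0)}\in\mathbb Z_{>0}$ for all $n\ge1$, and, for some real $\nu$ with $0<\nu<\lambda$, as $n\to\infty$, $$\log v_n^{(0)}=O(\nu^n)\qquad\text{and}\qquad v_n^{(j)}=O(v_n^{(0)})\quad\text{for } j=1,\dots,d-1.$$ Then $\alpha$ has irrationality exponent $\mu(\alpha)=\lambda$.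
   Context: The irrationality exponent $\mu(\alpha)$ of a real number $\alpha$ is the supremum of the set of real $\mu$ such that $0<|\alpha-P/Q|<1/Q^\mu$ holds for infinitely many rational numbers $P/Q$. Continued fractions: $[a_0;a_1,\dots,a_n]$ denotes the finite continued fraction with $a_0\in\mathbb Z$ and $a_j\in\mathbb Z_{>0}$ for $j\ge1$. The denominators $q_n$ of its convergents satisfy $q_{n+1}=a_{n+1}q_n+q_{n-1}$ for $n\ge-1$, with $q_{ -1}=0$, $q_{ -2}=1$. Every rational number has such an expansion with last index even, and one with last index odd. Common data: a rational $p/q$ in lowest terms with $q\ge1$, an integer $m\ge0$, and a sequence $(u_n)_{n\ge1}$ of positive integers ($u_n$ is allowed to depend on $x_n$). Given a positive integer $y_0$, the sequences $(y_n)_{n\ge0}$ and $(x_n)_{n\ge1}$ are defined by $x_1=q$, $y_j=y_{j-1}(1+u_jx_j)$, $x_{j+1}=x_jy_j$ for $j\ge1$. (E) Write $p/q=[a_0;a_1,\dots,a_{2k}]$ (last index even), put $y_0=mq+q_{2k-1}+1$, and let $\alpha=\frac pq+\sum_{j\ge2}\frac1{x_j}$. (P1) Assume $q>1$, write $p/q=[a_0;a_1,\dots,a_{2k}]$ (last index even), put $y_0=mq+q_{2k-1}-1$, requiring $m\ge1$ if $q_{2k-1}=1$, and let $\alpha=\frac pq+\sum_{j\ge2}\frac{(-1)^j}{x_j}$. (P2) Assume $q>1$, write $p/q=[a_0;a_1,\dots,a_{2k+1}]$ (last index odd), put $y_0=mq+q_{2k}-1$, requiring $m\ge1$ if $q_{2k}=1$,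 and let $\alpha=\frac pq-\sum_{j\ge2}\frac{(-1)^j}{x_j}$. -}

module Defs where

open import Algebra.Bundles using (CommutativeRing)
open import Data.Empty using (⊥; ⊥-elim)
open import Data.Fin.Base using (toℕ)
open import Data.Integer.Base as ℤ using (ℤ; +_; -[1+_])
import Data.Integer.Properties as ℤP
open import Data.List.Base using (List; []; _∷_; length)
open import Data.List.Membership.Propositional using (_∉_)
open import Data.List.Relation.Unary.All using (All)
open import Data.Nat.Base as ℕ using (ℕ; zero; suc)
import Data.Nat.Properties as ℕP
open import Data.Product.Base using (Σ; ∃; ∃-syntax; _×_; _,_; proj₁; proj₂)
open import Data.Rational.Base using (ℚ; mkℚ; 0ℚ; 1ℚ; ½; -_; _+_; _-_; _*_; 1/_; _/_; _<_; _≤_; _⊔_; ↧ₙ_; Positive; positive; nonNegative; toℚᵘ)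
import Data.Rational.Base as ℚ
import Data.Rational.Properties as ℚP
open import Data.Rational.Solver using (module +-*-Solver)
open import Data.Rational.Unnormalised.Base as ℚᵘ using (mkℚᵘ)
import Data.Rational.Unnormalised.Properties as ℚᵘP
open import Data.Sum.Base using (_⊎_; inj₁; inj₂)
open import Relation.Binary.PropositionalEquality.Core using (_≡_; refl; sym; trans; cong; cong₂; subst; subst₂)
open import Relation.Nullary using (Dec; yes; no)

open import Algebra.Properties.CommutativeSemiring.Exp (CommutativeRing.commutativeSemiring ℚP.+-*-commutativeRing) using (_^_; ^-homo-*; ^-assocʳ; ^-distrib-*)
open import Algebra.Properties.CommutativeMonoid.Sum ℤP.+-0-commutativeMonoid using () renaming (sum to sumℤ)

open +-*-Solver using (solve; _:+_; _:*_; :-_; _:-_; _:=_; con)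

fromℤ : ℤ → ℚ
fromℤ i = i / 1

fromℕ : ℕ → ℚ
fromℕ n = fromℤ (+ n)

neg-neg : ∀ p → - (- p) ≡ p
neg-neg = solve 1 (λ p → :- (:- p) := p) refl

p-q+q : ∀ p q → (p - q) + q ≡ p
p-q+q = solve 2 (λ p q → (p :- q) :+ q := p) refl

p+q-q : ∀ p q → (p + q) - q ≡ p
p+q-q = solve 2 (λ p q → (p :+ q) :- q := p) refl

p+[q-p] : ∀ p q → p + (q - p) ≡ q
p+[q-p] = solve 2 (λ p q → p :+ (q :- p) := q) refl

p<q⇒0<q-p : ∀ {p q} → p < q → 0ℚ < q - p
p<q⇒0<q-p {p} {q} p<q = subst (_< q - p) (ℚP.+-inverseʳ p) (ℚP.+-monoˡ-< (- p) p<q)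

p<p+q : ∀ {p q} → 0ℚ < q → p < p + q
p<p+q {p} {q} 0<q = subst (_< p + q) (ℚP.+-identityʳ p) (ℚP.+-monoʳ-< p 0<q)

p≤p+q : ∀ {p q} → 0ℚ ≤ q → p ≤ p + q
p≤p+q {p} {q} 0≤q = subst (_≤ p + q) (ℚP.+-identityʳ p) (ℚP.+-monoʳ-≤ p 0≤q)

p-q<p : ∀ {p q} → 0ℚ < q → p - q < p
p-q<p {p} {q} 0<q = subst (p - q <_) (ℚP.+-identityʳ p) (ℚP.+-monoʳ-< p (ℚP.neg-antimono-< 0<q))

-p<q⇒-q<p : ∀ {p q} → - p < q → - q < p
-p<q⇒-q<p {p} {q} h = subst (- q <_) (neg-neg p) (ℚP.neg-antimono-< h)

p<-q⇒q<-p : ∀ {p q} → p < - q → q < - p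
p<-q⇒q<-p {p} {q} h = subst (_< - p) (neg-neg q) (ℚP.neg-antimono-< h)

p-q<r⇒p<r+q : ∀ {p r} q → p - q < r → p < r + q
p-q<r⇒p<r+q {p} {r} q h = subst (_< r + q) (p-q+q p q) (ℚP.+-monoˡ-< q h)

r<p-q⇒r+q<p : ∀ {p r} q → r < p - q → r + q < p
r<p-q⇒r+q<p {p} {r} q h = subst (r + q <_) (p-q+q p q) (ℚP.+-monoˡ-< q h)

p<p⊔q+1 : ∀ p q → p < (p ⊔ q) + 1ℚ
p<p⊔q+1 p q = ℚP.≤-<-trans (ℚP.p≤p⊔q p q) (p<p+q (ℚP.positive⁻¹ 1ℚ))

q<p⊔q+1 : ∀ p q → q < (p ⊔ q) + 1ℚ
q<p⊔q+1 p q = ℚP.≤-<-trans (ℚP.p≤q⊔p p q) (p<p+q (ℚP.positive⁻¹ 1ℚ))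

p⊔q<r : ∀ {p q r} → p < r → q < r → p ⊔ q < r
p⊔q<r {p} {q} {r} p<r q<r with ℚP.⊔-sel p q
... | inj₁ e = subst (_< r) (sym e) p<r
... | inj₂ e = subst (_< r) (sym e) q<r

*-mono-≤₀ : ∀ {p q r s} → 0ℚ ≤ p → p ≤ q → 0ℚ ≤ r → r ≤ s → p * r ≤ q * s
*-mono-≤₀ {p} {q} {r} {s} 0≤p p≤q 0≤r r≤s = ℚP.≤-trans
  (ℚP.*-monoʳ-≤-nonNeg r {{nonNegative 0≤r}} p≤q)
  (ℚP.*-monoˡ-≤-nonNeg q {{nonNegative (ℚP.≤-trans 0≤p p≤q)}} r≤s)

0≤* : ∀ {p q} → 0ℚ ≤ p → 0ℚ ≤ q → 0ℚ ≤ p * q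
0≤* {p} {q} hp hq = subst (_≤ p * q) (ℚP.*-zeroʳ p) (ℚP.*-monoˡ-≤-nonNeg p {{nonNegative hp}} hq)

0<* : ∀ {p q} → 0ℚ < p → 0ℚ < q → 0ℚ < p * q
0<* {p} {q} hp hq = subst (_< p * q) (ℚP.*-zeroʳ p) (ℚP.*-monoʳ-<-pos p {{positive hp}} hq)

0≤+ : ∀ {p q} → 0ℚ ≤ p → 0ℚ ≤ q → 0ℚ ≤ p + q
0≤+ hp hq = ℚP.≤-trans hp (p≤p+q hq)

0≤1 : 0ℚ ≤ 1ℚ
0≤1 = ℚP.nonNegative⁻¹ 1ℚ

*-assoc-comm : ∀ p q r → (p * q) * r ≡ (p * r) * q
*-assoc-comm = solve 3 (λ p q r → (p :* q) :* r := (p :* r) :* q) refl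

toℚᵘ-/ : ∀ i k → toℚᵘ (i / suc k) ℚᵘ.≃ mkℚᵘ i k
toℚᵘ-/ i k = ℚP.toℚᵘ-fromℚᵘ (mkℚᵘ i k)

fromℤ-+ : ∀ i j → fromℤ (i ℤ.+ j) ≡ fromℤ i + fromℤ j
fromℤ-+ i j = ℚP.toℚᵘ-injective (ℚᵘP.≃-trans (toℚᵘ-/ (i ℤ.+ j) 0) (ℚᵘP.≃-sym
  (ℚᵘP.≃-trans (ℚP.toℚᵘ-homo-+ (fromℤ i) (fromℤ j))
    (ℚᵘP.≃-trans (ℚᵘP.+-cong (toℚᵘ-/ i 0) (toℚᵘ-/ j 0))
      (ℚᵘ.*≡* (cong (ℤ._* + 1) (cong₂ ℤ._+_ (ℤP.*-identityʳ i) (ℤP.*-identityʳ j))))))))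

fromℤ-* : ∀ i j → fromℤ (i ℤ.* j) ≡ fromℤ i * fromℤ j
fromℤ-* i j = ℚP.toℚᵘ-injective (ℚᵘP.≃-trans (toℚᵘ-/ (i ℤ.* j) 0) (ℚᵘP.≃-sym
  (ℚᵘP.≃-trans (ℚP.toℚᵘ-homo-* (fromℤ i) (fromℤ j))
    (ℚᵘP.≃-trans (ℚᵘP.*-cong (toℚᵘ-/ i 0) (toℚᵘ-/ j 0)) (ℚᵘ.*≡* refl)))))

fromℤ-mono-≤ : ∀ {i j} → i ℤ.≤ j → fromℤ i ≤ fromℤ j
fromℤ-mono-≤ {i} {j} i≤j = ℚP.toℚᵘ-cancel-≤
  (ℚᵘP.≤-respˡ-≃ (ℚᵘP.≃-sym (toℚᵘ-/ i 0)) (ℚᵘP.≤-respʳ-≃ (ℚᵘP.≃-sym (toℚᵘ-/ j 0))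
    (ℚᵘ.*≤* (ℤP.*-monoʳ-≤-nonNeg (+ 1) i≤j))))

fromℤ-mono-< : ∀ {i j} → i ℤ.< j → fromℤ i < fromℤ j
fromℤ-mono-< {i} {j} i<j = ℚP.toℚᵘ-cancel-<
  (ℚᵘP.<-respˡ-≃ (ℚᵘP.≃-sym (toℚᵘ-/ i 0)) (ℚᵘP.<-respʳ-≃ (ℚᵘP.≃-sym (toℚᵘ-/ j 0))
    (ℚᵘ.*<* (ℤP.*-monoʳ-<-pos (+ 1) i<j))))

fromℕ-+ : ∀ m n → fromℕ (m ℕ.+ n) ≡ fromℕ m + fromℕ n
fromℕ-+ m n = fromℤ-+ (+ m) (+ n)

fromℕ-* : ∀ m n → fromℕ (m ℕ.* n) ≡ fromℕ m * fromℕ n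
fromℕ-* m n = trans (cong fromℤ (ℤP.pos-* m n)) (fromℤ-* (+ m) (+ n))

fromℕ-suc : ∀ n → fromℕ (suc n) ≡ 1ℚ + fromℕ n
fromℕ-suc n = fromℕ-+ 1 n

0≤fromℕ : ∀ n → 0ℚ ≤ fromℕ n
0≤fromℕ n = fromℤ-mono-≤ {+ 0} {+ n} (ℤ.+≤+ ℕ.z≤n)

0<fromℕ-suc : ∀ n → 0ℚ < fromℕ (suc n)
0<fromℕ-suc n = fromℤ-mono-< {+ 0} {+ suc n} (ℤ.+<+ (ℕ.s≤s ℕ.z≤n))

1≤fromℕ-suc : ∀ n → 1ℚ ≤ fromℕ (suc n)
1≤fromℕ-suc n = fromℤ-mono-≤ {+ 1} {+ suc n} (ℤ.+≤+ (ℕ.s≤s ℕ.z≤n))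

/-* : ∀ i k → (i / suc k) * fromℕ (suc k) ≡ fromℤ i
/-* i k = ℚP.toℚᵘ-injective (ℚᵘP.≃-trans (ℚP.toℚᵘ-homo-* (i / suc k) (fromℕ (suc k)))
  (ℚᵘP.≃-trans (ℚᵘP.*-cong (toℚᵘ-/ i k) (toℚᵘ-/ (+ suc k) 0))
    (ℚᵘP.≃-trans (ℚᵘ.*≡* (trans (ℤP.*-identityʳ _) (cong (λ z → i ℤ.* + z) (sym (ℕP.*-identityʳ (suc k))))))
      (ℚᵘP.≃-sym (toℚᵘ-/ i 0)))))

unit-fraction-antimono : ∀ {a b} → a ℕ.≤ b → + 1 / suc b ≤ + 1 / suc a
unit-fraction-antimono {a} {b} a≤b = ℚP.toℚᵘ-cancel-≤
  (ℚᵘP.≤-respˡ-≃ (ℚᵘP.≃-sym (toℚᵘ-/ (+ 1) b)) (ℚᵘP.≤-respʳ-≃ (ℚᵘP.≃-sym (toℚᵘ-/ (+ 1) a))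
    (ℚᵘ.*≤* (ℤP.*-monoˡ-≤-nonNeg (+ 1) (ℤ.+≤+ (ℕ.s≤s a≤b))))))

0<unit-fraction : ∀ a → 0ℚ < + 1 / suc a
0<unit-fraction a = ℚP.toℚᵘ-cancel-< (ℚᵘP.<-respʳ-≃ (ℚᵘP.≃-sym (toℚᵘ-/ (+ 1) a)) (ℚᵘ.*<* (ℤ.+<+ (ℕ.s≤s ℕ.z≤n))))

archimedean : ∀ p → ∃[ n ] p < fromℕ n
archimedean p@(mkℚ i k _) = suc ℤ.∣ i ∣ , ℚP.toℚᵘ-cancel-<
  (ℚᵘP.<-respʳ-≃ (ℚᵘP.≃-sym (toℚᵘ-/ (+ suc ℤ.∣ i ∣) 0)) (ℚᵘ.*<* (lemma i)))
  where
    lemma : ∀ i → i ℤ.* + 1 ℤ.< + suc ℤ.∣ i ∣ ℤ.* + suc k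
    lemma i = ℤP.≤-<-trans (ℤP.≤-trans (ℤP.≤-reflexive (ℤP.*-identityʳ i)) (i≤∣i∣ i))
      (ℤP.<-≤-trans (ℤ.+<+ (ℕP.n<1+n ℤ.∣ i ∣))
        (ℤP.≤-trans (ℤ.+≤+ (ℕP.m≤m*n (suc ℤ.∣ i ∣) (suc k))) (ℤP.≤-reflexive (ℤP.pos-* (suc ℤ.∣ i ∣) (suc k)))))
      where
        i≤∣i∣ : ∀ i → i ℤ.≤ + ℤ.∣ i ∣
        i≤∣i∣ (+ n) = ℤP.≤-refl
        i≤∣i∣ -[1+ n ] = ℤ.-≤+

archimedean-* : ∀ p {q} → 0ℚ < q → ∃[ n ] p < fromℕ n * q
archimedean-* p {q} 0<q with archimedean (p * (1/ q) {{ℚP.pos⇒nonZero q {{positive 0<q}}}})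
... | n , h = n , subst (_< fromℕ n * q) eq (ℚP.*-monoˡ-<-pos q {{positive 0<q}} h)
  where
    instance
      nz : ℚ.NonZero q
      nz = ℚP.pos⇒nonZero q {{positive 0<q}}
    eq : (p * 1/ q) * q ≡ p
    eq = trans (ℚP.*-assoc p (1/ q) q) (trans (cong (p *_) (ℚP.*-inverseˡ q)) (ℚP.*-identityʳ p))

0≤^ : ∀ {p} n → 0ℚ ≤ p → 0ℚ ≤ p ^ n
0≤^ zero    _ = 0≤1
0≤^ (suc n) h = 0≤* h (0≤^ n h)

0<^ : ∀ {p} n → 0ℚ < p → 0ℚ < p ^ n
0<^ zero    _ = ℚP.positive⁻¹ 1ℚ
0<^ (suc n) h = 0<* h (0<^ n h)

^-mono-≤ : ∀ n {p q} → 0ℚ ≤ p → p ≤ q → p ^ n ≤ q ^ n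
^-mono-≤ zero    _ _ = ℚP.≤-refl
^-mono-≤ (suc n) 0≤p p≤q = *-mono-≤₀ 0≤p p≤q (0≤^ n 0≤p) (^-mono-≤ n 0≤p p≤q)

^-mono-< : ∀ n {p q} → 0ℚ ≤ p → p < q → p ^ suc n < q ^ suc n
^-mono-< n {p} {q} 0≤p p<q = ℚP.≤-<-trans
  (ℚP.*-monoˡ-≤-nonNeg p {{nonNegative 0≤p}} (^-mono-≤ n 0≤p (ℚP.<⇒≤ p<q)))
  (ℚP.*-monoˡ-<-pos (q ^ n) {{positive (0<^ n (ℚP.≤-<-trans 0≤p p<q))}} p<q)

^-cancel-≤ : ∀ n {p q} → 0ℚ ≤ q → p ^ suc n ≤ q ^ suc n → p ≤ q
^-cancel-≤ n {p} {q} 0≤q h with p ℚP.≤? q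
... | yes p≤q = p≤q
... | no p≰q = ⊥-elim (ℚP.<-irrefl refl (ℚP.<-≤-trans (^-mono-< n 0≤q (ℚP.≰⇒> p≰q)) h))

1≤^ : ∀ {p} n → 1ℚ ≤ p → 1ℚ ≤ p ^ n
1≤^ zero    _ = ℚP.≤-refl
1≤^ (suc n) h = *-mono-≤₀ 0≤1 h 0≤1 (1≤^ n h)

^-monoʳ-≤ : ∀ {p m n} → 1ℚ ≤ p → m ℕ.≤ n → p ^ m ≤ p ^ n
^-monoʳ-≤ {n = n} h ℕ.z≤n = 1≤^ n h
^-monoʳ-≤ {p} h (ℕ.s≤s m≤n) = ℚP.*-monoˡ-≤-nonNeg p {{nonNegative (ℚP.≤-trans 0≤1 h)}} (^-monoʳ-≤ h m≤n)

bernoulli : ∀ n {p} → 0ℚ ≤ p → 1ℚ + fromℕ n * p ≤ (1ℚ + p) ^ n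
bernoulli zero {p} _ = ℚP.≤-reflexive (trans (cong (λ z → 1ℚ + z) (ℚP.*-zeroˡ p)) (ℚP.+-identityʳ 1ℚ))
bernoulli (suc n) {p} 0≤p = ℚP.≤-trans
  (subst (1ℚ + fromℕ (suc n) * p ≤_) eq (p≤p+q (0≤* (0≤fromℕ n) (0≤* 0≤p 0≤p))))
  (ℚP.*-monoˡ-≤-nonNeg (1ℚ + p) {{nonNegative (0≤+ 0≤1 0≤p)}} (bernoulli n 0≤p))
  where
    eq : (1ℚ + fromℕ (suc n) * p) + fromℕ n * (p * p) ≡ (1ℚ + p) * (1ℚ + fromℕ n * p)
    eq = trans (cong (λ z → (1ℚ + z * p) + fromℕ n * (p * p)) (fromℕ-suc n))
      (solve 2 (λ n p → (con 1ℚ :+ (con 1ℚ :+ n) :* p) :+ n :* (p :* p) := (con 1ℚ :+ p) :* (con 1ℚ :+ n :* p)) refl (fromℕ n) p)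

-- For 0 ≤ p ≤ q ≤ M and 1 ≤ M: qⁿ ≤ pⁿ + n Mⁿ (q - p).
^-lipschitz : ∀ n {p q M} → 0ℚ ≤ p → p ≤ q → q ≤ M → 1ℚ ≤ M →
  q ^ n ≤ p ^ n + fromℕ n * M ^ n * (q - p)
^-lipschitz zero {p} {q} _ _ _ _ = ℚP.≤-reflexive (solve 2 (λ p q → con 1ℚ := con 1ℚ :+ con 0ℚ :* con 1ℚ :* (q :- p)) refl p q)
^-lipschitz (suc n) {p} {q} {M} 0≤p p≤q q≤M 1≤M = begin
  q * q ^ n ≡⟨ split q (q ^ n) p (p ^ n) ⟩
  p * p ^ n + (q * (q ^ n - p ^ n) + p ^ n * (q - p))
    ≤⟨ ℚP.+-monoʳ-≤ (p * p ^ n) (ℚP.+-mono-≤ (*-mono-≤₀ 0≤q q≤M 0≤d ih)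
         (ℚP.*-monoʳ-≤-nonNeg (q - p) {{nonNegative 0≤q-p}} pⁿ≤)) ⟩
  p * p ^ n + (M * (fromℕ n * M ^ n * (q - p)) + M * M ^ n * (q - p))
    ≡⟨ collect (p * p ^ n) M (fromℕ n) (M ^ n) (q - p) ⟩
  p * p ^ n + (1ℚ + fromℕ n) * (M * M ^ n) * (q - p)
    ≡⟨ cong (λ z → p * p ^ n + z * (M * M ^ n) * (q - p)) (sym (fromℕ-suc n)) ⟩
  p * p ^ n + fromℕ (suc n) * (M * M ^ n) * (q - p) ∎
  where
    open ℚP.≤-Reasoning
    split : ∀ q a p b → q * a ≡ p * b + (q * (a - b) + b * (q - p))
    split = solve 4 (λ q a p b → q :* a := p :* b :+ (q :* (a :- b) :+ b :* (q :- p))) refl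
    collect : ∀ x M n a d → x + (M * (n * a * d) + M * a * d) ≡ x + (1ℚ + n) * (M * a) * d
    collect = solve 5 (λ x M n a d → x :+ (M :* (n :* a :* d) :+ M :* a :* d) := x :+ (con 1ℚ :+ n) :* (M :* a) :* d) refl
    0≤q : 0ℚ ≤ q
    0≤q = ℚP.≤-trans 0≤p p≤q
    sub-≤ : ∀ {a b} c → a ≤ b + c → a - b ≤ c
    sub-≤ {a} {b} c h = subst (a - b ≤_) (solve 2 (λ b c → (b :+ c) :- b := c) refl b c) (ℚP.+-monoˡ-≤ (- b) h)
    0≤sub : ∀ {a b} → a ≤ b → 0ℚ ≤ b - a
    0≤sub {a} {b} h = subst (_≤ b - a) (ℚP.+-inverseʳ a) (ℚP.+-monoˡ-≤ (- a) h)
    0≤q-p : 0ℚ ≤ q - p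
    0≤q-p = 0≤sub p≤q
    0≤d : 0ℚ ≤ q ^ n - p ^ n
    0≤d = 0≤sub (^-mono-≤ n 0≤p p≤q)
    ih : q ^ n - p ^ n ≤ fromℕ n * M ^ n * (q - p)
    ih = sub-≤ _ (^-lipschitz n 0≤p p≤q q≤M 1≤M)
    0≤M : 0ℚ ≤ M
    0≤M = ℚP.≤-trans 0≤1 1≤M
    pⁿ≤ : p ^ n ≤ M * M ^ n
    pⁿ≤ = ℚP.≤-trans (^-mono-≤ n 0≤p (ℚP.≤-trans p≤q q≤M)) (^-monoʳ-≤ 1≤M (ℕP.n≤1+n n))

-- Two-sided, located Dedekind cuts: lower x r means r < x and upper x r
-- means x < r.  That lower and upper are closed downwards and upwards
-- follows from the other fields.
record ℝ : Set₁ where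
  field
    lower upper     : ℚ → Set
    lower-inhabited : ∃ lower
    upper-inhabited : ∃ upper
    lower-rounded   : ∀ {r} → lower r → ∃[ s ] r < s × lower s
    upper-rounded   : ∀ {r} → upper r → ∃[ s ] s < r × upper s
    disjoint        : ∀ {r} → lower r → upper r → ⊥
    located         : ∀ {r s} → r < s → lower r ⊎ upper s

open ℝ public

lower-closed : ∀ (x : ℝ) {r s} → r ≤ s → lower x s → lower x r
lower-closed x {r} {s} r≤s l with r ℚP.<? s
... | no r≮s = subst (lower x) (ℚP.≤-antisym (ℚP.≮⇒≥ r≮s) r≤s) l
... | yes r<s with located x r<s
...   | inj₁ l′ = l′
...   | inj₂ u = ⊥-elim (disjoint x l u)

upper-closed : ∀ (x : ℝ) {r s} → r ≤ s → upper x r → upper x s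
upper-closed x {r} {s} r≤s u with r ℚP.<? s
... | no r≮s = subst (upper x) (ℚP.≤-antisym r≤s (ℚP.≮⇒≥ r≮s)) u
... | yes r<s with located x r<s
...   | inj₂ u′ = u′
...   | inj₁ l = ⊥-elim (disjoint x l u)

lower<upper : ∀ (x : ℝ) {r s} → lower x r → upper x s → r < s
lower<upper x {r} {s} l u with r ℚP.<? s
... | yes r<s = r<s
... | no r≮s = ⊥-elim (disjoint x l (upper-closed x (ℚP.≮⇒≥ r≮s) u))

upper-⊓ : ∀ (x : ℝ) {r s} → upper x r → upper x s → upper x (r ℚ.⊓ s)
upper-⊓ x {r} {s} hr hs with ℚP.⊓-sel r s
... | inj₁ e = subst (upper x) (sym e) hr
... | inj₂ e = subst (upper x) (sym e) hs

infix 4 _<ʳ_ _≤ʳ_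

_<ʳ_ : ℝ → ℝ → Set
x <ʳ y = ∃[ r ] upper x r × lower y r

_≤ʳ_ : ℝ → ℝ → Set
x ≤ʳ y = ∀ {r} → lower x r → lower y r

fromℚ : ℚ → ℝ
fromℚ q = record
  { lower = _< q
  ; upper = q <_
  ; lower-inhabited = q - 1ℚ , p-q<p (ℚP.positive⁻¹ 1ℚ)
  ; upper-inhabited = q + 1ℚ , p<p+q (ℚP.positive⁻¹ 1ℚ)
  ; lower-rounded = λ h → let (s , h₁ , h₂) = ℚP.<-dense h in s , h₁ , h₂
  ; upper-rounded = λ h → let (s , h₁ , h₂) = ℚP.<-dense h in s , h₂ , h₁
  ; disjoint = ℚP.<-asym
  ; located = loc
  }
  where
    loc : ∀ {r s} → r < s → r < q ⊎ q < s
    loc {r} {s} r<s with r ℚP.<? q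
    ... | yes r<q = inj₁ r<q
    ... | no r≮q = inj₂ (ℚP.≤-<-trans (ℚP.≮⇒≥ r≮q) r<s)

infix  8 -ʳ_
infixl 6 _+ʳ_ _-ʳ_
infixl 7 _·ʳ_
infixr 9 _^ʳ_
infix  9 √_

-ʳ_ : ℝ → ℝ
-ʳ x = record
  { lower = λ r → upper x (- r)
  ; upper = λ r → lower x (- r)
  ; lower-inhabited = let (r , h) = upper-inhabited x in - r , subst (upper x) (sym (neg-neg r)) h
  ; upper-inhabited = let (r , h) = lower-inhabited x in - r , subst (lower x) (sym (neg-neg r)) h
  ; lower-rounded = λ h → let (s , s<-r , h′) = upper-rounded x h in
      - s , p<-q⇒q<-p s<-r , subst (upper x) (sym (neg-neg s)) h′
  ; upper-rounded = λ h → let (s , -r<s , h′) = lower-rounded x h in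
      - s , -p<q⇒-q<p -r<s , subst (lower x) (sym (neg-neg s)) h′
  ; disjoint = λ u l → disjoint x l u
  ; located = λ r<s → swap (located x (ℚP.neg-antimono-< r<s))
  }
  where
    swap : ∀ {A B : Set} → A ⊎ B → B ⊎ A
    swap (inj₁ a) = inj₂ a
    swap (inj₂ b) = inj₁ b

_+ʳ_ : ℝ → ℚ → ℝ
x +ʳ q = record
  { lower = λ r → lower x (r - q)
  ; upper = λ r → upper x (r - q)
  ; lower-inhabited = let (r , h) = lower-inhabited x in r + q , subst (lower x) (sym (p+q-q r q)) h
  ; upper-inhabited = let (r , h) = upper-inhabited x in r + q , subst (upper x) (sym (p+q-q r q)) h
  ; lower-rounded = λ h → let (s , lt , h′) = lower-rounded x h in
      s + q , p-q<r⇒p<r+q q lt , subst (lower x) (sym (p+q-q s q)) h′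
  ; upper-rounded = λ h → let (s , lt , h′) = upper-rounded x h in
      s + q , r<p-q⇒r+q<p q lt , subst (upper x) (sym (p+q-q s q)) h′
  ; disjoint = disjoint x
  ; located = λ r<s → located x (ℚP.+-monoˡ-< (- q) r<s)
  }

_-ʳ_ : ℝ → ℚ → ℝ
x -ʳ q = x +ʳ (- q)

∣_∣ʳ : ℝ → ℝ
∣ x ∣ʳ = record
  { lower = λ r → lower x r ⊎ upper x (- r)
  ; upper = λ r → upper x r × lower x (- r)
  ; lower-inhabited = let (r , h) = lower-inhabited x in r , inj₁ h
  ; upper-inhabited = let (r , u) = upper-inhabited x ; (s , l) = lower-inhabited x in
      (r ⊔ (- s)) + 1ℚ
      , upper-closed x (ℚP.<⇒≤ (p<p⊔q+1 r (- s))) u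
      , lower-closed x (ℚP.<⇒≤ (-p<q⇒-q<p (q<p⊔q+1 r (- s)))) l
  ; lower-rounded = low
  ; upper-rounded = λ (u , l) → let (s , s<r , u′) = upper-rounded x u ; (t , -r<t , l′) = lower-rounded x l in
      s ⊔ (- t)
      , p⊔q<r s<r (-p<q⇒-q<p -r<t)
      , upper-closed x (ℚP.p≤p⊔q s (- t)) u′
      , lower-closed x (subst (- (s ⊔ (- t)) ≤_) (neg-neg t) (ℚP.neg-antimono-≤ (ℚP.p≤q⊔p s (- t)))) l′
  ; disjoint = λ { (inj₁ l) (u , _) → disjoint x l u ; (inj₂ u) (_ , l) → disjoint x l u }
  ; located = loc
  }
  where
    low : ∀ {r} → lower x r ⊎ upper x (- r) → ∃[ s ] r < s × (lower x s ⊎ upper x (- s))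
    low (inj₁ l) = let (s , lt , l′) = lower-rounded x l in s , lt , inj₁ l′
    low (inj₂ u) = let (s , lt , u′) = upper-rounded x u in
      - s , p<-q⇒q<-p lt , inj₂ (subst (upper x) (sym (neg-neg s)) u′)
    loc : ∀ {r s} → r < s → (lower x r ⊎ upper x (- r)) ⊎ (upper x s × lower x (- s))
    loc r<s with located x r<s | located x (ℚP.neg-antimono-< r<s)
    ... | inj₁ l | _      = inj₁ (inj₁ l)
    ... | inj₂ _ | inj₂ u = inj₁ (inj₂ u)
    ... | inj₂ u | inj₁ l = inj₂ (u , l)

_·ʳ_ : (c : ℚ) .{{_ : Positive c}} → ℝ → ℝ
c ·ʳ x = record
  { lower = λ r → lower x (r * c⁻¹)
  ; upper = λ r → upper x (r * c⁻¹)
  ; lower-inhabited = let (r , h) = lower-inhabited x in r * c , subst (lower x) (sym (cancel r)) h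
  ; upper-inhabited = let (r , h) = upper-inhabited x in r * c , subst (upper x) (sym (cancel r)) h
  ; lower-rounded = λ {r} h → let (s , lt , h′) = lower-rounded x h in
      s * c , subst (_< s * c) (cancel′ r) (ℚP.*-monoˡ-<-pos c lt) , subst (lower x) (sym (cancel s)) h′
  ; upper-rounded = λ {r} h → let (s , lt , h′) = upper-rounded x h in
      s * c , subst (s * c <_) (cancel′ r) (ℚP.*-monoˡ-<-pos c lt) , subst (upper x) (sym (cancel s)) h′
  ; disjoint = disjoint x
  ; located = λ r<s → located x (ℚP.*-monoˡ-<-pos c⁻¹ {{ℚP.1/pos⇒pos c}} r<s)
  }
  where
    instance
      nz : ℚ.NonZero c
      nz = ℚP.pos⇒nonZero c
    c⁻¹ : ℚ
    c⁻¹ = 1/ c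
    cancel : ∀ r → (r * c) * c⁻¹ ≡ r
    cancel r = trans (ℚP.*-assoc r c c⁻¹) (trans (cong (r *_) (ℚP.*-inverseʳ c)) (ℚP.*-identityʳ r))
    cancel′ : ∀ r → (r * c⁻¹) * c ≡ r
    cancel′ r = trans (ℚP.*-assoc r c⁻¹ c) (trans (cong (r *_) (ℚP.*-inverseˡ c)) (ℚP.*-identityʳ r))

√_ : ℕ → ℝ
√ n = record
  { lower = λ r → ∃[ s ] 0ℚ ≤ s × r < s × s * s ≤ fromℕ n
  ; upper = λ r → ∃[ s ] 0ℚ ≤ s × s < r × fromℕ n ≤ s * s
  ; lower-inhabited = - 1ℚ , 0ℚ , ℚP.≤-refl , ℚP.negative⁻¹ (- 1ℚ) , 0≤fromℕ n
  ; upper-inhabited = 1ℚ + fromℕ n + 1ℚ , 1ℚ + fromℕ n , 0≤1+n , p<p+q (ℚP.positive⁻¹ 1ℚ) ,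
      ℚP.≤-trans n≤1+n (subst (_≤ (1ℚ + fromℕ n) * (1ℚ + fromℕ n)) (ℚP.*-identityˡ (1ℚ + fromℕ n))
        (ℚP.*-monoʳ-≤-nonNeg (1ℚ + fromℕ n) {{nonNegative 0≤1+n}} {1ℚ} {1ℚ + fromℕ n} (p≤p+q (0≤fromℕ n))))
  ; lower-rounded = λ (s , 0≤s , r<s , h) → let (t , r<t , t<s) = ℚP.<-dense r<s in
      t , r<t , s , 0≤s , t<s , h
  ; upper-rounded = λ (s , 0≤s , s<r , h) → let (t , s<t , t<r) = ℚP.<-dense s<r in
      t , t<r , s , 0≤s , s<t , h
  ; disjoint = λ (s , 0≤s , r<s , h) (t , 0≤t , t<r , h′) →
      let t<s = ℚP.<-trans t<r r<s in
      ℚP.<-irrefl refl (ℚP.<-≤-trans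
        (ℚP.≤-<-trans (ℚP.*-monoˡ-≤-nonNeg t {{nonNegative 0≤t}} (ℚP.<⇒≤ t<s))
          (ℚP.*-monoˡ-<-pos s {{positive (ℚP.≤-<-trans 0≤t t<s)}} t<s))
        (ℚP.≤-trans h h′))
  ; located = loc
  }
  where
    0≤1+n : 0ℚ ≤ 1ℚ + fromℕ n
    0≤1+n = 0≤+ 0≤1 (0≤fromℕ n)
    n≤1+n : fromℕ n ≤ 1ℚ + fromℕ n
    n≤1+n = subst (fromℕ n ≤_) (ℚP.+-comm (fromℕ n) 1ℚ) (p≤p+q 0≤1)
    loc : ∀ {r s} → r < s →
      (∃[ t ] 0ℚ ≤ t × r < t × t * t ≤ fromℕ n) ⊎ (∃[ t ] 0ℚ ≤ t × t < s × fromℕ n ≤ t * t)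
    loc {r} {s} r<s = let (t , r<t , t<s) = ℚP.<-dense r<s in decide t r<t t<s (r ℚP.<? 0ℚ) (t * t ℚP.≤? fromℕ n)
      where
        decide : ∀ t → r < t → t < s → Dec (r < 0ℚ) → Dec (t * t ≤ fromℕ n) →
          (∃[ t ] 0ℚ ≤ t × r < t × t * t ≤ fromℕ n) ⊎ (∃[ t ] 0ℚ ≤ t × t < s × fromℕ n ≤ t * t)
        decide t r<t t<s (yes r<0) _ = inj₁ (0ℚ , ℚP.≤-refl , r<0 , 0≤fromℕ n)
        decide t r<t t<s (no r≮0) (yes h) = inj₁ (t , ℚP.≤-trans (ℚP.≮⇒≥ r≮0) (ℚP.<⇒≤ r<t) , r<t , h)
        decide t r<t t<s (no r≮0) (no h) = inj₂ (t , ℚP.≤-trans (ℚP.≮⇒≥ r≮0) (ℚP.<⇒≤ r<t) , t<s , ℚP.<⇒≤ (ℚP.≰⇒> h))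

-- A cut crosses any increasing sequence of rationals between two
-- terms at most two steps apart.
crossing : ∀ (x : ℝ) (g : ℕ → ℚ) → (∀ n → g n < g (suc n)) →
  ∀ i m → lower x (g m) → upper x (g (i ℕ.+ m)) → ∃[ k ] lower x (g k) × upper x (g (2 ℕ.+ k))
crossing x g inc zero m l u = ⊥-elim (disjoint x l u)
crossing x g inc (suc i) m l u with located x (inc (suc m))
... | inj₂ u′ = m , l , u′
... | inj₁ l′ = crossing x g inc i (suc m) l′ (subst (λ k → upper x (g k)) (sym (ℕP.+-suc i m)) u)

approximate : ∀ (x : ℝ) {l δ} → lower x l → 0ℚ < δ → ∃[ s ] l ≤ s × lower x s × upper x (s + δ)
approximate x {l} {δ} hl 0<δ = found
  where
    ε : ℚ
    ε = ½ * δ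
    0<ε : 0ℚ < ε
    0<ε = 0<* (ℚP.positive⁻¹ ½) 0<δ
    g : ℕ → ℚ
    g n = l + fromℕ n * ε
    g-suc : ∀ n → g (suc n) ≡ g n + ε
    g-suc n = trans (cong (λ z → l + z * ε) (fromℕ-suc n))
      (solve 3 (λ l n e → l :+ (con 1ℚ :+ n) :* e := (l :+ n :* e) :+ e) refl l (fromℕ n) ε)
    g-zero : g 0 ≡ l
    g-zero = trans (cong (λ z → l + z) (ℚP.*-zeroˡ ε)) (ℚP.+-identityʳ l)
    inc : ∀ n → g n < g (suc n)
    inc n = subst (g n <_) (sym (g-suc n)) (p<p+q 0<ε)
    g-suc² : ∀ k → g (2 ℕ.+ k) ≡ g k + δ
    g-suc² k = trans (g-suc (suc k)) (trans (cong (_+ ε) (g-suc k))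
      (solve 2 (λ a d → (a :+ con ½ :* d) :+ con ½ :* d := a :+ d) refl (g k) δ))
    top : ∃[ N ] upper x (g N)
    top = let (u , hu) = upper-inhabited x ; (N , h) = archimedean-* (u - l) 0<ε in
      N , upper-closed x (ℚP.<⇒≤ (subst (_< g N) (p+[q-p] l u) (ℚP.+-monoʳ-< l h))) hu
    found : ∃[ s ] l ≤ s × lower x s × upper x (s + δ)
    found = let (N , hN) = top
                (k , h₁ , h₂) = crossing x g inc N 0 (subst (lower x) (sym g-zero) hl)
                  (subst (λ n → upper x (g n)) (sym (ℕP.+-identityʳ N)) hN)
            in g k , p≤p+q (0≤* (0≤fromℕ k) (ℚP.<⇒≤ 0<ε)) , h₁ , subst (upper x) (g-suc² k) h₂

pow : (x : ℝ) → fromℚ 0ℚ <ʳ x → ℕ → ℝ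
pow x (s₀ , 0<s₀ , ls₀) n = record
  { lower = λ r → ∃[ s ] 0ℚ ≤ s × lower x s × r < s ^ n
  ; upper = λ r → ∃[ s ] 0ℚ ≤ s × upper x s × s ^ n < r
  ; lower-inhabited = - 1ℚ , s₀ , 0≤s₀ , ls₀ , ℚP.<-≤-trans (ℚP.negative⁻¹ (- 1ℚ)) (0≤^ n 0≤s₀)
  ; upper-inhabited = let (u , hu) = upper-inhabited x in
      u ^ n + 1ℚ , u , ℚP.<⇒≤ (ℚP.<-trans 0<s₀ (lower<upper x ls₀ hu)) , hu , p<p+q (ℚP.positive⁻¹ 1ℚ)
  ; lower-rounded = λ (s , 0≤s , l , h) → let (t , h₁ , h₂) = ℚP.<-dense h in t , h₁ , s , 0≤s , l , h₂
  ; upper-rounded = λ (s , 0≤s , u , h) → let (t , h₁ , h₂) = ℚP.<-dense h in t , h₂ , s , 0≤s , u , h₁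
  ; disjoint = λ (s , 0≤s , l , h) (t , 0≤t , u , h′) →
      ℚP.<-irrefl refl (ℚP.<-≤-trans (ℚP.<-trans h′ h) (^-mono-≤ n 0≤s (ℚP.<⇒≤ (lower<upper x l u))))
  ; located = loc
  }
  where
    0≤s₀ : 0ℚ ≤ s₀
    0≤s₀ = ℚP.<⇒≤ 0<s₀
    M : ℚ
    M = (proj₁ (upper-inhabited x) ⊔ 1ℚ) + 1ℚ
    1≤M : 1ℚ ≤ M
    1≤M = ℚP.<⇒≤ (q<p⊔q+1 (proj₁ (upper-inhabited x)) 1ℚ)
    uM : upper x M
    uM = upper-closed x (ℚP.<⇒≤ (p<p⊔q+1 (proj₁ (upper-inhabited x)) 1ℚ)) (proj₂ (upper-inhabited x))
    K : ℚ
    K = fromℕ n * M ^ n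
    0≤K : 0ℚ ≤ K
    0≤K = 0≤* (0≤fromℕ n) (0≤^ n (ℚP.≤-trans 0≤1 1≤M))
    0<1+K : 0ℚ < 1ℚ + K
    0<1+K = ℚP.<-≤-trans (ℚP.positive⁻¹ 1ℚ) (p≤p+q 0≤K)
    loc : ∀ {r r′} → r < r′ →
      (∃[ s ] 0ℚ ≤ s × lower x s × r < s ^ n) ⊎ (∃[ s ] 0ℚ ≤ s × upper x s × s ^ n < r′)
    loc {r} {r′} r<r′ = found
      where
        instance
          nz : ℚ.NonZero (1ℚ + K)
          nz = ℚP.pos⇒nonZero (1ℚ + K) {{positive 0<1+K}}
        δ₁ : ℚ
        δ₁ = (r′ - r) * 1/ (1ℚ + K)
        0<δ₁ : 0ℚ < δ₁
        0<δ₁ = 0<* (p<q⇒0<q-p r<r′) (ℚP.positive⁻¹ (1/ (1ℚ + K)) {{ℚP.1/pos⇒pos (1ℚ + K) {{positive 0<1+K}}}})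
        δ₁-eq : (1ℚ + K) * δ₁ ≡ r′ - r
        δ₁-eq = trans (solve 3 (λ a d i → a :* (d :* i) := d :* (a :* i)) refl (1ℚ + K) (r′ - r) (1/ (1ℚ + K)))
          (trans (cong ((r′ - r) *_) (ℚP.*-inverseʳ (1ℚ + K))) (ℚP.*-identityʳ (r′ - r)))
        gap : K * δ₁ < r′ - r
        gap = subst (K * δ₁ <_) δ₁-eq (subst (K * δ₁ <_)
          (solve 2 (λ k d → k :* d :+ d := (con 1ℚ :+ k) :* d) refl K δ₁) (p<p+q 0<δ₁))
        decide : ∀ s t → 0ℚ ≤ s → lower x s → upper x t → t ≤ s + δ₁ → t ≤ M → s ≤ t →
          Dec (r < s ^ n) → (∃[ s ] 0ℚ ≤ s × lower x s × r < s ^ n) ⊎ (∃[ s ] 0ℚ ≤ s × upper x s × s ^ n < r′)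
        decide s t 0≤s ls ut t≤s+δ₁ t≤M s≤t (yes h) = inj₁ (s , 0≤s , ls , h)
        decide s t 0≤s ls ut t≤s+δ₁ t≤M s≤t (no h) = inj₂ (t , ℚP.≤-trans 0≤s s≤t , ut ,
          ℚP.≤-<-trans (^-lipschitz n 0≤s s≤t t≤M 1≤M)
            (subst (s ^ n + K * (t - s) <_) (p+[q-p] r r′) (ℚP.+-mono-≤-< (ℚP.≮⇒≥ h)
              (ℚP.≤-<-trans (ℚP.*-monoˡ-≤-nonNeg K {{nonNegative 0≤K}} t-s≤δ₁) gap))))
          where
            t-s≤δ₁ : t - s ≤ δ₁
            t-s≤δ₁ = subst (t - s ≤_) (solve 2 (λ s d → (s :+ d) :- s := d) refl s δ₁) (ℚP.+-monoˡ-≤ (- s) t≤s+δ₁)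
        found : (∃[ s ] 0ℚ ≤ s × lower x s × r < s ^ n) ⊎ (∃[ s ] 0ℚ ≤ s × upper x s × s ^ n < r′)
        found = let (s , s₀≤s , ls , us) = approximate x ls₀ 0<δ₁
                    ut = upper-⊓ x us uM
                in decide s ((s + δ₁) ℚ.⊓ M) (ℚP.≤-trans 0≤s₀ s₀≤s) ls ut
                     (ℚP.p⊓q≤p (s + δ₁) M) (ℚP.p⊓q≤q (s + δ₁) M) (ℚP.<⇒≤ (lower<upper x ls ut)) (r ℚP.<? s ^ n)

frac : ℕ → ℕ → ℕ → ℚ
frac m n k = (+ m ℤ.- + n) / suc k

frac-* : ∀ m n k → frac m n k * fromℕ (suc k) ≡ fromℕ m - fromℕ n
frac-* m n k = trans (/-* (+ m ℤ.- + n) k) (trans (fromℤ-+ (+ m) (ℤ.- + n)) (cong (λ z → fromℕ m + z) (fromℤ-neg (+ n))))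
  where
    fromℤ-neg : ∀ i → fromℤ (ℤ.- i) ≡ - fromℤ i
    fromℤ-neg (+ zero) = refl
    fromℤ-neg ℤ.+[1+ n ] = refl
    fromℤ-neg -[1+ n ] = sym (neg-neg (fromℕ (suc n)))

-- b ^ʳ x is the supremum of the rational powers b^((m-n)/(k+1)) with
-- (m-n)/(k+1) < x, and the infimum of those with (m-n)/(k+1) > x; for
-- s ≥ 0, the relation s ≤ b^((m-n)/(k+1)) is s^(k+1) b^n ≤ b^m.
_^ʳ_ : (b : ℕ) .{{_ : ℕ.NonZero b}} → ℝ → ℝ
b@(suc b′) ^ʳ x = record
  { lower = Low
  ; upper = Upp
  ; lower-inhabited = - 1ℚ , negative-low (ℚP.negative⁻¹ (- 1ℚ))
  ; upper-inhabited =
      let (m , um) = high 0 {0} in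
      B ^ m + 1ℚ , B ^ m , m , 0 , 0 , 0≤^ m 0≤B , p<p+q (ℚP.positive⁻¹ 1ℚ) , um ,
      ℚP.≤-reflexive (solve 1 (λ z → z := z :* con 1ℚ :* con 1ℚ) refl (B ^ m))
  ; lower-rounded = λ (s , m , n , k , 0≤s , r<s , l , h) → let (t , r<t , t<s) = ℚP.<-dense r<s in
      t , r<t , s , m , n , k , 0≤s , t<s , l , h
  ; upper-rounded = λ (s , m , n , k , 0≤s , s<r , u , h) → let (t , s<t , t<r) = ℚP.<-dense s<r in
      t , t<r , s , m , n , k , 0≤s , s<t , u , h
  ; disjoint = disj
  ; located = loc
  }
  where
    B : ℚ
    B = fromℕ b
    1≤B : 1ℚ ≤ B
    1≤B = 1≤fromℕ-suc b′
    0≤B : 0ℚ ≤ B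
    0≤B = ℚP.≤-trans 0≤1 1≤B
    0<B : 0ℚ < B
    0<B = 0<fromℕ-suc b′
    Low Upp : ℚ → Set
    Low r = ∃[ s ] ∃[ m ] ∃[ n ] ∃[ k ] 0ℚ ≤ s × r < s × lower x (frac m n k) × s ^ suc k * B ^ n ≤ B ^ m
    Upp r = ∃[ s ] ∃[ m ] ∃[ n ] ∃[ k ] 0ℚ ≤ s × s < r × upper x (frac m n k) × B ^ m ≤ s ^ suc k * B ^ n
    K-pos : ∀ k → Positive (fromℕ (suc k))
    K-pos k = positive (0<fromℕ-suc k)
    compare : ∀ k {p q} → p * fromℕ (suc k) < q * fromℕ (suc k) → p < q
    compare k = ℚP.*-cancelʳ-<-nonNeg (fromℕ (suc k)) {{nonNegative (0≤fromℕ (suc k))}}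
    low : ∀ k → ∃[ n ] lower x (frac 0 n k)
    low k = let (l , hl) = lower-inhabited x ; (n , h) = archimedean (- (l * fromℕ (suc k))) in
      n , lower-closed x (ℚP.<⇒≤ (compare k (subst (_< l * fromℕ (suc k)) (sym (trans (frac-* 0 n k) (ℚP.+-identityˡ (- fromℕ n))))
        (-p<q⇒-q<p h)))) hl
    high : ∀ k {n} → ∃[ m ] upper x (frac m n k)
    high k {n} = let (u , hu) = upper-inhabited x ; (m , h) = archimedean (u * fromℕ (suc k) + fromℕ n) in
      m , upper-closed x (ℚP.<⇒≤ (compare k (subst (u * fromℕ (suc k) <_) (sym (frac-* m n k))
        (subst (_< fromℕ m - fromℕ n) (p+q-q (u * fromℕ (suc k)) (fromℕ n)) (ℚP.+-monoˡ-< (- fromℕ n) h))))) hu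
    negative-low : ∀ {r} → r < 0ℚ → Low r
    negative-low r<0 = let (n , l) = low 0 in
      0ℚ , 0 , n , 0 , ℚP.≤-refl , r<0 , l , subst (_≤ 1ℚ) (sym (ℚP.*-zeroˡ (B ^ n))) 0≤1
    grid : ∀ k → ∃[ m ] ∃[ n ] lower x (frac m n k) × upper x (frac (2 ℕ.+ m) n k)
    grid k = let (n , l) = low k
                 (N , u) = high k {n}
                 (m , h₁ , h₂) = crossing x (λ m → frac m n k) (inc n) N 0 l
                   (subst (λ m → upper x (frac m n k)) (sym (ℕP.+-identityʳ N)) u)
             in m , n , h₁ , h₂
      where
        inc : ∀ n m → frac m n k < frac (suc m) n k
        inc n m = compare k (subst₂ _<_ (sym (frac-* m n k)) (sym (frac-* (suc m) n k))
          (ℚP.+-monoˡ-< (- fromℕ n) (fromℤ-mono-< {+ m} {+ suc m} (ℤ.+<+ (ℕP.n<1+n m)))))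
    cross : ∀ {m n k m′ n′ k′} → frac m n k < frac m′ n′ k′ →
      m ℕ.* suc k′ ℕ.+ n′ ℕ.* suc k ℕ.≤ m′ ℕ.* suc k ℕ.+ n ℕ.* suc k′
    cross {m} {n} {k} {m′} {n′} {k′} lt with (m ℕ.* suc k′ ℕ.+ n′ ℕ.* suc k) ℕP.≤? (m′ ℕ.* suc k ℕ.+ n ℕ.* suc k′)
    ... | yes h = h
    ... | no h = ⊥-elim (ℚP.<-asym lt″ (fromℤ-mono-< {+ (m′ ℕ.* suc k ℕ.+ n ℕ.* suc k′)} {+ (m ℕ.* suc k′ ℕ.+ n′ ℕ.* suc k)} (ℤ.+<+ (ℕP.≰⇒> h))))
      where
        c c′ : ℚ
        c = fromℕ (suc k)
        c′ = fromℕ (suc k′)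
        lt′ : (fromℕ m - fromℕ n) * c′ < (fromℕ m′ - fromℕ n′) * c
        lt′ = subst₂ _<_ (cong (_* c′) (frac-* m n k))
          (trans (*-assoc-comm (frac m′ n′ k′) c c′) (cong (_* c) (frac-* m′ n′ k′)))
          (ℚP.*-monoˡ-<-pos c′ {{K-pos k′}} (ℚP.*-monoˡ-<-pos c {{K-pos k}} lt))
        hom : ∀ a i b j → fromℕ (a ℕ.* i ℕ.+ b ℕ.* j) ≡ fromℕ a * fromℕ i + fromℕ b * fromℕ j
        hom a i b j = trans (fromℕ-+ (a ℕ.* i) (b ℕ.* j)) (cong₂ _+_ (fromℕ-* a i) (fromℕ-* b j))
        lt″ : fromℕ (m ℕ.* suc k′ ℕ.+ n′ ℕ.* suc k) < fromℕ (m′ ℕ.* suc k ℕ.+ n ℕ.* suc k′)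
        lt″ = subst₂ _<_
          (trans (solve 5 (λ a b c d e → (a :- b) :* c :+ (b :* c :+ d :* e) := a :* c :+ d :* e) refl (fromℕ m) (fromℕ n) c′ (fromℕ n′) c)
            (sym (hom m (suc k′) n′ (suc k))))
          (trans (solve 5 (λ a d e b c → (a :- d) :* e :+ (b :* c :+ d :* e) := a :* e :+ b :* c) refl (fromℕ m′) (fromℕ n′) c (fromℕ n) c′)
            (sym (hom m′ (suc k) n (suc k′))))
          (ℚP.+-monoˡ-< (fromℕ n * c′ + fromℕ n′ * c) lt′)
    disj : ∀ {r} → Low r → Upp r → ⊥
    disj (s , m , n , k , 0≤s , r<s , l , h) (s′ , m′ , n′ , k′ , 0≤s′ , s′<r , u , h′) =
      ℚP.<-irrefl refl (ℚP.<-≤-trans (ℚP.<-trans s′<r r<s) (^-cancel-≤ (k′ ℕ.+ k ℕ.* suc k′) 0≤s′ final))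
      where
        a a′ : ℚ
        a = s ^ suc k
        a′ = s′ ^ suc k′
        0≤a : 0ℚ ≤ a
        0≤a = 0≤^ (suc k) 0≤s
        0≤a′ : 0ℚ ≤ a′
        0≤a′ = 0≤^ (suc k′) 0≤s′
        -- b^(n k′) s^(k k′) ≤ b^(m k′) and b^(m′ k) ≤ s′^(k k′) b^(n′ k), writing k for k + 1
        h₁ : a ^ suc k′ * B ^ (n ℕ.* suc k′) ≤ B ^ (m ℕ.* suc k′)
        h₁ = subst₂ _≤_ (trans (^-distrib-* a (B ^ n) (suc k′)) (cong (a ^ suc k′ *_) (^-assocʳ B n (suc k′)))) (^-assocʳ B m (suc k′))
          (^-mono-≤ (suc k′) (0≤* 0≤a (0≤^ n 0≤B)) h)
        h₂ : B ^ (m′ ℕ.* suc k) ≤ a′ ^ suc k * B ^ (n′ ℕ.* suc k)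
        h₂ = subst₂ _≤_ (^-assocʳ B m′ (suc k)) (trans (^-distrib-* a′ (B ^ n′) (suc k)) (cong (a′ ^ suc k *_) (^-assocʳ B n′ (suc k))))
          (^-mono-≤ (suc k) (0≤^ m′ 0≤B) h′)
        T : ℚ
        T = B ^ (m′ ℕ.* suc k ℕ.+ n ℕ.* suc k′)
        0<T : 0ℚ < T
        0<T = 0<^ (m′ ℕ.* suc k ℕ.+ n ℕ.* suc k′) 0<B
        A A′ : ℚ
        A = a ^ suc k′
        A′ = a′ ^ suc k
        0≤A : 0ℚ ≤ A
        0≤A = 0≤^ (suc k′) 0≤a
        0≤A′ : 0ℚ ≤ A′
        0≤A′ = 0≤^ (suc k) 0≤a′
        chain : A * T ≤ A′ * T
        chain = begin
          A * T ≡⟨ cong (A *_) (^-homo-* B (m′ ℕ.* suc k) (n ℕ.* suc k′)) ⟩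
          A * (B ^ (m′ ℕ.* suc k) * B ^ (n ℕ.* suc k′))
            ≡⟨ solve 3 (λ p q r → p :* (q :* r) := (p :* r) :* q) refl A (B ^ (m′ ℕ.* suc k)) (B ^ (n ℕ.* suc k′)) ⟩
          (A * B ^ (n ℕ.* suc k′)) * B ^ (m′ ℕ.* suc k)
            ≤⟨ *-mono-≤₀ (0≤* 0≤A (0≤^ (n ℕ.* suc k′) 0≤B)) h₁ (0≤^ (m′ ℕ.* suc k) 0≤B) h₂ ⟩
          B ^ (m ℕ.* suc k′) * (A′ * B ^ (n′ ℕ.* suc k))
            ≡⟨ solve 3 (λ p q r → p :* (q :* r) := q :* (p :* r)) refl (B ^ (m ℕ.* suc k′)) A′ (B ^ (n′ ℕ.* suc k)) ⟩
          A′ * (B ^ (m ℕ.* suc k′) * B ^ (n′ ℕ.* suc k))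
            ≡⟨ cong (A′ *_) (sym (^-homo-* B (m ℕ.* suc k′) (n′ ℕ.* suc k))) ⟩
          A′ * B ^ (m ℕ.* suc k′ ℕ.+ n′ ℕ.* suc k)
            ≤⟨ ℚP.*-monoˡ-≤-nonNeg A′ {{nonNegative 0≤A′}} (^-monoʳ-≤ 1≤B (cross {m} {n} {k} {m′} {n′} {k′} (lower<upper x l u))) ⟩
          A′ * T ∎
          where open ℚP.≤-Reasoning
        final : s ^ suc (k′ ℕ.+ k ℕ.* suc k′) ≤ s′ ^ suc (k′ ℕ.+ k ℕ.* suc k′)
        final = subst₂ _≤_ (^-assocʳ s (suc k) (suc k′))
          (trans (^-assocʳ s′ (suc k′) (suc k)) (cong (s′ ^_) (ℕP.*-comm (suc k′) (suc k))))
          (ℚP.*-cancelʳ-≤-pos T {{positive 0<T}} chain)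
    -- For 0 < s < s′ there is k with b² s^(k+1) ≤ s′^(k+1).
    spread : ∀ {s s′} → 0ℚ < s → s < s′ → ∃[ k ] (B * B) * s ^ suc k ≤ s′ ^ suc k
    spread {s} {s′} 0<s s<s′ = let (k , h) = archimedean-* (B * B) 0<t in k , bound k h
      where
        instance
          nz : ℚ.NonZero s
          nz = ℚP.pos⇒nonZero s {{positive 0<s}}
        t : ℚ
        t = (s′ - s) * 1/ s
        0<t : 0ℚ < t
        0<t = 0<* (p<q⇒0<q-p s<s′) (ℚP.positive⁻¹ (1/ s) {{ℚP.1/pos⇒pos s {{positive 0<s}}}})
        s′-eq : (1ℚ + t) * s ≡ s′
        s′-eq = trans (solve 3 (λ d i s → (con 1ℚ :+ d :* i) :* s := s :+ d :* (i :* s)) refl (s′ - s) (1/ s) s)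
          (trans (cong (λ z → s + (s′ - s) * z) (ℚP.*-inverseˡ s))
            (trans (cong (λ z → s + z) (ℚP.*-identityʳ (s′ - s))) (p+[q-p] s s′)))
        bound : ∀ k → B * B < fromℕ k * t → (B * B) * s ^ suc k ≤ s′ ^ suc k
        bound k h = subst ((B * B) * s ^ suc k ≤_) (trans (sym (^-distrib-* (1ℚ + t) s (suc k))) (cong (_^ suc k) s′-eq))
          (ℚP.*-monoʳ-≤-nonNeg (s ^ suc k) {{nonNegative (0≤^ (suc k) (ℚP.<⇒≤ 0<s))}}
            (ℚP.≤-trans (ℚP.<⇒≤ h) (ℚP.≤-trans
              (ℚP.*-monoʳ-≤-nonNeg t {{nonNegative (ℚP.<⇒≤ 0<t)}} (fromℤ-mono-≤ {+ k} {+ suc k} (ℤ.+≤+ (ℕP.n≤1+n k))))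
              (ℚP.≤-trans (subst (fromℕ (suc k) * t ≤_) (ℚP.+-comm (fromℕ (suc k) * t) 1ℚ) (p≤p+q 0≤1))
                (bernoulli (suc k) (ℚP.<⇒≤ 0<t))))))
    loc : ∀ {r r′} → r < r′ → Low r ⊎ Upp r′
    loc {r} {r′} r<r′ = choose (r ℚP.<? 0ℚ)
      where
        step : ∀ {s s′ m n k} → (B * B) * s ^ suc k ≤ s′ ^ suc k → B ^ m ≤ s ^ suc k * B ^ n →
          B ^ (2 ℕ.+ m) ≤ s′ ^ suc k * B ^ n
        step {s} {s′} {m} {n} {k} wide h = begin
          B * (B * B ^ m) ≡⟨ sym (ℚP.*-assoc B B (B ^ m)) ⟩
          (B * B) * B ^ m ≤⟨ ℚP.*-monoˡ-≤-nonNeg (B * B) {{nonNegative (0≤* 0≤B 0≤B)}} h ⟩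
          (B * B) * (s ^ suc k * B ^ n) ≡⟨ sym (ℚP.*-assoc (B * B) (s ^ suc k) (B ^ n)) ⟩
          ((B * B) * s ^ suc k) * B ^ n ≤⟨ ℚP.*-monoʳ-≤-nonNeg (B ^ n) {{nonNegative (0≤^ n 0≤B)}} wide ⟩
          s′ ^ suc k * B ^ n ∎
          where open ℚP.≤-Reasoning
        decide : ∀ {s s′ m n k} → 0ℚ < s → r < s → s < s′ → s′ < r′ → (B * B) * s ^ suc k ≤ s′ ^ suc k →
          lower x (frac m n k) → upper x (frac (2 ℕ.+ m) n k) → Dec (s ^ suc k * B ^ n ≤ B ^ m) → Low r ⊎ Upp r′
        decide {s} {s′} {m} {n} {k} 0<s r<s _ _ _ l _ (yes h) = inj₁ (s , m , n , k , ℚP.<⇒≤ 0<s , r<s , l , h)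
        decide {s} {s′} {m} {n} {k} 0<s _ s<s′ s′<r′ wide _ u (no h) = inj₂
          (s′ , 2 ℕ.+ m , n , k , ℚP.<⇒≤ (ℚP.<-trans 0<s s<s′) , s′<r′ , u , step {s} {s′} {m} {n} {k} wide (ℚP.<⇒≤ (ℚP.≰⇒> h)))
        choose : Dec (r < 0ℚ) → Low r ⊎ Upp r′
        choose (yes r<0) = inj₁ (negative-low r<0)
        choose (no r≮0) =
          let (s′ , r<s′ , s′<r′) = ℚP.<-dense r<r′
              (s , r<s , s<s′) = ℚP.<-dense r<s′
              0<s = ℚP.≤-<-trans (ℚP.≮⇒≥ r≮0) r<s
              (k , wide) = spread 0<s s<s′
              (m , n , l , u) = grid k
          in decide {s} {s′} {m} {n} {k} 0<s r<s s<s′ s′<r′ wide l u (s ^ suc k * B ^ n ℚP.≤? B ^ m)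

-- harmonic a l = 1/(a+1) + ⋯ + 1/(a+l)
harmonic : ℕ → ℕ → ℚ
harmonic a zero    = 0ℚ
harmonic a (suc l) = + 1 / suc a + harmonic (suc a) l

harmonic-+ : ∀ a l l′ → harmonic a (l ℕ.+ l′) ≡ harmonic a l + harmonic (a ℕ.+ l) l′
harmonic-+ a zero l′ = trans (cong (λ z → harmonic z l′) (sym (ℕP.+-identityʳ a))) (sym (ℚP.+-identityˡ _))
harmonic-+ a (suc l) l′ = trans (cong (λ z → + 1 / suc a + z) (harmonic-+ (suc a) l l′))
  (trans (sym (ℚP.+-assoc (+ 1 / suc a) (harmonic (suc a) l) _))
    (cong (λ z → (+ 1 / suc a + harmonic (suc a) l) + harmonic z l′) (sym (ℕP.+-suc a l))))

harmonic-≥ : ∀ l a {q} → (∀ b → b ℕ.< a ℕ.+ l → q ≤ + 1 / suc b) → fromℕ l * q ≤ harmonic a l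
harmonic-≥ zero a {q} h = ℚP.≤-reflexive (ℚP.*-zeroˡ q)
harmonic-≥ (suc l) a {q} h = subst (_≤ harmonic a (suc l))
  (sym (trans (cong (_* q) (fromℕ-suc l)) (solve 2 (λ l q → (con 1ℚ :+ l) :* q := q :+ l :* q) refl (fromℕ l) q)))
  (ℚP.+-mono-≤ (h a (ℕP.m<m+n a (ℕ.s≤s ℕ.z≤n)))
    (harmonic-≥ l (suc a) (λ b b< → h b (subst (b ℕ.<_) (sym (ℕP.+-suc a l)) b<))))

harmonic-≤ : ∀ l a {q} → (∀ b → a ℕ.≤ b → + 1 / suc b ≤ q) → harmonic a l ≤ fromℕ l * q
harmonic-≤ zero a {q} h = ℚP.≤-reflexive (sym (ℚP.*-zeroˡ q))
harmonic-≤ (suc l) a {q} h = subst (harmonic a (suc l) ≤_)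
  (sym (trans (cong (_* q) (fromℕ-suc l)) (solve 2 (λ l q → (con 1ℚ :+ l) :* q := q :+ l :* q) refl (fromℕ l) q)))
  (ℚP.+-mono-≤ (h a ℕP.≤-refl) (harmonic-≤ l (suc a) (λ b a≤b → h b (ℕP.<⇒≤ a≤b))))

harmonic-antimono : ∀ {a b} l → a ℕ.≤ b → harmonic b l ≤ harmonic a l
harmonic-antimono zero _ = ℚP.≤-refl
harmonic-antimono (suc l) a≤b = ℚP.+-mono-≤ (unit-fraction-antimono a≤b) (harmonic-antimono l (ℕ.s≤s a≤b))

harmonic-telescope : ∀ a l → harmonic a l ≤ harmonic (suc a) l + + 1 / suc a
harmonic-telescope a zero = subst (0ℚ ≤_) (sym (ℚP.+-identityˡ (+ 1 / suc a))) (ℚP.<⇒≤ (0<unit-fraction a))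
harmonic-telescope a (suc l) = ℚP.≤-trans
  (ℚP.+-monoʳ-≤ (+ 1 / suc a) (harmonic-telescope (suc a) l))
  (ℚP.≤-reflexive (solve 3 (λ p h q → p :+ (h :+ q) := (q :+ h) :+ p) refl (+ 1 / suc a) (harmonic (suc (suc a)) l) (+ 1 / suc (suc a))))

unit-fraction-* : ∀ m a → fromℕ (suc m) * (+ 1 / (suc a ℕ.* suc m)) ≡ + 1 / suc a
unit-fraction-* m a = trans (sym (ℚP.*-identityʳ _)) (trans (cong (fromℕ (suc m) * u *_) (sym (/-*′ a)))
  (trans (solve 4 (λ m u f a → (m :* u) :* (f :* a) := f :* (u :* (a :* m))) refl (fromℕ (suc m)) u (+ 1 / suc a) (fromℕ (suc a)))
    (trans (cong (λ z → + 1 / suc a * (u * z)) (sym (fromℕ-* (suc a) (suc m))))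
      (trans (cong (+ 1 / suc a *_) (/-* (+ 1) (m ℕ.+ a ℕ.* suc m))) (ℚP.*-identityʳ _)))))
  where
    u : ℚ
    u = + 1 / (suc a ℕ.* suc m)
    /-*′ : ∀ a → (+ 1 / suc a) * fromℕ (suc a) ≡ 1ℚ
    /-*′ a = /-* (+ 1) a

harmonic-refine-≥ : ∀ m l a → harmonic a l ≤ harmonic (a ℕ.* suc m) (l ℕ.* suc m)
harmonic-refine-≥ m zero a = ℚP.≤-refl
harmonic-refine-≥ m (suc l) a = subst (harmonic a (suc l) ≤_) (sym (harmonic-+ (a ℕ.* suc m) (suc m) (l ℕ.* suc m)))
  (ℚP.+-mono-≤
    (subst (_≤ harmonic (a ℕ.* suc m) (suc m)) (unit-fraction-* m a) (harmonic-≥ (suc m) (a ℕ.* suc m)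
      (λ b b< → unit-fraction-antimono (ℕP.≤-pred (subst (suc b ℕ.≤_) (ℕP.+-comm (a ℕ.* suc m) (suc m)) b<)))))
    (subst (λ z → harmonic (suc a) l ≤ harmonic z (l ℕ.* suc m)) (ℕP.+-comm (suc m) (a ℕ.* suc m)) (harmonic-refine-≥ m l (suc a))))

harmonic-refine-≤ : ∀ m l a → harmonic (m ℕ.+ a ℕ.* suc m) (l ℕ.* suc m) ≤ harmonic a l
harmonic-refine-≤ m zero a = ℚP.≤-refl
harmonic-refine-≤ m (suc l) a = subst (_≤ harmonic a (suc l)) (sym (harmonic-+ (m ℕ.+ a ℕ.* suc m) (suc m) (l ℕ.* suc m)))
  (ℚP.+-mono-≤
    (subst (harmonic (m ℕ.+ a ℕ.* suc m) (suc m) ≤_) (unit-fraction-* m a) (harmonic-≤ (suc m) (m ℕ.+ a ℕ.* suc m)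
      (λ b ≤b → unit-fraction-antimono ≤b)))
    (subst (λ z → harmonic z (l ℕ.* suc m) ≤ harmonic (suc a) l) eq (harmonic-refine-≤ m l (suc a))))
  where
    eq : m ℕ.+ suc a ℕ.* suc m ≡ (m ℕ.+ a ℕ.* suc m) ℕ.+ suc m
    eq = trans (cong (m ℕ.+_) (ℕP.+-comm (suc m) (a ℕ.* suc m))) (sym (ℕP.+-assoc m (a ℕ.* suc m) (suc m)))

-- The natural logarithm log v = ∫₁ᵛ dt/t of v ≥ 1, as the common cut of
-- the lower and upper Riemann sums of step 1/(k+1).  (log 0 is 0.)
log : ℕ → ℝ
log v = record
  { lower = λ r → ∃[ k ] r < low k
  ; upper = λ r → ∃[ k ] upp k < r
  ; lower-inhabited = low 0 - 1ℚ , 0 , p-q<p (ℚP.positive⁻¹ 1ℚ)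
  ; upper-inhabited = upp 0 + 1ℚ , 0 , p<p+q (ℚP.positive⁻¹ 1ℚ)
  ; lower-rounded = λ (k , h) → let (t , h₁ , h₂) = ℚP.<-dense h in t , h₁ , k , h₂
  ; upper-rounded = λ (k , h) → let (t , h₁ , h₂) = ℚP.<-dense h in t , h₂ , k , h₁
  ; disjoint = λ (j , h) (k , h′) → ℚP.<-irrefl refl (ℚP.<-≤-trans (ℚP.<-trans h′ h) (low≤upp j k))
  ; located = loc
  }
  where
    w : ℕ
    w = ℕ.pred v
    low upp : ℕ → ℚ
    low k = harmonic (suc k) (w ℕ.* suc k)
    upp k = harmonic k (w ℕ.* suc k)
    low≤upp : ∀ j k → low j ≤ upp k
    low≤upp j k = ℚP.≤-trans (harmonic-refine-≥ k (w ℕ.* suc j) (suc j))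
      (ℚP.≤-trans (harmonic-antimono ((w ℕ.* suc j) ℕ.* suc k) le)
        (subst (λ l → harmonic (j ℕ.+ k ℕ.* suc j) l ≤ upp k) eq (harmonic-refine-≤ j (w ℕ.* suc k) k)))
      where
        le : j ℕ.+ k ℕ.* suc j ℕ.≤ suc j ℕ.* suc k
        le = ℕP.≤-trans (ℕP.n≤1+n _) (ℕP.≤-reflexive (ℕP.*-comm (suc k) (suc j)))
        eq : (w ℕ.* suc k) ℕ.* suc j ≡ (w ℕ.* suc j) ℕ.* suc k
        eq = trans (ℕP.*-assoc w (suc k) (suc j)) (trans (cong (w ℕ.*_) (ℕP.*-comm (suc k) (suc j))) (sym (ℕP.*-assoc w (suc j) (suc k))))
    loc : ∀ {r s} → r < s → (∃[ k ] r < low k) ⊎ (∃[ k ] upp k < s)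
    loc {r} {s} r<s = let (k , h) = archimedean-* 1ℚ (p<q⇒0<q-p r<s) in decide k h (r ℚP.<? low k)
      where
        small : ∀ k → 1ℚ < fromℕ k * (s - r) → + 1 / suc k < s - r
        small k h = ℚP.*-cancelʳ-<-nonNeg (fromℕ (suc k)) {{nonNegative (0≤fromℕ (suc k))}}
          (subst₂ _<_ (sym (/-* (+ 1) k)) (ℚP.*-comm (fromℕ (suc k)) (s - r))
            (ℚP.<-≤-trans h (ℚP.*-monoʳ-≤-nonNeg (s - r) {{nonNegative (ℚP.<⇒≤ (p<q⇒0<q-p r<s))}} (fromℤ-mono-≤ {+ k} {+ suc k} (ℤ.+≤+ (ℕP.n≤1+n k))))))
        decide : ∀ k → 1ℚ < fromℕ k * (s - r) → Dec (r < low k) → (∃[ k ] r < low k) ⊎ (∃[ k ] upp k < s)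
        decide k h (yes r<l) = inj₁ (k , r<l)
        decide k h (no r≮l) = inj₂ (k , ℚP.≤-<-trans (harmonic-telescope k (w ℕ.* suc k))
          (subst (low k + + 1 / suc k <_) (p+[q-p] r s) (ℚP.+-mono-≤-< (ℚP.≮⇒≥ r≮l) (small k h))))

-- isLeast is the constructive form of leastness: no t < s bounds S.
record IsSupremum (S : ℝ → Set) (s : ℝ) : Set₁ where
  field
    isUpperBound : ∀ x → S x → x ≤ʳ s
    isLeast      : ∀ t → t <ʳ s → ∃[ x ] S x × t <ʳ x

infix 4 _ConvergesTo_ _=O_

_ConvergesTo_ : (ℕ → ℚ) → ℝ → Set
f ConvergesTo α = ∀ ε → 0ℚ < ε → ∃[ N ] ∀ n → N ℕ.≤ n → ∣ α -ʳ f n ∣ʳ <ʳ fromℚ ε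

_=O_ : (ℕ → ℝ) → (ℕ → ℝ) → Set
f =O g = ∃[ C ] Σ (Positive C) λ C>0 → ∃[ N ] ∀ n → N ℕ.≤ n → ∣ f n ∣ʳ ≤ʳ _·ʳ_ C {{C>0}} ∣ g n ∣ʳ

InfinitelyMany : (ℚ → Set) → Set
InfinitelyMany P = ∀ (l : List ℚ) → ∃[ r ] r ∉ l × P r

-- The denominator Q of P/Q is that of lowest terms, and 1/Q^μ is Q^(-μ).
ApproximableToOrder : ℝ → ℝ → Set
ApproximableToOrder α μ = InfinitelyMany λ r →
  fromℚ 0ℚ <ʳ ∣ α -ʳ r ∣ʳ × ∣ α -ʳ r ∣ʳ <ʳ (↧ₙ r) ^ʳ (-ʳ μ)

IrrationalityExponent : ℝ → ℝ → Set₁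
IrrationalityExponent α = IsSupremum (ApproximableToOrder α)

infix 8 _⁻¹

-- Reciprocal, with the dummy value 0 at 0.
_⁻¹ : ℚ → ℚ
q@(mkℚ (+ 0) _ _) ⁻¹ = 0ℚ
q@(mkℚ ℤ.+[1+ _ ] _ _) ⁻¹ = 1/ q
q@(mkℚ -[1+ _ ] _ _) ⁻¹ = 1/ q

-- cfrac a₀ (a₁ ∷ … ∷ aₙ ∷ []) = [a₀; a₁, …, aₙ]
cfrac : ℤ → List ℕ → ℚ
cfrac a []       = fromℤ a
cfrac a (b ∷ bs) = fromℤ a + cfrac (+ b) bs ⁻¹

-- penultimate qᵢ₋₁ qᵢ (aᵢ₊₁ ∷ … ∷ aₙ ∷ []) = qₙ₋₁
penultimate : ℕ → ℕ → List ℕ → ℕ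
penultimate q′ q []       = q′
penultimate q′ q (a ∷ as) = penultimate q (a ℕ.* q ℕ.+ q′) as

-- qₙ₋₁ for [a₀; a₁, …, aₙ], starting from q₋₁ = 0 and q₀ = 1.
penultimateDenominator : List ℕ → ℕ
penultimateDenominator = penultimate 0 1

record Expansion (ρ : ℚ) : Set where
  field
    a₀    : ℤ
    as    : List ℕ
    as≥1  : All (1 ℕ.≤_) as
    value : ρ ≡ cfrac a₀ as

  lastIndex : ℕ
  lastIndex = length as

  q₋ : ℕ
  q₋ = penultimateDenominator as

open Expansion public using (lastIndex; q₋)

-- Construction ρ y₀ ε: for p/q = ρ, the initial value y₀ and the
-- coefficients εⱼ of α = p/q + Σ_{j≥2} εⱼ/xⱼ in one of the cases.
data Construction (ρ : ℚ) : (y₀ : ℕ) (ε : ℕ → ℤ) → Set where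
  E  : (m k : ℕ) (e : Expansion ρ) → lastIndex e ≡ 2 ℕ.* k →
       Construction ρ (m ℕ.* ↧ₙ ρ ℕ.+ q₋ e ℕ.+ 1) (λ j → + 1)
  P1 : (m k : ℕ) (e : Expansion ρ) → lastIndex e ≡ 2 ℕ.* k →
       1 ℕ.< ↧ₙ ρ → (q₋ e ≡ 1 → 1 ℕ.≤ m) →
       Construction ρ (m ℕ.* ↧ₙ ρ ℕ.+ q₋ e ℕ.∸ 1) (λ j → ℤ.-1ℤ ℤ.^ j)
  P2 : (m k : ℕ) (e : Expansion ρ) → lastIndex e ≡ 2 ℕ.* k ℕ.+ 1 →
       1 ℕ.< ↧ₙ ρ → (q₋ e ≡ 1 → 1 ℕ.≤ m) →
       Construction ρ (m ℕ.* ↧ₙ ρ ℕ.+ q₋ e ℕ.∸ 1) (λ j → ℤ.- (ℤ.-1ℤ ℤ.^ j))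

-- xⱼ and yⱼ from x₁ = q, y₀ and u; the value at j = 0 of xSeq is a dummy.
xSeq ySeq : (q y₀ : ℕ) (u : ℕ → ℕ) → ℕ → ℕ
xSeq q y₀ u 0 = 0
xSeq q y₀ u 1 = q
xSeq q y₀ u (suc (suc j)) = xSeq q y₀ u (suc j) ℕ.* ySeq q y₀ u (suc j)
ySeq q y₀ u 0 = y₀
ySeq q y₀ u (suc j) = ySeq q y₀ u j ℕ.* (1 ℕ.+ u (suc j) ℕ.* xSeq q y₀ u (suc j))

-- partialSum ρ ε x n = ρ + Σ_{2≤j≤n+1} εⱼ/xⱼ
partialSum : ℚ → (ℕ → ℤ) → (ℕ → ℕ) → ℕ → ℚ
partialSum ρ ε x zero    = ρ
partialSum ρ ε x (suc n) = partialSum ρ ε x n + fromℤ (ε (2 ℕ.+ n)) * fromℕ (x (2 ℕ.+ n)) ⁻¹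

∑v : (d : ℕ) (v : ℕ → ℤ) (X : ℕ) → ℤ
∑v d v X = sumℤ {d} λ j → v (toℕ j) ℤ.* (+ X) ℤ.^ (d ℕ.∸ 1 ℕ.∸ toℕ j)

λ[_] : ℕ → ℝ
λ[ d ] = ½ ·ʳ (√ (d ℕ.* (d ℕ.+ 4)) +ʳ fromℕ (d ℕ.+ 2))

{-# OPTIONS --safe #-}
-- Let S n be the partial sums and X n = x (n+1), so that S n has denominator
-- dividing X n.  The choice of y₀ makes the numerator of S n congruent to ± p
-- modulo q, hence X n is exactly the denominator of S n in lowest terms, and
-- |α - S n| lies between 1/(4 X (n+1)) and 2/X (n+1).
--
-- From X (n+2) X n = X (n+1)² (1 + u X (n+1)) the integers L n = ⌊log₂ X n⌋
-- satisfy L (n+2) = (d+2) L (n+1) - L n + O(1 + log v), where λ is the larger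
-- root of λ² - (d+2) λ + 1.  For t < λ the sequence L (n+1) - t L n increases
-- until it is nonnegative and then stays so; hence L grows faster than νⁿ, the
-- error log v is negligible, and the same argument gives L (n+1) ≤ s L n for
-- every s > λ.  Thus X (n+1) = X n ^ (λ + o(1)), and the S n show μ(α) ≥ λ.
--
-- For the upper bound no intermediate convergents are needed: for a fraction of
-- denominator Q choose n with X (n+1)/(4 X n) < Q ≤ X (n+2)/(4 X (n+1)).  Unless
-- it equals S (n+1), its distance from α is at least 1/(2 Q X (n+1)), where
-- X (n+1) ≤ Q ^ (λ/(λ-1) + o(1)), and 1 + λ/(λ-1) ≤ λ because
-- λ² - 3 λ + 1 = (d-1) λ ≥ 0.

module Submission where

open import Defs
open import Algebra.Bundles using (CommutativeRing)
open import Data.Empty using (⊥; ⊥-elim)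
open import Data.Fin.Base as Fin using (Fin; toℕ)
open import Data.Fin.Properties using (toℕ<n)
open import Data.Integer.Base as ℤ using (ℤ; +_; -[1+_]; 0ℤ; 1ℤ; -1ℤ; ∣_∣)
import Data.Integer.Divisibility.Signed as ℤS
import Data.Integer.Properties as ℤP
open import Data.Integer.Solver renaming (module +-*-Solver to ℤ-Solver)
open import Data.List.Base using (List; []; _∷_; _++_; length; map; upTo; cartesianProductWith)
open import Data.List.Membership.Propositional using (_∈_; _∉_)
open import Data.List.Membership.Propositional.Properties using (∈-cartesianProductWith⁺; ∈-upTo⁺; ∈-++⁺ˡ; ∈-++⁺ʳ; ∈-map⁺)
open import Data.List.Relation.Unary.All using (All; []; _∷_)
open import Data.List.Relation.Unary.Any using (here; there)
open import Data.Nat.Base as ℕ using (ℕ; zero; suc; z≤n; s≤s)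
open import Data.Nat.Coprimality as Coprimality using (Coprime)
open import Data.Nat.Divisibility using (_∣_; divides; ∣1⇒≡1; ∣-antisym; ∣-trans; ∣-refl; m∣m*n)
import Data.Nat.Properties as ℕP
open import Data.Nat.Solver renaming (module +-*-Solver to ℕ-Solver)
open import Data.Product.Base using (Σ; Σ-syntax; ∃-syntax; _×_; _,_; proj₁; proj₂)
open import Data.Rational.Base as ℚ using (ℚ; mkℚ; 0ℚ; 1ℚ; ½; ↥_; ↧ₙ_; Positive)
import Data.Rational.Properties as ℚP
open import Data.Rational.Solver renaming (module +-*-Solver to ℚ-Solver)
open import Data.Sum.Base using (_⊎_; inj₁; inj₂; [_,_]′)
open import Relation.Binary.Definitions using (tri<; tri≈; tri>)
open import Relation.Binary.PropositionalEquality.Core using (_≡_; refl; sym; trans; cong; cong₂; subst; subst₂)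
open import Relation.Binary.PropositionalEquality.Properties using (module ≡-Reasoning)
open import Relation.Nullary using (¬_; Dec; yes; no)
open import Algebra.Properties.CommutativeMonoid.Sum ℤP.+-0-commutativeMonoid using (sum)
import Algebra.Properties.CommutativeSemiring.Exp (CommutativeRing.commutativeSemiring ℚP.+-*-commutativeRing) as Exp

open ℕ-Solver using () renaming (solve to solveℕ; _:+_ to _⊕_; _:*_ to _⊗_; _:=_ to _⊜_; con to nat)

-- No step computes with the irrational λ. Put δ = d + 2. For rational t at or above δ - 1, the sign
-- of t (δ - t) - 1 tells on which side of λ it lies, and that sign is what drives the recurrence
-- for L (n+1) - t L n. The damping factor there is δ - t, so keeping the exponents between δ - 1
-- and δ keeps this factor between 0 and 1.
--
-- Neglecting log v is not circular. The lower bound for the growth of L needs of the size of v only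
-- v ≥ 1. The growth condition on v enters afterwards, when L is already known to outgrow r^n for
-- some r between ν and λ.
--
-- Powers Q^(-μ) with real μ are never estimated directly. For a rational exponent a/b a bound
-- becomes M^b ≤ Q^a in natural numbers, and comparison with powers of 2 turns that into a linear
-- inequality between floor logarithms. Rounding costs a bounded amount, which a strict gap between
-- two rational exponents absorbs because L tends to infinity. This is why most estimates carry a
-- pair of neighbouring exponents.

-- Rational inequalities and statements valid for all large indices.

module NumberLemmas where

  open import Data.Rational.Base using (-_; _+_; _-_; _*_; _<_; _≤_; positive; nonNegative)
  open Exp using (_^_)

  ≤-by-difference : ∀ {p q} e → 0ℚ ≤ e → q ≡ p + e → p ≤ q
  ≤-by-difference {p} e 0≤e eq = subst (p ≤_) (sym eq) (p≤p+q 0≤e)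

  <-by-difference : ∀ {p q} e → 0ℚ < e → q ≡ p + e → p < q
  <-by-difference {p} e 0<e eq = subst (p <_) (sym eq) (p<p+q 0<e)

  p≤q⇒0≤q-p : ∀ {p q} → p ≤ q → 0ℚ ≤ q - p
  p≤q⇒0≤q-p {p} {q} p≤q = subst (_≤ q - p) (ℚP.+-inverseʳ p) (ℚP.+-monoˡ-≤ (- p) p≤q)

  0≤q-p⇒p≤q : ∀ {p q} → 0ℚ ≤ q - p → p ≤ q
  0≤q-p⇒p≤q {p} {q} h = ≤-by-difference (q - p) h (sym (p+[q-p] p q))

  0<q-p⇒p<q : ∀ {p q} → 0ℚ < q - p → p < q
  0<q-p⇒p<q {p} {q} h = <-by-difference (q - p) h (sym (p+[q-p] p q))

  0<+≤ : ∀ {p q} → 0ℚ < p → 0ℚ ≤ q → 0ℚ < p + q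
  0<+≤ 0<p 0≤q = ℚP.<-≤-trans 0<p (p≤p+q 0≤q)

  0<1 : 0ℚ < 1ℚ
  0<1 = ℚP.positive⁻¹ 1ℚ

  *-monoˡ-≤₀ : ∀ {p q r} → 0ℚ ≤ r → p ≤ q → r * p ≤ r * q
  *-monoˡ-≤₀ {r = r} 0≤r = ℚP.*-monoˡ-≤-nonNeg r {{nonNegative 0≤r}}

  *-monoʳ-≤₀ : ∀ {p q r} → 0ℚ ≤ r → p ≤ q → p * r ≤ q * r
  *-monoʳ-≤₀ {r = r} 0≤r = ℚP.*-monoʳ-≤-nonNeg r {{nonNegative 0≤r}}

  *-monoˡ-<₀ : ∀ {p q r} → 0ℚ < r → p < q → p * r < q * r
  *-monoˡ-<₀ {r = r} 0<r = ℚP.*-monoˡ-<-pos r {{positive 0<r}}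

  *-cancelʳ-≤₀ : ∀ {p q r} → 0ℚ < r → p * r ≤ q * r → p ≤ q
  *-cancelʳ-≤₀ {r = r} 0<r = ℚP.*-cancelʳ-≤-pos r {{positive 0<r}}

  *-cancelʳ-<₀ : ∀ {p q r} → 0ℚ ≤ r → p * r < q * r → p < q
  *-cancelʳ-<₀ {r = r} 0≤r = ℚP.*-cancelʳ-<-nonNeg r {{nonNegative 0≤r}}

  ≤₀⊎>₀ : ∀ p q → p ≤ q ⊎ q < p
  ≤₀⊎>₀ p q with p ℚP.≤? q
  ... | yes h = inj₁ h
  ... | no h = inj₂ (ℚP.≰⇒> h)

  fromℕ-mono-≤ : ∀ {m n} → m ℕ.≤ n → fromℕ m ≤ fromℕ n
  fromℕ-mono-≤ {m} {n} h = fromℤ-mono-≤ {+ m} {+ n} (ℤ.+≤+ h)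

  fromℕ-mono-< : ∀ {m n} → m ℕ.< n → fromℕ m < fromℕ n
  fromℕ-mono-< {m} {n} h = fromℤ-mono-< {+ m} {+ n} (ℤ.+<+ h)

  fromℕ-cancel-≤ : ∀ {m n} → fromℕ m ≤ fromℕ n → m ℕ.≤ n
  fromℕ-cancel-≤ {m} {n} h with m ℕP.≤? n
  ... | yes m≤n = m≤n
  ... | no m≰n = ⊥-elim (ℚP.<-irrefl refl (ℚP.<-≤-trans (fromℕ-mono-< (ℕP.≰⇒> m≰n)) h))

  0<fromℕ : ∀ {n} → 1 ℕ.≤ n → 0ℚ < fromℕ n
  0<fromℕ h = fromℕ-mono-< {0} h

  1≤fromℕ : ∀ {n} → 1 ℕ.≤ n → 1ℚ ≤ fromℕ n
  1≤fromℕ h = fromℕ-mono-≤ {1} h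

  fromℕ-^ : ∀ m n → fromℕ (m ℕ.^ n) ≡ fromℕ m ^ n
  fromℕ-^ m zero = refl
  fromℕ-^ m (suc n) = trans (fromℕ-* m (m ℕ.^ n)) (cong (fromℕ m *_) (fromℕ-^ m n))

  n<2^n : ∀ n → n ℕ.< 2 ℕ.^ n
  n<2^n zero = ℕ.s≤s ℕ.z≤n
  n<2^n (suc n) = ℕP.≤-trans (ℕ.s≤s (n<2^n n))
    (ℕP.+-mono-≤ (ℕP.m^n>0 2 n) (ℕP.≤-reflexive (sym (ℕP.+-identityʳ (2 ℕ.^ n)))))

  Eventually : (ℕ → Set) → Set
  Eventually P = ∃[ N ] ∀ n → N ℕ.≤ n → P n

  infixr 4 _⟨&⟩_

  _⟨&⟩_ : ∀ {P Q} → Eventually P → Eventually Q → Eventually (λ n → P n × Q n)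
  (M , p) ⟨&⟩ (N , q) = M ℕ.⊔ N , λ n h →
    p n (ℕP.≤-trans (ℕP.m≤m⊔n M N) h) , q n (ℕP.≤-trans (ℕP.m≤n⊔m M N) h)

  mapᵉ : ∀ {P Q} → (∀ n → P n → Q n) → Eventually P → Eventually Q
  mapᵉ f (N , p) = N , λ n h → f n (p n h)

  shift : ∀ {P} → Eventually P → Eventually (λ n → P (suc n))
  shift (N , p) = N , λ n h → p (suc n) (ℕP.m≤n⇒m≤1+n h)

  from-multiples : ∀ {P} N → (∀ k → P (k ℕ.+ N)) → Eventually P
  from-multiples {P} N h = N , λ n N≤n → subst P (ℕP.m∸n+n≡m N≤n) (h (n ℕ.∸ N))

  -- The device by which bounded rounding errors disappear into any positive multiple of `L`.
  eventually-≤-* : ∀ c {κ} {L : ℕ → ℚ} → 0ℚ < κ → (∀ n → fromℕ n ≤ L n) → Eventually (λ n → c ≤ κ * L n)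
  eventually-≤-* c {κ} {L} 0<κ n≤L = let (N , h) = archimedean-* c 0<κ in
    N , λ n N≤n → ℚP.≤-trans (ℚP.<⇒≤ h) (subst (_≤ κ * L n) (ℚP.*-comm κ (fromℕ N))
      (*-monoˡ-≤₀ (ℚP.<⇒≤ 0<κ) (ℚP.≤-trans (fromℕ-mono-≤ N≤n) (n≤L n))))

-- Growth ratios from a perturbed linear recurrence.

module Recurrence where

  open NumberLemmas
  open import Data.Rational.Base using (-_; _+_; _-_; _*_; _<_; _≤_)
  open Exp using (_^_; ^-homo-*)
  open ℚ-Solver using (solve; _:+_; _:*_; :-_; _:-_; _:=_; con)

  -- While `D n` is negative, `s ≤ 1` makes `s * D n` at least `D n`, so every step gains at least 1
  -- and finitely many steps reach 0. From then on `0 ≤ s` preserves the sign.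
  eventually-nonnegative : ∀ (D : ℕ → ℚ) {s} → 0ℚ ≤ s → s ≤ 1ℚ →
    Eventually (λ n → s * D n + 1ℚ ≤ D (suc n)) → Eventually (λ n → 0ℚ ≤ D n)
  eventually-nonnegative D {s} 0≤s s≤1 (N , step) =
    let (k , -D<k) = archimedean (- D N) in from-multiples (k ℕ.+ N) (λ j → stay j k (reach k -D<k (climb k)))
    where
      N≤ : ∀ j → N ℕ.≤ j ℕ.+ N
      N≤ j = ℕP.m≤n+m N j
      keep : ∀ n → N ℕ.≤ n → 0ℚ ≤ D n → 0ℚ ≤ D (suc n)
      keep n N≤n 0≤D = ℚP.≤-trans (0≤+ (0≤* 0≤s 0≤D) 0≤1) (step n N≤n)
      climb : ∀ j → 0ℚ ≤ D (j ℕ.+ N) ⊎ D N + fromℕ j ≤ D (j ℕ.+ N)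
      climb zero = inj₂ (ℚP.≤-reflexive (ℚP.+-identityʳ (D N)))
      climb (suc j) with ≤₀⊎>₀ 0ℚ (D (j ℕ.+ N)) | climb j
      ... | inj₁ 0≤D | _ = inj₁ (keep (j ℕ.+ N) (N≤ j) 0≤D)
      ... | inj₂ _ | inj₁ 0≤D = inj₁ (keep (j ℕ.+ N) (N≤ j) 0≤D)
      ... | inj₂ D<0 | inj₂ h = inj₂ (subst (λ z → D N + z ≤ D (suc j ℕ.+ N)) (sym (fromℕ-suc j))
        (≤-by-difference ((D (j ℕ.+ N) - (D N + fromℕ j)) + (1ℚ - s) * (0ℚ - D (j ℕ.+ N)) +
          (D (suc j ℕ.+ N) - (s * D (j ℕ.+ N) + 1ℚ)))
          (0≤+ (0≤+ (p≤q⇒0≤q-p h) (0≤* (p≤q⇒0≤q-p s≤1) (p≤q⇒0≤q-p (ℚP.<⇒≤ D<0)))) (p≤q⇒0≤q-p (step (j ℕ.+ N) (N≤ j))))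
          (solve 5 (λ a b c j s → c := (a :+ (con 1ℚ :+ j)) :+
            ((b :- (a :+ j)) :+ (con 1ℚ :- s) :* (con 0ℚ :- b) :+ (c :- (s :* b :+ con 1ℚ))))
            refl (D N) (D (j ℕ.+ N)) (D (suc j ℕ.+ N)) (fromℕ j) s)))
      reach : ∀ k → - D N < fromℕ k → 0ℚ ≤ D (k ℕ.+ N) ⊎ D N + fromℕ k ≤ D (k ℕ.+ N) → 0ℚ ≤ D (k ℕ.+ N)
      reach k _ (inj₁ h) = h
      reach k -D<k (inj₂ h) = ℚP.≤-trans
        (ℚP.<⇒≤ (subst (_< D N + fromℕ k) (ℚP.+-inverseʳ (D N)) (ℚP.+-monoʳ-< (D N) -D<k))) h
      stay : ∀ j k → 0ℚ ≤ D (k ℕ.+ N) → 0ℚ ≤ D (j ℕ.+ (k ℕ.+ N))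
      stay zero k h = h
      stay (suc j) k h = keep (j ℕ.+ (k ℕ.+ N)) (ℕP.≤-trans (N≤ k) (ℕP.m≤n+m (k ℕ.+ N) j)) (stay j k h)

  module _ (L : ℕ → ℚ) (n≤L : ∀ n → fromℕ n ≤ L n) (δ : ℚ) where

    -- With D n = L (1+n) - t L n the recurrence reads
    -- D (1+n) ≥ (δ - t) D n + (t (δ - t) - 1) L n - c.
    eventual-ratio-≥ : ∀ {c t} → t ≤ δ → δ - t ≤ 1ℚ → 1ℚ < t * (δ - t) →
      Eventually (λ n → δ * L (1 ℕ.+ n) ≤ L (2 ℕ.+ n) + L n + c) →
      Eventually (λ n → t * L n ≤ L (1 ℕ.+ n))
    eventual-ratio-≥ {c} {t} t≤δ δ-t≤1 1<t[δ-t] rec = mapᵉ (λ n → 0≤q-p⇒p≤q)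
      (eventually-nonnegative (λ n → L (1 ℕ.+ n) - t * L n) (p≤q⇒0≤q-p t≤δ) δ-t≤1
        (mapᵉ step (rec ⟨&⟩ eventually-≤-* (c + 1ℚ) (p<q⇒0<q-p 1<t[δ-t]) n≤L)))
      where
        step : ∀ n → δ * L (1 ℕ.+ n) ≤ L (2 ℕ.+ n) + L n + c × c + 1ℚ ≤ (t * (δ - t) - 1ℚ) * L n →
          (δ - t) * (L (1 ℕ.+ n) - t * L n) + 1ℚ ≤ L (2 ℕ.+ n) - t * L (1 ℕ.+ n)
        step n (h₁ , h₂) = ≤-by-difference
          ((L (2 ℕ.+ n) + L n + c - δ * L (1 ℕ.+ n)) + ((t * (δ - t) - 1ℚ) * L n - (c + 1ℚ)))
          (0≤+ (p≤q⇒0≤q-p h₁) (p≤q⇒0≤q-p h₂))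
          (solve 6 (λ x y z t δ c → z :- t :* y := ((δ :- t) :* (y :- t :* x) :+ con 1ℚ) :+
              ((z :+ x :+ c :- δ :* y) :+ ((t :* (δ :- t) :- con 1ℚ) :* x :- (c :+ con 1ℚ))))
            refl (L n) (L (1 ℕ.+ n)) (L (2 ℕ.+ n)) t δ c)

    -- The mirror image with D n = s L n - L (1+n), for which D (1+n) ≥ (δ - s) D n + (1 - s (δ -
    -- s)) L n - w n. The error `w` may be unbounded, so it has to be negligible against `L`.
    eventual-ratio-≤ : ∀ {s} {w : ℕ → ℚ} → s ≤ δ → δ - s ≤ 1ℚ → s * (δ - s) < 1ℚ →
      (∀ {κ} → 0ℚ < κ → Eventually (λ n → w n + 1ℚ ≤ κ * L n)) →
      Eventually (λ n → L (2 ℕ.+ n) + L n ≤ δ * L (1 ℕ.+ n) + w n) →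
      Eventually (λ n → L (1 ℕ.+ n) ≤ s * L n)
    eventual-ratio-≤ {s} {w} s≤δ δ-s≤1 s[δ-s]<1 w≪L rec = mapᵉ (λ n → 0≤q-p⇒p≤q)
      (eventually-nonnegative (λ n → s * L n - L (1 ℕ.+ n)) (p≤q⇒0≤q-p s≤δ) δ-s≤1
        (mapᵉ step (rec ⟨&⟩ w≪L (p<q⇒0<q-p s[δ-s]<1))))
      where
        step : ∀ n → L (2 ℕ.+ n) + L n ≤ δ * L (1 ℕ.+ n) + w n × w n + 1ℚ ≤ (1ℚ - s * (δ - s)) * L n →
          (δ - s) * (s * L n - L (1 ℕ.+ n)) + 1ℚ ≤ s * L (1 ℕ.+ n) - L (2 ℕ.+ n)
        step n (h₁ , h₂) = ≤-by-difference
          ((δ * L (1 ℕ.+ n) + w n - (L (2 ℕ.+ n) + L n)) + ((1ℚ - s * (δ - s)) * L n - (w n + 1ℚ)))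
          (0≤+ (p≤q⇒0≤q-p h₁) (p≤q⇒0≤q-p h₂))
          (solve 6 (λ x y z s δ w → s :* y :- z := ((δ :- s) :* (s :* x :- y) :+ con 1ℚ) :+
              ((δ :* y :+ w :- (z :+ x)) :+ ((con 1ℚ :- s :* (δ :- s)) :* x :- (w :+ con 1ℚ))))
            refl (L n) (L (1 ℕ.+ n)) (L (2 ℕ.+ n)) s δ (w n))

    -- Bernoulli's inequality for (t/r)^k, multiplied by r^(k+1) to avoid division.
    bernoulli-ratio : ∀ {r t} → 0ℚ ≤ r → r ≤ t → ∀ k → (r + fromℕ k * (t - r)) * r ^ k ≤ r * t ^ k
    bernoulli-ratio {r} {t} 0≤r r≤t zero = ℚP.≤-reflexive
      (solve 2 (λ r t → (r :+ con 0ℚ :* (t :- r)) :* con 1ℚ := r :* con 1ℚ) refl r t)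
    bernoulli-ratio {r} {t} 0≤r r≤t (suc k) = ℚP.≤-trans
      (subst (λ z → (r + z * (t - r)) * (r * r ^ k) ≤ t * ((r + fromℕ k * (t - r)) * r ^ k)) (sym (fromℕ-suc k))
        (≤-by-difference (fromℕ k * ((t - r) * (t - r)) * r ^ k)
          (0≤* (0≤* (0≤fromℕ k) (0≤* 0≤δ 0≤δ)) (0≤^ k 0≤r))
          (solve 4 (λ r t k p → t :* ((r :+ k :* (t :- r)) :* p) := (r :+ (con 1ℚ :+ k) :* (t :- r)) :* (r :* p) :+
            k :* ((t :- r) :* (t :- r)) :* p)
            refl r t (fromℕ k) (r ^ k))))
      (subst (t * ((r + fromℕ k * (t - r)) * r ^ k) ≤_)
        (solve 3 (λ r t p → t :* (r :* p) := r :* (t :* p)) refl r t (t ^ k))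
        (*-monoˡ-≤₀ (ℚP.≤-trans 0≤r r≤t) (bernoulli-ratio 0≤r r≤t k)))
      where
        0≤δ : 0ℚ ≤ t - r
        0≤δ = p≤q⇒0≤q-p r≤t

    -- Iterating the ratio gives t^k ≤ L (k + N), and (t/r)^k outgrows every constant by Bernoulli's
    -- inequality.
    eventually-≥-geometric : ∀ {r t} A → 0ℚ < r → r < t → Eventually (λ n → t * L n ≤ L (1 ℕ.+ n)) →
      Eventually (λ n → A * r ^ n ≤ L n)
    eventually-≥-geometric {r} {t} A 0<r r<t (N₀ , ratio) =
      let (k , h) = archimedean-* (A * r ^ N * r) (p<q⇒0<q-p r<t) in
      from-multiples (k ℕ.+ N) (λ j → subst (λ m → A * r ^ m ≤ L m) (ℕP.+-assoc j k N)
        (bound (j ℕ.+ k) (ℚP.≤-trans (ℚP.<⇒≤ h) (*-monoʳ-≤₀ (ℚP.<⇒≤ (p<q⇒0<q-p r<t)) (fromℕ-mono-≤ (ℕP.m≤n+m k j))))))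
      where
        -- The successor makes `N` at least 1, so that `L N` dominates t^0 = 1 at the start of the
        -- iteration.
        N : ℕ
        N = suc N₀
        0≤r : 0ℚ ≤ r
        0≤r = ℚP.<⇒≤ 0<r
        0≤t : 0ℚ ≤ t
        0≤t = ℚP.<⇒≤ (ℚP.<-trans 0<r r<t)
        iterate : ∀ k → t ^ k ≤ L (k ℕ.+ N)
        iterate zero = ℚP.≤-trans (1≤fromℕ {N} (ℕ.s≤s ℕ.z≤n)) (n≤L N)
        iterate (suc k) = ℚP.≤-trans (*-monoˡ-≤₀ 0≤t (iterate k))
          (ratio (k ℕ.+ N) (ℕP.≤-trans (ℕP.n≤1+n N₀) (ℕP.m≤n+m N k)))
        bound : ∀ k → A * r ^ N * r ≤ fromℕ k * (t - r) → A * r ^ (k ℕ.+ N) ≤ L (k ℕ.+ N)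
        bound k h = ℚP.≤-trans (*-cancelʳ-≤₀ 0<r (begin
          A * r ^ (k ℕ.+ N) * r ≡⟨ cong (λ z → A * z * r) (^-homo-* r k N) ⟩
          A * (r ^ k * r ^ N) * r ≡⟨ solve 4 (λ a x y r → a :* (x :* y) :* r := (a :* y :* r) :* x) refl A
            (r ^ k) (r ^ N) r ⟩
          A * r ^ N * r * r ^ k ≤⟨ *-monoʳ-≤₀ (0≤^ k 0≤r)
            (ℚP.≤-trans h (subst (_≤ r + fromℕ k * (t - r)) (ℚP.+-identityˡ _)
            (ℚP.+-monoˡ-≤ (fromℕ k * (t - r)) 0≤r))) ⟩
          (r + fromℕ k * (t - r)) * r ^ k ≤⟨ bernoulli-ratio 0≤r (ℚP.<⇒≤ r<t) k ⟩
          r * t ^ k ≡⟨ ℚP.*-comm r (t ^ k) ⟩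
          t ^ k * r ∎)) (iterate k)
          where open ℚP.≤-Reasoning

-- Continued fractions and the inverse of p modulo q.

module ContinuedFractions where

  open NumberLemmas
  open import Data.Rational.Base using (_+_; _*_)
  open ℤ-Solver using (solve; _:+_; _:*_; :-_; _:-_; _:=_; con)

  -- (B C; B′ C′) is the product of the matrices (a 1; 1 0) over the entries a, in
  -- reverse order.
  record Continuants (as : List ℕ) : Set where
    field
      B B′ C C′   : ℕ
      penultimate-≡ : ∀ q′ q → penultimate q′ q as ≡ B′ ℕ.* q ℕ.+ C′ ℕ.* q′
      cfrac-≡     : ∀ a → cfrac a as * fromℕ B ≡ fromℤ (a ℤ.* + B ℤ.+ + C)
      determinant : + B ℤ.* + C′ ℤ.- + B′ ℤ.* + C ≡ -1ℤ ℤ.^ length as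
      B≥1         : 1 ℕ.≤ B
      -- The empty list has `B′` equal to 0, so positivity alone cannot be carried through the
      -- induction. The first alternative ties this case to denominator 1 and supplies the positive
      -- `C′` that enters the next `B′`.
      nonempty    : (B ≡ 1 × 1 ℕ.≤ C′) ⊎ 1 ℕ.≤ B′

  ⁻¹-inverseʳ : ∀ q → 0ℚ ℚ.< q → q * q ⁻¹ ≡ 1ℚ
  ⁻¹-inverseʳ q@(mkℚ ℤ.+[1+ _ ] _ _) _ = ℚP.*-inverseʳ q
  ⁻¹-inverseʳ (mkℚ (+ 0) _ _) (ℚ.*<* (ℤ.+<+ ()))
  ⁻¹-inverseʳ (mkℚ -[1+ _ ] _ _) (ℚ.*<* ())

  continuants : ∀ as → All (1 ℕ.≤_) as → Continuants as
  continuants [] [] = record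
    { B = 1 ; B′ = 0 ; C = 0 ; C′ = 1
    ; penultimate-≡ = λ q′ q → sym (ℕP.+-identityʳ q′)
    ; cfrac-≡ = λ a → trans (ℚP.*-identityʳ (fromℤ a))
      (cong fromℤ (solve 1 (λ a → a := a :* con 1ℤ :+ con (+ 0)) refl a))
    ; determinant = refl
    ; B≥1 = ℕ.s≤s ℕ.z≤n
    ; nonempty = inj₁ (refl , ℕP.≤-refl)
    }
  continuants (a ∷ as) (1≤a ∷ as≥1) = record
    { B = a ℕ.* B ℕ.+ C ; B′ = a ℕ.* B′ ℕ.+ C′ ; C = B ; C′ = B′
    ; penultimate-≡ = λ q′ q → trans (penultimate-≡ q (a ℕ.* q ℕ.+ q′)) (ℕ-identity q′ q)
    ; cfrac-≡ = value
    ; determinant = trans (cong₂ (λ x y → x ℤ.* + B′ ℤ.- y ℤ.* + B) (pos-+-* a B C) (pos-+-* a B′ C′))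
        (trans (solve 5 (λ a b b′ c c′ → (a :* b :+ c) :* b′ :- (a :* b′ :+ c′) :* b := con -1ℤ :*
          (b :* c′ :- b′ :* c)) refl (+ a) (+ B) (+ B′) (+ C) (+ C′))
          (cong (-1ℤ ℤ.*_) determinant))
    ; B≥1 = 1≤aB+C
    ; nonempty = inj₂ (B′-positive nonempty)
    }
    where
      open Continuants (continuants as as≥1)
      ℕ-identity : ∀ q′ q → B′ ℕ.* (a ℕ.* q ℕ.+ q′) ℕ.+ C′ ℕ.* q ≡ (a ℕ.* B′ ℕ.+ C′) ℕ.* q ℕ.+ B′ ℕ.* q′
      ℕ-identity q′ q = solveℕ 5 (λ a b′ c′ q q′ → b′ ⊗ (a ⊗ q ⊕ q′) ⊕ c′ ⊗ q ⊜ (a ⊗ b′ ⊕ c′) ⊗ q ⊕ b′ ⊗ q′) refl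
        a B′ C′ q q′
      pos-+-* : ∀ a b c → + (a ℕ.* b ℕ.+ c) ≡ + a ℤ.* + b ℤ.+ + c
      pos-+-* a b c = cong (ℤ._+ + c) (ℤP.pos-* a b)
      1≤aB+C : 1 ℕ.≤ a ℕ.* B ℕ.+ C
      1≤aB+C = ℕP.≤-trans (ℕP.*-mono-≤ 1≤a B≥1) (ℕP.m≤m+n (a ℕ.* B) C)
      B′-positive : (B ≡ 1 × 1 ℕ.≤ C′) ⊎ 1 ℕ.≤ B′ → 1 ℕ.≤ a ℕ.* B′ ℕ.+ C′
      B′-positive (inj₂ 1≤B′) = ℕP.≤-trans (ℕP.*-mono-≤ 1≤a 1≤B′) (ℕP.m≤m+n (a ℕ.* B′) C′)
      B′-positive (inj₁ (_ , 1≤C′)) = ℕP.≤-trans 1≤C′ (ℕP.m≤n+m C′ (a ℕ.* B′))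
      1/cfrac : cfrac (+ a) as ⁻¹ * fromℕ (a ℕ.* B ℕ.+ C) ≡ fromℕ B
      1/cfrac = begin
        z ⁻¹ * fromℕ (a ℕ.* B ℕ.+ C) ≡⟨ cong (z ⁻¹ *_) (trans (cong fromℤ (pos-+-* a B C)) (sym (cfrac-≡ (+ a)))) ⟩
        z ⁻¹ * (z * fromℕ B) ≡⟨ trans (sym (ℚP.*-assoc (z ⁻¹) z (fromℕ B))) (cong (_* fromℕ B) (ℚP.*-comm (z ⁻¹) z)) ⟩
        z * z ⁻¹ * fromℕ B ≡⟨ cong (_* fromℕ B) (⁻¹-inverseʳ z 0<z) ⟩
        1ℚ * fromℕ B ≡⟨ ℚP.*-identityˡ (fromℕ B) ⟩
        fromℕ B ∎
        where
          open ≡-Reasoning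
          z : ℚ
          z = cfrac (+ a) as
          0<z : 0ℚ ℚ.< z
          0<z = *-cancelʳ-<₀ (0≤fromℕ B) (subst₂ ℚ._<_ (sym (ℚP.*-zeroˡ (fromℕ B)))
            (trans (cong fromℤ (pos-+-* a B C)) (sym (cfrac-≡ (+ a)))) (0<fromℕ 1≤aB+C))
      value : ∀ i → cfrac i (a ∷ as) * fromℕ (a ℕ.* B ℕ.+ C) ≡ fromℤ (i ℤ.* + (a ℕ.* B ℕ.+ C) ℤ.+ + B)
      value i = trans (ℚP.*-distribʳ-+ (fromℕ (a ℕ.* B ℕ.+ C)) (fromℤ i) (cfrac (+ a) as ⁻¹))
        (trans (cong₂ _+_ (sym (fromℤ-* i (+ (a ℕ.* B ℕ.+ C)))) 1/cfrac)
          (sym (fromℤ-+ (i ℤ.* + (a ℕ.* B ℕ.+ C)) (+ B))))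

  fromℤ-injective : ∀ {i j} → fromℤ i ≡ fromℤ j → i ≡ j
  fromℤ-injective {i} {j} eq with ℤP.<-cmp i j
  ... | tri< i<j _ _ = ⊥-elim (ℚP.<-irrefl eq (fromℤ-mono-< i<j))
  ... | tri≈ _ i≡j _ = i≡j
  ... | tri> _ _ j<i = ⊥-elim (ℚP.<-irrefl (sym eq) (fromℤ-mono-< j<i))

  ↥≡*↧ : ∀ r → fromℤ (↥ r) ≡ r * fromℕ (↧ₙ r)
  ↥≡*↧ r@(mkℚ n k _) = trans (sym (/-* n k)) (cong (_* fromℕ (suc k)) (ℚP.↥p/↧p≡p r))

  -- Cross-multiplication and coprimality make the two denominators divide each other.
  lowest-terms : ∀ r {n D} → r * fromℕ D ≡ fromℤ n → 1 ℕ.≤ D → Coprime ∣ n ∣ D → ↥ r ≡ n × ↧ₙ r ≡ D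
  lowest-terms r@(mkℚ m k c) {n} {D@(suc _)} eq _ coprime = ↥r≡n , ↧r≡D
    where
      cross : m ℤ.* + D ≡ n ℤ.* + suc k
      cross = fromℤ-injective (trans (fromℤ-* m (+ D)) (trans (cong (_* fromℕ D) (↥≡*↧ r))
        (trans (*-assoc-comm r (fromℕ (suc k)) (fromℕ D))
          (trans (cong (_* fromℕ (suc k)) eq) (sym (fromℤ-* n (+ suc k)))))))
      cross′ : ∣ m ∣ ℕ.* D ≡ ∣ n ∣ ℕ.* suc k
      cross′ = trans (sym (ℤP.abs-* m (+ D))) (trans (cong ∣_∣ cross) (ℤP.abs-* n (+ suc k)))
      ↧r≡D : suc k ≡ D
      ↧r≡D = ∣-antisym
        (Coprimality.coprime-divisor (Coprimality.sym (Coprimality.recompute c)) (divides ∣ n ∣ cross′))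
        (Coprimality.coprime-divisor (Coprimality.sym coprime) (divides ∣ m ∣ (sym cross′)))
      ↥r≡n : m ≡ n
      ↥r≡n = ℤP.*-cancelʳ-≡ m n (+ D) (trans cross (cong (λ z → n ℤ.* + z) ↧r≡D))

  IsSign : ℤ → Set
  IsSign i = i ≡ 1ℤ ⊎ i ≡ -1ℤ

  -1^-sign : ∀ n → IsSign (-1ℤ ℤ.^ n)
  -1^-sign zero = inj₁ refl
  -1^-sign (suc n) with -1^-sign n
  ... | inj₁ eq = inj₂ (cong (-1ℤ ℤ.*_) eq)
  ... | inj₂ eq = inj₁ (cong (-1ℤ ℤ.*_) eq)

  ∣sign∣ : ∀ {s} → IsSign s → ∣ s ∣ ≡ 1
  ∣sign∣ (inj₁ refl) = refl
  ∣sign∣ (inj₂ refl) = refl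

  module _ {ρ : ℚ} (e : Expansion ρ) where
    open Expansion e using (a₀; as; as≥1; value)
    open Continuants (continuants as as≥1)

    private
      coprime : Coprime ∣ a₀ ℤ.* + B ℤ.+ + C ∣ B
      coprime {k} (k∣n , k∣B) = ∣1⇒≡1 (subst (k ∣_) (trans (cong ∣_∣ combination) (∣sign∣ (-1^-sign (length as))))
        (ℤS.∣⇒∣ᵤ {+ k} (ℤS.∣m∣n⇒∣m+n (ℤS.∣n⇒∣m*n (ℤ.- + B′) (ℤS.∣ᵤ⇒∣ k∣n))
          (ℤS.∣n⇒∣m*n (+ C′ ℤ.+ + B′ ℤ.* a₀) (ℤS.∣ᵤ⇒∣ {+ k} {+ B} k∣B)))))
        where
          -- Bezout coefficients: the combination collapses to the determinant, hence to ±1.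
          combination : (ℤ.- + B′) ℤ.* (a₀ ℤ.* + B ℤ.+ + C) ℤ.+ (+ C′ ℤ.+ + B′ ℤ.* a₀) ℤ.* + B ≡ -1ℤ ℤ.^ length as
          combination = trans (solve 5 (λ a b b′ c c′ → (:- b′) :* (a :* b :+ c) :+ (c′ :+ b′ :* a) :* b := b :*
            c′ :- b′ :* c)
            refl a₀ (+ B) (+ B′) (+ C) (+ C′)) determinant

      ↥ρ,↧ρ : ↥ ρ ≡ a₀ ℤ.* + B ℤ.+ + C × ↧ₙ ρ ≡ B
      ↥ρ,↧ρ = lowest-terms ρ (trans (cong (_* fromℕ B) value) (cfrac-≡ a₀)) B≥1 coprime

      q₋≡B′ : q₋ e ≡ B′
      q₋≡B′ = trans (penultimate-≡ 0 1) (trans (cong₂ ℕ._+_ (ℕP.*-identityʳ B′) (ℕP.*-zeroʳ C′)) (ℕP.+-identityʳ B′))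

    -- The identity p_n q_(n-1) - p_(n-1) q_n = (-1)^(n-1) for convergents, with p_(n-1) as the
    -- witness. Modulo q, `q₋ e` is the inverse of p up to a sign fixed by the parity of the last
    -- index.
    q₋-inverse : ∃[ k ] ↥ ρ ℤ.* + q₋ e ≡ k ℤ.* + ↧ₙ ρ ℤ.- -1ℤ ℤ.^ lastIndex e
    q₋-inverse = let (↥≡ , ↧≡) = ↥ρ,↧ρ in a₀ ℤ.* + B′ ℤ.+ + C′ ,
      subst₂ (λ i j → i ℤ.* + q₋ e ≡ (a₀ ℤ.* + B′ ℤ.+ + C′) ℤ.* + j ℤ.- -1ℤ ℤ.^ lastIndex e) (sym ↥≡) (sym ↧≡)
        (trans (cong (λ z → (a₀ ℤ.* + B ℤ.+ + C) ℤ.* + z) q₋≡B′)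
          (trans (solve 5 (λ a b b′ c c′ → (a :* b :+ c) :* b′ := (a :* b′ :+ c′) :* b :- (b :* c′ :- b′ :* c))
            refl a₀ (+ B) (+ B′) (+ C) (+ C′))
            (cong (λ z → (a₀ ℤ.* + B′ ℤ.+ + C′) ℤ.* + B ℤ.- z) determinant)))

    1≤q₋ : 1 ℕ.< ↧ₙ ρ → 1 ℕ.≤ q₋ e
    1≤q₋ 1<↧ with nonempty | ↥ρ,↧ρ
    ... | inj₂ h | _ = subst (1 ℕ.≤_) (sym q₋≡B′) h
    ... | inj₁ (B≡1 , _) | (_ , ↧≡B) = ⊥-elim (ℕP.<-irrefl (sym (trans ↧≡B B≡1)) 1<↧)

-- Numerators and denominators of the partial sums.

module Series where

  open NumberLemmas
  open ContinuedFractions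
  open import Data.Nat.Base using (_≤_; _<_; _*_; _+_; _^_)
  open ℤ-Solver using (solve; _:+_; _:*_; :-_; _:-_; _:=_; con)

  neg-sign : ∀ {i} → IsSign i → IsSign (ℤ.- i)
  neg-sign (inj₁ refl) = inj₂ refl
  neg-sign (inj₂ refl) = inj₁ refl

  -1^-even : ∀ k → -1ℤ ℤ.^ (2 * k) ≡ 1ℤ
  -1^-even k = trans (sym (ℤP.^-*-assoc -1ℤ 2 k)) (ℤP.^-zeroˡ k)

  -1^-odd : ∀ k → -1ℤ ℤ.^ (2 * k + 1) ≡ -1ℤ
  -1^-odd k = trans (cong (-1ℤ ℤ.^_) (ℕP.+-comm (2 * k) 1)) (cong (-1ℤ ℤ.*_) (-1^-even k))

  -- The numerator of the partial sum S n is congruent to σ n · p modulo q.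
  Compatible : ℚ → ℕ → (ℕ → ℤ) → (ℕ → ℤ) → Set
  Compatible ρ y₀ ε σ = ∀ n → ∃[ k ] σ n ℤ.* ↥ ρ ℤ.* + y₀ ℤ.+ ε (2 + n) ≡ σ (suc n) ℤ.* ↥ ρ ℤ.+ k ℤ.* + ↧ₙ ρ

  pos-∸1 : ∀ {a} → 1 ≤ a → + (a ℕ.∸ 1) ≡ + a ℤ.- 1ℤ
  pos-∸1 {suc a} _ = refl

  pos-*+ : ∀ a b c → + (a * b + c) ≡ + a ℤ.* + b ℤ.+ + c
  pos-*+ a b c = cong (ℤ._+ + c) (ℤP.pos-* a b)

  -- When `q₋ e` is 1 the value collapses to `m * ↧ₙ ρ`, and the requirement on `m` makes it
  -- positive. For larger `q₋ e` the part `q₋ e ∸ 1` suffices.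
  1≤mq+q₋∸1 : ∀ {ρ} m (e : Expansion ρ) → 1 < ↧ₙ ρ → (q₋ e ≡ 1 → 1 ≤ m) → 1 ≤ m * ↧ₙ ρ + q₋ e ℕ.∸ 1
  1≤mq+q₋∸1 {ρ} m e 1<q m≥1 with q₋ e | 1≤q₋ e 1<q
  ... | suc zero | _ = subst (λ z → 1 ≤ z ℕ.∸ 1) (ℕP.+-comm 1 (m * ↧ₙ ρ)) (ℕP.*-mono-≤ (m≥1 refl) (ℕP.<⇒≤ 1<q))
  ... | suc (suc r) | _ = subst (λ z → 1 ≤ z ℕ.∸ 1) (sym (ℕP.+-suc (m * ↧ₙ ρ) (suc r)))
    (ℕP.≤-trans (s≤s z≤n) (ℕP.m≤n+m (suc r) (m * ↧ₙ ρ)))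

  -- Congruences modulo q. In (E), p q₋ ≡ -1 gives p y₀ + 1 ≡ p q₋ + p + 1 ≡ p, so the sign stays 1.
  -- Let s = (-1)^n. In (P1), p q₋ ≡ -1 turns s p (q₋ - 1) + s into -s p; in (P2), p q₋ ≡ 1 turns s
  -- p (q₋ - 1) - s into -s p. There the sign alternates.
  construction-signs : ∀ {ρ y₀ ε} → Construction ρ y₀ ε →
    1 ≤ y₀ × (∀ j → IsSign (ε j)) × Σ (ℕ → ℤ) λ σ → σ 0 ≡ 1ℤ × (∀ n → IsSign (σ n)) × Compatible ρ y₀ ε σ
  construction-signs {ρ} (E m k e even) = ℕP.m≤n+m 1 _ , (λ _ → inj₁ refl) , (λ _ → 1ℤ) , refl , (λ _ → inj₁ refl) ,
    λ n → let (c , h) = q₋-inverse e in ↥ ρ ℤ.* + m ℤ.+ c ,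
      trans (cong (λ z → 1ℤ ℤ.* ↥ ρ ℤ.* z ℤ.+ 1ℤ) (cong (ℤ._+ 1ℤ) (pos-*+ m (↧ₙ ρ) (q₋ e))))
        (trans (solve 4 (λ p m q r → con 1ℤ :* p :* (m :* q :+ r :+ con 1ℤ) :+ con 1ℤ := p :* m :* q :+ p :* r :+ p
          :+ con 1ℤ) refl (↥ ρ) (+ m) (+ ↧ₙ ρ) (+ q₋ e))
          (trans (cong (λ z → ↥ ρ ℤ.* + m ℤ.* + ↧ₙ ρ ℤ.+ z ℤ.+ ↥ ρ ℤ.+ 1ℤ)
            (trans h (cong (λ z → c ℤ.* + ↧ₙ ρ ℤ.- z) (trans (cong (-1ℤ ℤ.^_) even) (-1^-even k)))))
            (solve 4 (λ p m q c → p :* m :* q :+ (c :* q :- con 1ℤ) :+ p :+ con 1ℤ := con 1ℤ :* p :+ (p :* m :+ c)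
              :* q) refl (↥ ρ) (+ m) (+ ↧ₙ ρ) c)))
  construction-signs {ρ} (P1 m k e even 1<q m≥1) = 1≤mq+q₋∸1 m e 1<q m≥1 , -1^-sign , (-1ℤ ℤ.^_) , refl , -1^-sign ,
    λ n → let (c , h) = q₋-inverse e ; s = -1ℤ ℤ.^ n in s ℤ.* (↥ ρ ℤ.* + m ℤ.+ c) ,
      trans (cong (λ z → s ℤ.* ↥ ρ ℤ.* z ℤ.+ -1ℤ ℤ.* (-1ℤ ℤ.* s))
        (trans (pos-∸1 (ℕP.≤-trans (1≤q₋ e 1<q) (ℕP.m≤n+m (q₋ e) (m * ↧ₙ ρ))))
        (cong (ℤ._- 1ℤ) (pos-*+ m (↧ₙ ρ) (q₋ e)))))
        (trans (solve 5 (λ s p m q r → s :* p :* (m :* q :+ r :- con 1ℤ) :+ con -1ℤ :* (con -1ℤ :* s) := s :*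
          (p :* m :* q :+ p :* r :- p :+ con 1ℤ)) refl s (↥ ρ) (+ m) (+ ↧ₙ ρ) (+ q₋ e))
          (trans (cong (λ z → s ℤ.* (↥ ρ ℤ.* + m ℤ.* + ↧ₙ ρ ℤ.+ z ℤ.- ↥ ρ ℤ.+ 1ℤ))
            (trans h (cong (λ z → c ℤ.* + ↧ₙ ρ ℤ.- z) (trans (cong (-1ℤ ℤ.^_) even) (-1^-even k)))))
            (solve 5 (λ s p m q c → s :* (p :* m :* q :+ (c :* q :- con 1ℤ) :- p :+ con 1ℤ) := con -1ℤ :* s :* p :+
              s :* (p :* m :+ c) :* q) refl s (↥ ρ) (+ m) (+ ↧ₙ ρ) c)))
  construction-signs {ρ} (P2 m k e odd 1<q m≥1) = 1≤mq+q₋∸1 m e 1<q m≥1 , (λ j → neg-sign (-1^-sign j)) ,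
    (-1ℤ ℤ.^_) , refl , -1^-sign ,
    λ n → let (c , h) = q₋-inverse e ; s = -1ℤ ℤ.^ n in s ℤ.* (↥ ρ ℤ.* + m ℤ.+ c) ,
      trans (cong (λ z → s ℤ.* ↥ ρ ℤ.* z ℤ.+ ℤ.- (-1ℤ ℤ.* (-1ℤ ℤ.* s)))
        (trans (pos-∸1 (ℕP.≤-trans (1≤q₋ e 1<q) (ℕP.m≤n+m (q₋ e) (m * ↧ₙ ρ))))
        (cong (ℤ._- 1ℤ) (pos-*+ m (↧ₙ ρ) (q₋ e)))))
        (trans (solve 5 (λ s p m q r → s :* p :* (m :* q :+ r :- con 1ℤ) :+ (:- (con -1ℤ :* (con -1ℤ :* s))) := s
          :* (p :* m :* q :+ p :* r :- p :- con 1ℤ)) refl s (↥ ρ) (+ m) (+ ↧ₙ ρ) (+ q₋ e))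
          (trans (cong (λ z → s ℤ.* (↥ ρ ℤ.* + m ℤ.* + ↧ₙ ρ ℤ.+ z ℤ.- ↥ ρ ℤ.- 1ℤ))
            (trans h (cong (λ z → c ℤ.* + ↧ₙ ρ ℤ.- z) (trans (cong (-1ℤ ℤ.^_) odd) (-1^-odd k)))))
            (solve 5 (λ s p m q c → s :* (p :* m :* q :+ (c :* q :- con -1ℤ) :- p :- con 1ℤ) := con -1ℤ :* s :* p
              :+ s :* (p :* m :+ c) :* q) refl s (↥ ρ) (+ m) (+ ↧ₙ ρ) c)))

  coprime-* : ∀ {a b c} → Coprime a b → Coprime a c → Coprime a (b * c)
  coprime-* a⊥b a⊥c (d∣a , d∣bc) =
    a⊥c (d∣a , Coprimality.coprime-divisor (λ (k∣d , k∣b) → a⊥b (∣-trans k∣d d∣a , k∣b)) d∣bc)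

  module Sequences (q y₀ : ℕ) (u : ℕ → ℕ) where

    X Y : ℕ → ℕ
    X n = xSeq q y₀ u (suc n)
    Y n = ySeq q y₀ u n

    -- Elimination of `Y`: the quotient of consecutive `X` is a value of `Y`, and consecutive
    -- quotients differ by the factor `1 + u (2 + n) * X (1 + n)`.
    X-recurrence : ∀ n → X (2 + n) * X n ≡ X (1 + n) * X (1 + n) * (1 + u (2 + n) * X (1 + n))
    X-recurrence n = solveℕ 3 (λ x y z → x ⊗ y ⊗ (y ⊗ z) ⊗ x ⊜ x ⊗ y ⊗ (x ⊗ y) ⊗ z)
      refl (X n) (Y (1 + n)) (1 + u (2 + n) * X (1 + n))

    Y∣Y : ∀ {j n} → j ℕ.≤′ n → Y j ∣ Y n
    Y∣Y (ℕ.≤′-reflexive refl) = ∣-refl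
    Y∣Y {n = suc n} (ℕ.≤′-step h) = ∣-trans (Y∣Y h) (m∣m*n (1 + u (suc n) * X n))

    q∣X : ∀ n → q ∣ X n
    q∣X zero = ∣-refl
    q∣X (suc n) = ∣-trans (q∣X n) (m∣m*n (Y (suc n)))

    -- Since q divides every `X n`, each factor 1 + u X is 1 modulo q.
    Y-mod : ∀ n → ∃[ k ] Y n ≡ y₀ + k * q
    Y-mod zero = 0 , sym (ℕP.+-identityʳ y₀)
    Y-mod (suc n) with Y-mod n | q∣X n
    ... | k , h | divides l eq = k + Y n * (u (suc n) * l) , trans
      (cong (λ z → Y n * (1 + u (suc n) * z)) eq)
      (trans (solveℕ 4 (λ y u l q → y ⊗ (nat 1 ⊕ u ⊗ (l ⊗ q)) ⊜ y ⊕ y ⊗ (u ⊗ l) ⊗ q) refl (Y n) (u (suc n)) l q)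
        (trans (cong (_+ Y n * (u (suc n) * l) * q) h)
          (solveℕ 4 (λ y k q z → y ⊕ k ⊗ q ⊕ z ⊗ q ⊜ y ⊕ (k ⊕ z) ⊗ q) refl y₀ k q (Y n * (u (suc n) * l)))))

    module Growth (1≤q : 1 ≤ q) (1≤y₀ : 1 ≤ y₀) (1≤u : ∀ n → 1 ≤ n → 1 ≤ u n) where

      mutual
        1≤X : ∀ n → 1 ≤ X n
        1≤X zero = 1≤q
        1≤X (suc n) = ℕP.*-mono-≤ (1≤X n) (1≤Y (suc n))

        1≤Y : ∀ n → 1 ≤ Y n
        1≤Y zero = 1≤y₀
        1≤Y (suc n) = ℕP.*-mono-≤ (1≤Y n) (s≤s z≤n)

      1+X≤Y : ∀ n → Y n * (1 + X n) ≤ Y (suc n)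
      1+X≤Y n = ℕP.*-monoʳ-≤ (Y n) (s≤s
        (subst (_≤ u (suc n) * X n) (ℕP.*-identityˡ (X n)) (ℕP.*-monoˡ-≤ (X n) (1≤u (suc n) (s≤s z≤n)))))

      2≤Y : ∀ n → 2 ≤ Y (suc n)
      2≤Y n = ℕP.≤-trans (ℕP.*-mono-≤ (1≤Y n) (s≤s (1≤X n))) (1+X≤Y n)

      2^n≤X : ∀ n → 2 ^ n ≤ X n
      2^n≤X zero = 1≤q
      2^n≤X (suc n) = subst (2 ^ suc n ≤_) (ℕP.*-comm (Y (suc n)) (X n)) (ℕP.*-mono-≤ (2≤Y n) (2^n≤X n))

      -- The quotient is `Y (2 + n)`, at least 2 times 2. The statement starts at index 1 because
      -- `Y 1` is only known to be at least 2.
      4X≤X : ∀ n → 4 * X (1 + n) ≤ X (2 + n)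
      4X≤X n = subst (4 * X (1 + n) ≤_) (ℕP.*-comm (Y (2 + n)) (X (1 + n))) (ℕP.*-monoˡ-≤ (X (1 + n))
        (ℕP.≤-trans (ℕP.*-mono-≤ (2≤Y n) (ℕP.≤-trans (s≤s (1≤X (1 + n))) ℕP.≤-refl)) (1+X≤Y (1 + n))))

    module Denominators {ρ : ℚ} (q≡↧ρ : q ≡ ↧ₙ ρ) (1≤q : 1 ≤ q) (1≤y₀ : 1 ≤ y₀) (1≤u : ∀ n → 1 ≤ n → 1 ≤ u n)
      {ε : ℕ → ℤ} (ε-sign : ∀ j → IsSign (ε j))
      {σ : ℕ → ℤ} (σ-zero : σ 0 ≡ 1ℤ) (σ-sign : ∀ n → IsSign (σ n)) (compatible : Compatible ρ y₀ ε σ) where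

      open Growth 1≤q 1≤y₀ 1≤u

      S : ℕ → ℚ
      S = partialSum ρ ε (xSeq q y₀ u)

      -- Numerators over the denominators `X n`, which grow by the factor `Y (suc n)`.
      P : ℕ → ℤ
      P zero = ↥ ρ
      P (suc n) = P n ℤ.* + Y (suc n) ℤ.+ ε (2 + n)

      S*X≡P : ∀ n → S n ℚ.* fromℕ (X n) ≡ fromℤ (P n)
      S*X≡P zero = trans (cong (λ z → ρ ℚ.* fromℕ z) q≡↧ρ) (sym (↥≡*↧ ρ))
      S*X≡P (suc n) = begin
        (S n ℚ.+ e ℚ.* i) ℚ.* fromℕ (X n * Y (suc n)) ≡⟨ ℚP.*-distribʳ-+ (fromℕ (X (suc n))) (S n) (e ℚ.* i) ⟩
        S n ℚ.* fromℕ (X n * Y (suc n)) ℚ.+ e ℚ.* i ℚ.* fromℕ (X (suc n)) ≡⟨ cong₂ ℚ._+_ eq₁ eq₂ ⟩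
        fromℤ (P n ℤ.* + Y (suc n)) ℚ.+ e ≡⟨ sym (fromℤ-+ (P n ℤ.* + Y (suc n)) (ε (2 + n))) ⟩
        fromℤ (P (suc n)) ∎
        where
          open ≡-Reasoning
          e i : ℚ
          e = fromℤ (ε (2 + n))
          i = fromℕ (X (suc n)) ⁻¹
          eq₁ : S n ℚ.* fromℕ (X n * Y (suc n)) ≡ fromℤ (P n ℤ.* + Y (suc n))
          eq₁ = trans (cong (S n ℚ.*_) (fromℕ-* (X n) (Y (suc n))))
            (trans (sym (ℚP.*-assoc (S n) (fromℕ (X n)) (fromℕ (Y (suc n)))))
            (trans (cong (ℚ._* fromℕ (Y (suc n))) (S*X≡P n)) (sym (fromℤ-* (P n) (+ Y (suc n))))))
          eq₂ : e ℚ.* i ℚ.* fromℕ (X (suc n)) ≡ e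
          eq₂ = trans (ℚP.*-assoc e i (fromℕ (X (suc n))))
            (trans (cong (e ℚ.*_) (trans (ℚP.*-comm i (fromℕ (X (suc n))))
            (⁻¹-inverseʳ (fromℕ (X (suc n))) (0<fromℕ (1≤X (suc n)))))) (ℚP.*-identityʳ e))

      P-mod : ∀ n → ∃[ k ] P n ≡ σ n ℤ.* ↥ ρ ℤ.+ k ℤ.* + q
      P-mod zero = ℤ.0ℤ , sym (trans (ℤP.+-identityʳ (σ 0 ℤ.* ↥ ρ))
        (trans (cong (ℤ._* ↥ ρ) σ-zero) (ℤP.*-identityˡ (↥ ρ))))
      P-mod (suc n) with P-mod n | Y-mod (suc n) | compatible n
      ... | k , hP | l , hY | m , hσ = m ℤ.+ c , (begin
        P n ℤ.* + Y (suc n) ℤ.+ ε (2 + n) ≡⟨ cong₂ (λ x y → x ℤ.* y ℤ.+ ε (2 + n)) hP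
          (trans (cong +_ hY) (cong (λ z → + y₀ ℤ.+ z) (ℤP.pos-* l q))) ⟩
        (σ n ℤ.* ↥ ρ ℤ.+ k ℤ.* + q) ℤ.* (+ y₀ ℤ.+ + l ℤ.* + q) ℤ.+ ε (2 + n)
          ≡⟨ solve 6 (λ p y e k l q → (p :+ k :* q) :* (y :+ l :* q) :+ e := (p :* y :+ e) :+
            (p :* l :+ k :* (y :+ l :* q)) :* q)
               refl (σ n ℤ.* ↥ ρ) (+ y₀) (ε (2 + n)) k (+ l) (+ q) ⟩
        σ n ℤ.* ↥ ρ ℤ.* + y₀ ℤ.+ ε (2 + n) ℤ.+ c ℤ.* + q ≡⟨ cong (ℤ._+ c ℤ.* + q)
          (trans hσ (cong (λ z → σ (suc n) ℤ.* ↥ ρ ℤ.+ m ℤ.* + z) (sym q≡↧ρ))) ⟩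
        σ (suc n) ℤ.* ↥ ρ ℤ.+ m ℤ.* + q ℤ.+ c ℤ.* + q ≡⟨ solve 4
          (λ a m c q → a :+ m :* q :+ c :* q := a :+ (m :+ c) :* q) refl (σ (suc n) ℤ.* ↥ ρ) m c (+ q) ⟩
        σ (suc n) ℤ.* ↥ ρ ℤ.+ (m ℤ.+ c) ℤ.* + q ∎)
        where
          open ≡-Reasoning
          c : ℤ
          c = σ n ℤ.* ↥ ρ ℤ.* + l ℤ.+ k ℤ.* (+ y₀ ℤ.+ + l ℤ.* + q)

      ∣sign*i∣ : ∀ {s} i → IsSign s → ∣ s ℤ.* i ∣ ≡ ∣ i ∣
      ∣sign*i∣ {s} i (inj₁ refl) = cong ∣_∣ (ℤP.*-identityˡ i)
      ∣sign*i∣ {s} i (inj₂ refl) = trans (cong ∣_∣ (ℤP.-1*i≡-i i)) (ℤP.∣-i∣≡∣i∣ i)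

      coprime-q : ∀ n → Coprime ∣ P n ∣ q
      coprime-q n {d} (d∣P , d∣q) = let (k , h) = P-mod n in coprime-ρ ρ
        ( subst (d ∣_) (∣sign*i∣ (↥ ρ) (σ-sign n))
          (ℤS.∣⇒∣ᵤ (ℤS.∣m+n∣n⇒∣m {+ d} {σ n ℤ.* ↥ ρ} {k ℤ.* + q} (subst (ℤS._∣_ (+ d)) h (ℤS.∣ᵤ⇒∣ d∣P))
            (ℤS.∣n⇒∣m*n k (ℤS.∣ᵤ⇒∣ {+ d} {+ q} d∣q))))
        , subst (d ∣_) q≡↧ρ d∣q)
        where
          coprime-ρ : ∀ ρ → Coprime ∣ ↥ ρ ∣ (↧ₙ ρ)
          coprime-ρ (mkℚ _ _ c) = Coprimality.recompute c

      -- Modulo `Y (suc n)` only the summand `ε (2 + n)` of the numerator survives, and it is a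
      -- unit.
      coprime-Y : ∀ n → Coprime ∣ P (suc n) ∣ (Y (suc n))
      coprime-Y n {d} (d∣P , d∣Y) = ∣1⇒≡1 (subst (d ∣_) (∣sign∣ (ε-sign (2 + n)))
        (ℤS.∣⇒∣ᵤ (ℤS.∣m+n∣m⇒∣n {+ d} {P n ℤ.* + Y (suc n)} {ε (2 + n)} (ℤS.∣ᵤ⇒∣ d∣P)
          (ℤS.∣n⇒∣m*n (P n) (ℤS.∣ᵤ⇒∣ {+ d} {+ Y (suc n)} d∣Y)))))

      -- `X j` is q times Y 1, ..., Y j, and each of these factors divides `Y n`; so coprimality to
      -- q and to the last factor is enough.
      coprime-X : ∀ n j → j ≤ n → Coprime ∣ P n ∣ (X j)
      coprime-X n zero _ = coprime-q n
      coprime-X (suc n) (suc j) h = coprime-* (coprime-X (suc n) j (ℕP.<⇒≤ h))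
        (λ (d∣P , d∣Y) → coprime-Y n (d∣P , ∣-trans d∣Y (Y∣Y (ℕP.≤⇒≤′ h))))

      ↧S≡X : ∀ n → ↧ₙ (S n) ≡ X n
      ↧S≡X n = proj₂ (lowest-terms (S n) {P n} (S*X≡P n) (1≤X n) (coprime-X n n ℕP.≤-refl))

-- Two-sided error bounds for the partial sums.

module Tails where

  open NumberLemmas
  open ContinuedFractions using (⁻¹-inverseʳ; IsSign)
  open import Data.Rational.Base using (-_; _+_; _-_; _*_; _<_; _≤_)
  open ℚ-Solver using (solve; _:+_; _:*_; :-_; _:-_; _:=_; con)

  0≤½ : 0ℚ ≤ ½
  0≤½ = ℚP.nonNegative⁻¹ ½

  0<½ : 0ℚ < ½
  0<½ = ℚP.positive⁻¹ ½

  converges-near : ∀ {f α} → f ConvergesTo α → ∀ {δ} → 0ℚ < δ →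
    Eventually (λ n → lower α (f n - δ) × upper α (f n + δ))
  converges-near {f} {α} conv {δ} 0<δ = let (N , h) = conv δ 0<δ in
    N , λ n N≤n → let (r , (u , l) , r<δ) = h n N≤n in
      lower-closed α (≤-by-difference (δ - r) (p≤q⇒0≤q-p (ℚP.<⇒≤ r<δ))
        (solve 3 (λ f d r → (:- r) :- (:- f) := (f :- d) :+ (d :- r)) refl (f n) δ r)) l ,
      upper-closed α (≤-by-difference (δ - r) (p≤q⇒0≤q-p (ℚP.<⇒≤ r<δ))
        (solve 3 (λ f d r → f :+ d := (r :- (:- f)) :+ (d :- r)) refl (f n) δ r)) u

  module Errors {X : ℕ → ℕ} (1≤X : ∀ n → 1 ℕ.≤ X n) (4X≤X : ∀ n → 4 ℕ.* X (1 ℕ.+ n) ℕ.≤ X (2 ℕ.+ n))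
    {ρ : ℚ} {ε : ℕ → ℤ} (ε-sign : ∀ j → IsSign (ε j)) {x : ℕ → ℕ} (x≡X : ∀ n → x (suc n) ≡ X n) where

    1/X : ℕ → ℚ
    1/X n = fromℕ (X n) ⁻¹

    X*1/X : ∀ n → fromℕ (X n) * 1/X n ≡ 1ℚ
    X*1/X n = ⁻¹-inverseʳ (fromℕ (X n)) (0<fromℕ (1≤X n))

    0<1/X : ∀ n → 0ℚ < 1/X n
    0<1/X n = *-cancelʳ-<₀ (0≤fromℕ (X n)) (subst₂ _<_ (sym (ℚP.*-zeroˡ (fromℕ (X n))))
      (trans (sym (X*1/X n)) (ℚP.*-comm (fromℕ (X n)) (1/X n))) 0<1)

    1/X-shrinks : ∀ n → fromℕ 4 * 1/X (2 ℕ.+ n) ≤ 1/X (1 ℕ.+ n)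
    1/X-shrinks n = begin
      c * j ≡⟨ sym (ℚP.*-identityˡ (c * j)) ⟩
      1ℚ * (c * j) ≡⟨ cong (_* (c * j)) (sym (X*1/X (1 ℕ.+ n))) ⟩
      fromℕ (X (1 ℕ.+ n)) * i * (c * j) ≡⟨ solve 4 (λ x i c j → x :* i :* (c :* j) := (c :* x) :* (i :* j)) refl
        (fromℕ (X (1 ℕ.+ n))) i c j ⟩
      c * fromℕ (X (1 ℕ.+ n)) * (i * j) ≡⟨ cong (_* (i * j)) (sym (fromℕ-* 4 (X (1 ℕ.+ n)))) ⟩
      fromℕ (4 ℕ.* X (1 ℕ.+ n)) * (i * j) ≤⟨ *-monoʳ-≤₀ (ℚP.<⇒≤ (0<* (0<1/X (1 ℕ.+ n)) (0<1/X (2 ℕ.+ n))))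
        (fromℕ-mono-≤ (4X≤X n)) ⟩
      fromℕ (X (2 ℕ.+ n)) * (i * j) ≡⟨ solve 3 (λ x i j → x :* (i :* j) := (x :* j) :* i) refl
        (fromℕ (X (2 ℕ.+ n))) i j ⟩
      fromℕ (X (2 ℕ.+ n)) * j * i ≡⟨ trans (cong (_* i) (X*1/X (2 ℕ.+ n))) (ℚP.*-identityˡ i) ⟩
      i ∎
      where
        open ℚP.≤-Reasoning
        c i j : ℚ
        c = fromℕ 4
        i = 1/X (1 ℕ.+ n)
        j = 1/X (2 ℕ.+ n)

    S : ℕ → ℚ
    S = partialSum ρ ε x

    S-suc : ∀ n → S (suc n) ≡ S n + fromℤ (ε (2 ℕ.+ n)) * 1/X (suc n)
    S-suc n = cong (λ z → S n + fromℤ (ε (2 ℕ.+ n)) * fromℕ z ⁻¹) (x≡X (suc n))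

    private
      Within : ℚ → ℚ → ℚ → Set
      Within a p q = q - a ≤ p × p ≤ q + a

      within-mono : ∀ {a b p q} → a ≤ b → Within a p q → Within b p q
      within-mono {a} {b} {p} {q} a≤b (l , u) =
        ℚP.≤-trans (ℚP.+-monoʳ-≤ q (ℚP.neg-antimono-≤ a≤b)) l , ℚP.≤-trans u (ℚP.+-monoʳ-≤ q a≤b)

      from-first-term : ∀ j n → S (j ℕ.+ suc n) ≡ S (suc j ℕ.+ n)
      from-first-term j n = cong S (ℕP.+-suc j n)

      -- The terms after the first add up to at most (3/2) / X (2+n), which the factor 4 makes at
      -- most 3/8 of 1 / X (1+n); this is rounded up to a half.
      tail-half : ∀ j n → Within ((1ℚ + ½) * 1/X (2 ℕ.+ n)) (S (j ℕ.+ suc n)) (S (suc n)) →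
        Within (½ * 1/X (1 ℕ.+ n)) (S (suc j ℕ.+ n)) (S n + fromℤ (ε (2 ℕ.+ n)) * 1/X (1 ℕ.+ n))
      tail-half j n w = subst₂ (Within (½ * 1/X (1 ℕ.+ n))) (from-first-term j n) (S-suc n)
        (within-mono {(1ℚ + ½) * 1/X (2 ℕ.+ n)} {½ * 1/X (1 ℕ.+ n)} {S (j ℕ.+ suc n)} {S (suc n)}
          (≤-by-difference (½ * (1/X (1 ℕ.+ n) - fromℕ 4 * 1/X (2 ℕ.+ n)) + ½ * 1/X (2 ℕ.+ n))
            (0≤+ (0≤* 0≤½ (p≤q⇒0≤q-p (1/X-shrinks n))) (0≤* 0≤½ (ℚP.<⇒≤ (0<1/X (2 ℕ.+ n)))))
            (solve 2 (λ i j → con ½ :* i := (con 1ℚ :+ con ½) :* j :+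
              (con ½ :* (i :- con (fromℕ 4) :* j) :+ con ½ :* j)) refl (1/X (1 ℕ.+ n)) (1/X (2 ℕ.+ n))))
          w)

      -- The constant 3/2 reproduces itself: the first term contributes 1 and, by `tail-half`, the
      -- rest at most 1/2.
      tail : ∀ j n → Within ((1ℚ + ½) * 1/X (1 ℕ.+ n)) (S (j ℕ.+ n)) (S n)
      tail zero n =
        ≤-by-difference ((1ℚ + ½) * 1/X (1 ℕ.+ n)) 0≤a
          (solve 2 (λ s a → s := (s :- a) :+ a) refl (S n) ((1ℚ + ½) * 1/X (1 ℕ.+ n))) , p≤p+q 0≤a
        where
          0≤a : 0ℚ ≤ (1ℚ + ½) * 1/X (1 ℕ.+ n)
          0≤a = 0≤* (0≤+ 0≤1 0≤½) (ℚP.<⇒≤ (0<1/X (1 ℕ.+ n)))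
      tail (suc j) n = by-sign (ε-sign (2 ℕ.+ n)) (tail-half j n (tail j (suc n)))
        where
          i s : ℚ
          i = 1/X (1 ℕ.+ n)
          s = S n
          0≤i : 0ℚ ≤ i
          0≤i = ℚP.<⇒≤ (0<1/X (1 ℕ.+ n))
          by-sign : ∀ {e} → IsSign e → Within (½ * i) (S (suc j ℕ.+ n)) (s + fromℤ e * i) → Within ((1ℚ + ½) * i)
            (S (suc j ℕ.+ n)) s
          by-sign (inj₁ refl) (l , u) =
            ℚP.≤-trans (≤-by-difference (i + i) (0≤+ 0≤i 0≤i)
              (solve 2 (λ s i → (s :+ con 1ℚ :* i) :- con ½ :* i := (s :- (con 1ℚ :+ con ½) :* i) :+ (i :+ i))
              refl s i)) l ,
            ℚP.≤-trans u (ℚP.≤-reflexive (solve 2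
              (λ s i → (s :+ con 1ℚ :* i) :+ con ½ :* i := s :+ (con 1ℚ :+ con ½) :* i) refl s i))
          by-sign (inj₂ refl) (l , u) =
            ℚP.≤-trans (ℚP.≤-reflexive (solve 2
              (λ s i → s :- (con 1ℚ :+ con ½) :* i := (s :+ (:- con 1ℚ) :* i) :- con ½ :* i) refl s i)) l ,
            ℚP.≤-trans u (≤-by-difference (i + i) (0≤+ 0≤i 0≤i)
              (solve 2 (λ s i → s :+ (con 1ℚ :+ con ½) :* i := ((s :+ (:- con 1ℚ) :* i) :+ con ½ :* i) :+
              (i :+ i)) refl s i))

    module _ {α : ℝ} (conv : S ConvergesTo α) where

      -- In units of 1 / X (1+n): 3/2 for a late partial sum and 1/2 for its distance from `α`.
      upper-error : ∀ n → upper ∣ α -ʳ S n ∣ʳ (fromℕ 2 * 1/X (1 ℕ.+ n))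
      upper-error n = let (N , h) = converges-near {S} {α} conv (0<* 0<½ (0<1/X (1 ℕ.+ n)))
                          (l , u) = h (N ℕ.+ n) (ℕP.m≤m+n N n)
                          (tl , tu) = tail N n in
        upper-closed α (≤-by-difference ((s + (1ℚ + ½) * i) - S (N ℕ.+ n)) (p≤q⇒0≤q-p tu)
          (solve 3 (λ s i m → con (fromℕ 2) :* i :- (:- s) := (m :+ con ½ :* i) :+
            ((s :+ (con 1ℚ :+ con ½) :* i) :- m)) refl s i (S (N ℕ.+ n)))) u ,
        lower-closed α (≤-by-difference (S (N ℕ.+ n) - (s - (1ℚ + ½) * i)) (p≤q⇒0≤q-p tl)
          (solve 3 (λ s i m → m :- con ½ :* i := (:- (con (fromℕ 2) :* i) :- (:- s)) :+
            (m :- (s :- (con 1ℚ :+ con ½) :* i))) refl s i (S (N ℕ.+ n)))) l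
        where
          i s : ℚ
          i = 1/X (1 ℕ.+ n)
          s = S n

      -- In units of 1 / X (1+n): the first omitted term has modulus 1, the later terms of a late
      -- partial sum take back at most 1/2, and its distance from `α` at most 1/4.
      lower-error : ∀ n → lower ∣ α -ʳ S n ∣ʳ (½ * ½ * 1/X (1 ℕ.+ n))
      lower-error n = let (N , h) = converges-near {S} {α} conv (0<* (0<* 0<½ 0<½) (0<1/X (1 ℕ.+ n))) in
        -- `suc N` instead of `N`: the late partial sum must contain the term with `ε (2 + n)` even
        -- if `N` is 0.
        by-sign N (ε-sign (2 ℕ.+ n)) (h (suc N ℕ.+ n) (ℕP.≤-trans (ℕP.m≤m+n N n) (ℕP.n≤1+n (N ℕ.+ n))))
          (tail-half N n (tail N (suc n)))
        where
          i s : ℚ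
          i = 1/X (1 ℕ.+ n)
          s = S n
          by-sign : ∀ N {e} → IsSign e →
            lower α (S (suc N ℕ.+ n) - ½ * ½ * i) × upper α (S (suc N ℕ.+ n) + ½ * ½ * i) →
            Within (½ * i) (S (suc N ℕ.+ n)) (s + fromℤ e * i) → lower ∣ α -ʳ s ∣ʳ (½ * ½ * i)
          by-sign N (inj₁ refl) (l , _) (tl , _) = inj₁
            (lower-closed α (≤-by-difference (S (suc N ℕ.+ n) - ((s + 1ℚ * i) - ½ * i)) (p≤q⇒0≤q-p tl)
            (solve 3 (λ s i m → m :- con (½ * ½) :* i := (con (½ * ½) :* i :- (:- s)) :+
              (m :- ((s :+ con 1ℚ :* i) :- con ½ :* i))) refl s i (S (suc N ℕ.+ n)))) l)
          by-sign N (inj₂ refl) (_ , u) (_ , tu) = inj₂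
            (upper-closed α (≤-by-difference (((s + (- 1ℚ) * i) + ½ * i) - S (suc N ℕ.+ n)) (p≤q⇒0≤q-p tu)
            (solve 3 (λ s i m → :- (con (½ * ½) :* i) :- (:- s) := (m :+ con (½ * ½) :* i) :+
              (((s :+ (:- con 1ℚ) :* i) :+ con ½ :* i) :- m)) refl s i (S (suc N ℕ.+ n)))) u)

-- The coefficients u and their leading term.

module Coefficients where

  open NumberLemmas
  open import Data.Nat.Base using (_≤_; _<_; _*_; _+_; _^_; _∸_)

  lower-·ʳ : ∀ {c} .{{_ : Positive c}} {x r} → lower (c ·ʳ x) r → ∃[ s ] lower x s × s ℚ.* c ≡ r
  lower-·ʳ {c} {r = r} l = _ , l , trans (ℚP.*-assoc r (ℚ.1/ c) c)
    (trans (cong (r ℚ.*_) (ℚP.*-inverseˡ c)) (ℚP.*-identityʳ r))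
    where instance _ = ℚP.pos⇒nonZero c

  lower-∣fromℤ∣ : ∀ i {r} → r ℚ.< fromℕ ∣ i ∣ → lower ∣ fromℚ (fromℤ i) ∣ʳ r
  lower-∣fromℤ∣ (+ n) h = inj₁ h
  lower-∣fromℤ∣ -[1+ n ] h = inj₂ (ℚP.neg-antimono-< h)

  lower-∣fromℤ∣⁻¹ : ∀ i {r} → lower ∣ fromℚ (fromℤ i) ∣ʳ r → r ℚ.< fromℕ ∣ i ∣
  lower-∣fromℤ∣⁻¹ (+ n) (inj₁ h) = h
  lower-∣fromℤ∣⁻¹ (+ n) (inj₂ h) = ℚP.<-≤-trans (p<-q⇒q<-p h) (ℚP.≤-trans (ℚP.neg-antimono-≤ (0≤fromℕ n)) (0≤fromℕ n))
  lower-∣fromℤ∣⁻¹ -[1+ n ] (inj₁ h) = ℚP.<-trans h (ℚP.<-trans (ℚP.neg-antimono-< (0<fromℕ-suc n)) (0<fromℕ-suc n))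
  lower-∣fromℤ∣⁻¹ -[1+ n ] {r} (inj₂ h) = subst₂ ℚ._<_ (neg-neg r) (neg-neg (fromℕ (suc n))) (ℚP.neg-antimono-< h)

  -- If the bound with `C` failed, a rational strictly between both sides would be below the modulus
  -- of `a n`, hence by hypothesis below `C` times that of `b n`. Afterwards `C` is rounded up to a
  -- natural number.
  =O⇒≤ : ∀ {a b : ℕ → ℤ} → (λ n → fromℚ (fromℤ (a n))) =O (λ n → fromℚ (fromℤ (b n))) →
    ∃[ c ] Eventually (λ n → ∣ a n ∣ ≤ c * ∣ b n ∣)
  =O⇒≤ {a} {b} (C , C>0 , N , h) = let (c , C<c) = archimedean C in c , N , λ n N≤n →
    fromℕ-cancel-≤ (subst (fromℕ ∣ a n ∣ ℚ.≤_) (sym (fromℕ-* c ∣ b n ∣))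
      (ℚP.≤-trans (bound n N≤n) (*-monoʳ-≤₀ (0≤fromℕ ∣ b n ∣) (ℚP.<⇒≤ C<c))))
    where
      bound : ∀ n → N ≤ n → fromℕ ∣ a n ∣ ℚ.≤ C ℚ.* fromℕ ∣ b n ∣
      bound n N≤n with ≤₀⊎>₀ (fromℕ ∣ a n ∣) (C ℚ.* fromℕ ∣ b n ∣)
      ... | inj₁ le = le
      ... | inj₂ gt =
        let (r , Cb<r , r<a) = ℚP.<-dense gt
            (s , ls , sC≡r) = lower-·ʳ {C} {{C>0}} {∣ fromℚ (fromℤ (b n)) ∣ʳ} (h n N≤n (lower-∣fromℤ∣ (a n) r<a))
        in ⊥-elim (ℚP.<-asym Cb<r (subst₂ ℚ._<_ sC≡r (ℚP.*-comm (fromℕ ∣ b n ∣) C)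
             (ℚP.*-monoˡ-<-pos C {{C>0}} (lower-∣fromℤ∣⁻¹ (b n) ls))))

  ∣sum∣*≤ : ∀ {n} (t : Fin n → ℤ) {x M} → (∀ i → ∣ t i ∣ * x ≤ M) → ∣ sum t ∣ * x ≤ n * M
  ∣sum∣*≤ {zero} t h = z≤n
  ∣sum∣*≤ {suc n} t {x} {M} h = ℕP.≤-trans
    (ℕP.*-monoˡ-≤ x (ℤP.∣i+j∣≤∣i∣+∣j∣ (t Fin.zero) (sum (λ i → t (Fin.suc i)))))
    (subst (_≤ suc n * M) (sym (ℕP.*-distribʳ-+ x ∣ t Fin.zero ∣ ∣ sum (λ i → t (Fin.suc i)) ∣))
      (ℕP.+-mono-≤ (h Fin.zero) (∣sum∣*≤ (λ i → t (Fin.suc i)) (λ i → h (Fin.suc i)))))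

  pos-^ : ∀ x k → (+ x) ℤ.^ k ≡ + (x ^ k)
  pos-^ x zero = refl
  pos-^ x (suc k) = trans (cong (+ x ℤ.*_) (pos-^ x k)) (sym (ℤP.pos-* x (x ^ k)))

  module _ {d c V x : ℕ} (v : ℕ → ℤ) (v₀≡V : v 0 ≡ + V) (v≤cV : ∀ j → 1 ≤ j → j < suc d → ∣ v j ∣ ≤ c * V)
    (1≤x : 1 ≤ x) where

    private
      -- The leading term of u. Here `d` is one less than the d of the theorem, so it is the top
      -- exponent.
      W : ℕ
      W = V * x ^ d

      rest : Fin d → ℤ
      rest i = v (suc (toℕ i)) ℤ.* (+ x) ℤ.^ (d ∸ suc (toℕ i))

      ∑v≡W+rest : ∑v (suc d) v x ≡ + W ℤ.+ sum rest
      ∑v≡W+rest = cong (ℤ._+ sum rest) (trans (cong₂ ℤ._*_ v₀≡V (pos-^ x d)) (sym (ℤP.pos-* V (x ^ d))))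

      -- A lower term has at least one factor x fewer than the leading term; multiplying by `x` says
      -- so without division.
      rest-bound : ∀ i → ∣ rest i ∣ * x ≤ c * W
      rest-bound i = begin
        ∣ rest i ∣ * x ≡⟨ cong (_* x) (trans (ℤP.abs-* (v (suc (toℕ i))) _)
          (cong (λ z → ∣ v (suc (toℕ i)) ∣ * ∣ z ∣) (pos-^ x (d ∸ suc (toℕ i))))) ⟩
        ∣ v (suc (toℕ i)) ∣ * x ^ (d ∸ suc (toℕ i)) * x ≡⟨ ℕP.*-assoc ∣ v (suc (toℕ i)) ∣ _ x ⟩
        ∣ v (suc (toℕ i)) ∣ * (x ^ (d ∸ suc (toℕ i)) * x) ≤⟨ ℕP.*-mono-≤
          (v≤cV (suc (toℕ i)) (s≤s z≤n) (s≤s (toℕ<n i))) power ⟩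
        c * V * x ^ d ≡⟨ ℕP.*-assoc c V (x ^ d) ⟩
        c * W ∎
        where
          open ℕP.≤-Reasoning
          instance _ = ℕ.>-nonZero 1≤x
          power : x ^ (d ∸ suc (toℕ i)) * x ≤ x ^ d
          power = subst (_≤ x ^ d) (ℕP.*-comm x _)
            (ℕP.^-monoʳ-≤ x (subst (_≤ d) (ℕP.+-∸-assoc 1 (toℕ<n i)) (ℕP.m∸n≤m d (toℕ i))))

    module _ (large : 2 * (d * c) ≤ x) {U : ℕ} (U≡∑v : + U ≡ ∑v (suc d) v x) where

      private
        R : ℕ
        R = ∣ sum rest ∣

        -- Each of the `d` lower terms is at most c W / x, so together they are at most half the
        -- leading term once x ≥ 2 d c. This determines u up to a factor 2.
        2R≤W : 2 * R ≤ W
        2R≤W = ℕP.*-cancelʳ-≤ (2 * R) W x (begin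
          2 * R * x ≡⟨ ℕP.*-assoc 2 R x ⟩
          2 * (R * x) ≤⟨ ℕP.*-monoʳ-≤ 2 (∣sum∣*≤ rest rest-bound) ⟩
          2 * (d * (c * W)) ≡⟨ solveℕ 3 (λ d c w → nat 2 ⊗ (d ⊗ (c ⊗ w)) ⊜ nat 2 ⊗ (d ⊗ c) ⊗ w) refl d c W ⟩
          2 * (d * c) * W ≤⟨ ℕP.*-monoˡ-≤ W large ⟩
          x * W ≡⟨ ℕP.*-comm x W ⟩
          W * x ∎)
          where
            open ℕP.≤-Reasoning
            instance _ = ℕ.>-nonZero 1≤x

        U≡W+rest : + U ≡ + W ℤ.+ sum rest
        U≡W+rest = trans U≡∑v ∑v≡W+rest

      u≤2Vx^ : U ≤ 2 * W
      u≤2Vx^ = begin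
        U ≡⟨ cong ∣_∣ U≡W+rest ⟩
        ∣ + W ℤ.+ sum rest ∣ ≤⟨ ℤP.∣i+j∣≤∣i∣+∣j∣ (+ W) (sum rest) ⟩
        W + R ≤⟨ ℕP.+-monoʳ-≤ W (ℕP.≤-trans (ℕP.m≤m+n R (R + 0)) 2R≤W) ⟩
        W + W ≡⟨ cong (λ z → W + z) (sym (ℕP.+-identityʳ W)) ⟩
        2 * W ∎
        where open ℕP.≤-Reasoning

      Vx^≤2u : W ≤ 2 * U
      Vx^≤2u = ℕP.+-cancelʳ-≤ W W (2 * U) (begin
        W + W ≡⟨ cong (λ z → W + z) (sym (ℕP.+-identityʳ W)) ⟩
        2 * W ≤⟨ ℕP.*-monoʳ-≤ 2 W≤U+R ⟩
        2 * (U + R) ≡⟨ ℕP.*-distribˡ-+ 2 U R ⟩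
        2 * U + 2 * R ≤⟨ ℕP.+-monoʳ-≤ (2 * U) 2R≤W ⟩
        2 * U + W ∎)
        where
          open ℕP.≤-Reasoning
          open ℤ-Solver using (solve; _:+_; _:-_; _:=_)
          W≤U+R : W ≤ U + R
          W≤U+R = begin
            W ≡⟨ cong ∣_∣ (trans (solve 2 (λ w r → w := (w :+ r) :- r) refl (+ W) (sum rest))
              (cong (ℤ._- sum rest) (sym U≡W+rest))) ⟩
            ∣ + U ℤ.- sum rest ∣ ≤⟨ ℤP.∣i-j∣≤∣i∣+∣j∣ (+ U) (sum rest) ⟩
            U + R ∎

  uniform-bound : ∀ d (v : ℕ → ℕ → ℤ) (V : ℕ → ℕ) →
    (∀ j → 1 ≤ j → j < suc d → ∃[ c ] Eventually (λ n → ∣ v j n ∣ ≤ c * V n)) →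
    ∃[ c ] Eventually (λ n → ∀ j → 1 ≤ j → j < suc d → ∣ v j n ∣ ≤ c * V n)
  uniform-bound zero v V h = 0 , 0 , λ { n _ (suc j) _ (s≤s ()) }
  uniform-bound (suc d) v V h with uniform-bound d v V (λ j 1≤j j<d → h j 1≤j (ℕP.m<n⇒m<1+n j<d)) | h (suc d)
    (s≤s z≤n) ℕP.≤-refl
  ... | c , hc | c′ , hc′ = c + c′ , mapᵉ both (hc ⟨&⟩ hc′)
    where
      both : ∀ n → (∀ j → 1 ≤ j → j < suc d → ∣ v j n ∣ ≤ c * V n) × ∣ v (suc d) n ∣ ≤ c′ * V n →
        ∀ j → 1 ≤ j → j < suc (suc d) → ∣ v j n ∣ ≤ (c + c′) * V n
      both n (p , q) j 1≤j j<d with ℕP.m<1+n⇒m<n∨m≡n j<d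
      ... | inj₁ j<1+d = ℕP.≤-trans (p j 1≤j j<1+d) (ℕP.*-monoˡ-≤ (V n) (ℕP.m≤m+n c c′))
      ... | inj₂ refl = ℕP.≤-trans q (ℕP.*-monoˡ-≤ (V n) (ℕP.m≤n+m c′ c))

  leading-term : ∀ d c (v : ℕ → ℕ → ℤ) {V : ℕ → ℕ} → (∀ n → v 0 n ≡ + V n) →
    Eventually (λ n → ∀ j → 1 ≤ j → j < suc d → ∣ v j n ∣ ≤ c * V n) →
    (X : ℕ → ℕ) → (∀ n → 2 ^ suc n ≤ X n) → {u : ℕ → ℕ} → (∀ n → + u n ≡ ∑v (suc d) (λ j → v j n) (X n)) →
    Eventually (λ n → V n * X n ^ d ≤ 2 * u n × u n ≤ 2 * (V n * X n ^ d))
  leading-term d c v {V} v₀≡V v≤cV X 2^n≤X {u} u≡∑v = mapᵉ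
    (λ n (bound , large) →
      Vx^≤2u {d} {c} {V n} {X n} (λ j → v j n) (v₀≡V n) bound (1≤X n) large {u n} (u≡∑v n) ,
      u≤2Vx^ {d} {c} {V n} {X n} (λ j → v j n) (v₀≡V n) bound (1≤X n) large {u n} (u≡∑v n))
    (v≤cV ⟨&⟩ (2 * (d * c) , λ n M≤n → ℕP.≤-trans M≤n
      (ℕP.≤-trans (ℕP.<⇒≤ (n<2^n n)) (ℕP.≤-trans (ℕP.^-monoʳ-≤ 2 (ℕP.n≤1+n n)) (2^n≤X n)))))
    where
      1≤X : ∀ n → 1 ≤ X n
      1≤X n = ℕP.≤-trans (ℕP.m^n>0 2 (suc n)) (2^n≤X n)

-- Integer binary logarithms compared with the natural logarithm.

module Logarithms where

  open NumberLemmas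
  open Coefficients using (lower-·ʳ)
  open import Data.Rational.Base using (_+_; _*_; _<_; _≤_; _/_)
  open Exp using (_^_)
  open ℚ-Solver using (solve; _:+_; _:*_; _:=_; con)

  dyadic : ∀ n → ∃[ k ] 2 ℕ.^ k ℕ.≤ suc n × suc n ℕ.< 2 ℕ.^ suc k
  dyadic zero = 0 , ℕP.≤-refl , ℕP.≤-refl
  dyadic (suc n) with dyadic n
  ... | k , l , u with suc (suc n) ℕP.<? 2 ℕ.^ suc k
  ...   | yes h = k , ℕP.m≤n⇒m≤1+n l , h
  ...   | no h = suc k , ℕP.≮⇒≥ h , ℕP.<-≤-trans (s≤s u)
    (ℕP.+-mono-≤ (ℕP.m^n>0 2 (suc k)) (ℕP.≤-reflexive (sym (ℕP.+-identityʳ (2 ℕ.^ suc k)))))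

  -- log₂ 0 = 0
  log₂ : ℕ → ℕ
  log₂ n = proj₁ (dyadic (ℕ.pred n))

  2^log₂≤ : ∀ {n} → 1 ℕ.≤ n → 2 ℕ.^ log₂ n ℕ.≤ n
  2^log₂≤ {suc n} _ = proj₁ (proj₂ (dyadic n))

  <2^1+log₂ : ∀ {n} → 1 ℕ.≤ n → n ℕ.< 2 ℕ.^ suc (log₂ n)
  <2^1+log₂ {suc n} _ = proj₂ (proj₂ (dyadic n))

  2^-cancel-≤ : ∀ {m n} → 2 ℕ.^ m ℕ.≤ 2 ℕ.^ n → m ℕ.≤ n
  2^-cancel-≤ {m} {n} h with m ℕP.≤? n
  ... | yes m≤n = m≤n
  ... | no m≰n = ⊥-elim (ℕP.<⇒≱ (ℕP.^-monoʳ-< 2 (s≤s (s≤s z≤n)) (ℕP.≰⇒> m≰n)) h)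

  harmonic-block : ∀ a → ½ ≤ harmonic (suc a) (suc a)
  harmonic-block a = ℚP.≤-trans (ℚP.≤-reflexive half)
    (harmonic-≥ (suc a) (suc a) (λ b b<2a → unit-fraction-antimono (ℕP.≤-pred b<2a)))
    where
      z : ℚ
      z = + 1 / suc (a ℕ.+ suc a)
      half : ½ ≡ fromℕ (suc a) * z
      half = trans (cong (½ *_) (trans (sym (/-* (+ 1) (a ℕ.+ suc a))) (cong (z *_) (fromℕ-+ (suc a) (suc a)))))
        (solve 2 (λ z a → con ½ :* (z :* (a :+ a)) := a :* z) refl z (fromℕ (suc a)))

  harmonic-nonneg : ∀ a l → 0ℚ ≤ harmonic a l
  harmonic-nonneg a l = subst (_≤ harmonic a l) (ℚP.*-zeroʳ (fromℕ l))
    (harmonic-≥ l a (λ b _ → ℚP.<⇒≤ (0<unit-fraction b)))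

  -- Oresme's argument: each doubling of the range adds a dyadic block, which contributes at least
  -- 1/2 by `harmonic-block`.
  harmonic-≥-log : ∀ k m → 2 ℕ.^ k ℕ.≤ suc m → fromℕ k * ½ ≤ harmonic 1 m
  harmonic-≥-log zero m _ = subst (_≤ harmonic 1 m) (sym (ℚP.*-zeroˡ ½)) (harmonic-nonneg 1 m)
  harmonic-≥-log (suc k) m h with 2 ℕ.^ k | harmonic-≥-log k | ℕP.m^n>0 2 k
  ... | suc a | ih | _ with ℕP.m≤n⇒∃[o]m+o≡n h
  ...   | l , refl = begin
    fromℕ (suc k) * ½ ≡⟨ trans (cong (_* ½) (fromℕ-suc k))
      (solve 1 (λ k → (con 1ℚ :+ k) :* con ½ := k :* con ½ :+ con ½) refl (fromℕ k)) ⟩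
    fromℕ k * ½ + ½ ≤⟨ ℚP.+-mono-≤ (ih a ℕP.≤-refl) (ℚP.≤-trans (harmonic-block a)
        (subst (harmonic (suc a) (suc a) ≤_) (sym (harmonic-+ (suc a) (suc a) l))
          (p≤p+q (harmonic-nonneg (suc a ℕ.+ suc a) l)))) ⟩
    harmonic 1 a + harmonic (suc a) (suc a ℕ.+ l) ≡⟨ sym (harmonic-+ 1 a (suc a ℕ.+ l)) ⟩
    harmonic 1 (a ℕ.+ (suc a ℕ.+ l)) ≡⟨ cong (harmonic 1)
      (trans (sym (ℕP.+-assoc a (suc a) l)) (cong (λ z → a ℕ.+ z ℕ.+ l) (sym (ℕP.+-identityʳ (suc a))))) ⟩
    harmonic 1 (a ℕ.+ (suc a ℕ.+ 0) ℕ.+ l) ∎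
    where open ℚP.≤-Reasoning

  -- The lower Riemann sum of step 1 already gives k/2. Halving once more makes the inequality
  -- strict, which is why `k` is positive; any positive constant would serve.
  lower-log : ∀ {k v} → 1 ℕ.≤ k → 2 ℕ.^ k ℕ.≤ v → lower (log v) (fromℕ k * (½ * ½))
  lower-log {k} {suc w} 1≤k h = 0 , ℚP.<-≤-trans
    (<-by-difference (fromℕ k * (½ * ½)) (0<* (0<fromℕ 1≤k) (ℚP.positive⁻¹ (½ * ½)))
      (solve 1 (λ k → k :* con ½ := k :* con (½ * ½) :+ k :* con (½ * ½)) refl (fromℕ k)))
    (subst (λ l → fromℕ k * ½ ≤ harmonic 1 l) (sym (ℕP.*-identityʳ w)) (harmonic-≥-log k w h))
  lower-log {zero} {zero} () _
  lower-log {suc k} {zero} _ h = ⊥-elim (ℕP.<⇒≱ (ℕP.m^n>0 2 (suc k)) h)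

  log₂-growth : ∀ {V : ℕ → ℕ} {ν} {0<ν : fromℚ 0ℚ <ʳ ν} → (∀ n → 1 ℕ.≤ n → 1 ℕ.≤ V n) →
    (λ n → log (V n)) =O (λ n → pow ν 0<ν n) → ∀ {r} → 0ℚ ≤ r → upper ν r →
    ∃[ A ] Eventually (λ n → fromℕ (log₂ (V n)) ≤ A * r ^ n)
  -- The 4 undoes the factor 1/4 of `lower-log`; `suc N` keeps n at least 1, where `V n` is known to
  -- be positive.
  log₂-growth {V} {ν} {0<ν@(_ , _ , _)} 1≤V (C , C>0 , N , h) {r} 0≤r ur = fromℕ 4 * C , suc N , bound
    where
      0≤C : 0ℚ ≤ C
      0≤C = ℚP.<⇒≤ (ℚP.positive⁻¹ C {{C>0}})
      0≤4C : 0ℚ ≤ fromℕ 4 * C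
      0≤4C = 0≤* (0≤fromℕ 4) 0≤C
      below-pow : ∀ n {s} → lower ∣ pow ν 0<ν n ∣ʳ s → s ≤ r ^ n
      below-pow n (inj₁ (t , 0≤t , lt , s<t^n)) = ℚP.≤-trans (ℚP.<⇒≤ s<t^n)
        (^-mono-≤ n 0≤t (ℚP.<⇒≤ (lower<upper ν lt ur)))
      below-pow n (inj₂ (t , 0≤t , _ , t^n<-s)) =
        ℚP.≤-trans (ℚP.<⇒≤ (p<-q⇒q<-p t^n<-s)) (ℚP.≤-trans (ℚP.neg-antimono-≤ (0≤^ n 0≤t)) (0≤^ n 0≤r))
      bound : ∀ n → suc N ℕ.≤ n → fromℕ (log₂ (V n)) ≤ fromℕ 4 * C * r ^ n
      bound n N<n with log₂ (V n) | 2^log₂≤ (1≤V n (ℕP.≤-trans (s≤s z≤n) N<n))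
      ... | zero | _ = 0≤* 0≤4C (0≤^ n 0≤r)
      ... | suc k | le =
        let (s , ls , sC≡) = lower-·ʳ {C} {{C>0}} {∣ pow ν 0<ν n ∣ʳ} {fromℕ (suc k) * (½ * ½)}
                (h n (ℕP.<⇒≤ N<n) (inj₁ (lower-log {suc k} {V n} (s≤s z≤n) le))) in
        subst₂ _≤_ (trans (cong (fromℕ 4 *_) sC≡)
          (solve 1 (λ k → con (fromℕ 4) :* (k :* con (½ * ½)) := k) refl (fromℕ (suc k))))
          (solve 3 (λ f c p → f :* (p :* c) := f :* c :* p) refl (fromℕ 4) C (r ^ n))
          (*-monoˡ-≤₀ (0≤fromℕ 4) (*-monoʳ-≤₀ 0≤C (below-pow n ls)))

-- Rational exponents on either side of λ.

module CriticalExponent where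

  open NumberLemmas
  open ContinuedFractions using (⁻¹-inverseʳ)
  open import Data.Rational.Base using (-_; _+_; _-_; _*_; _<_; _≤_; _⊔_)
  open ℚ-Solver using (solve; _:+_; _:*_; :-_; _:-_; _:=_; con)

  square-mono-< : ∀ {p q} → 0ℚ ≤ p → p < q → p * p < q * q
  square-mono-< {p} {q} 0≤p p<q = ℚP.≤-<-trans (*-monoˡ-≤₀ 0≤p (ℚP.<⇒≤ p<q)) (*-monoˡ-<₀ (ℚP.≤-<-trans 0≤p p<q) p<q)

  square-cancel-≤ : ∀ {p q} → 0ℚ ≤ q → p * p ≤ q * q → p ≤ q
  square-cancel-≤ {p} {q} 0≤q h with ≤₀⊎>₀ p q
  ... | inj₁ le = le
  ... | inj₂ gt = ⊥-elim (ℚP.<-irrefl refl (ℚP.<-≤-trans (square-mono-< 0≤q gt) h))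

  module _ {d : ℕ} (1≤d : 1 ℕ.≤ d) where

    δ : ℚ
    δ = fromℕ (d ℕ.+ 2)

    private
      x : ℚ
      x = fromℕ d

      0≤x : 0ℚ ≤ x
      0≤x = 0≤fromℕ d

      δ≡ : δ ≡ x + fromℕ 2
      δ≡ = fromℕ-+ d 2

      discriminant≡ : fromℕ (d ℕ.* (d ℕ.+ 4)) ≡ x * (x + fromℕ 4)
      discriminant≡ = trans (fromℕ-* d (d ℕ.+ 4)) (cong (x *_) (fromℕ-+ d 4))

    δ-1≤δ : δ - 1ℚ ≤ δ
    δ-1≤δ = ≤-by-difference 1ℚ 0≤1 (sym (p-q+q δ 1ℚ))

    -- (2 t - δ)² and the discriminant δ² - 4 differ by 4 (t (δ - t) - 1).
    private
      discriminant-difference : ∀ t → x * (x + fromℕ 4) - (t * fromℕ 2 - δ) * (t * fromℕ 2 - δ) ≡ fromℕ 4 *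
        (t * (δ - t) - 1ℚ)
      discriminant-difference t = subst
        (λ δ → x * (x + fromℕ 4) - (t * fromℕ 2 - δ) * (t * fromℕ 2 - δ) ≡ fromℕ 4 * (t * (δ - t) - 1ℚ)) (sym δ≡)
        (solve 2 (λ x t → x :* (x :+ con (fromℕ 4)) :- (t :* con (fromℕ 2) :- (x :+ con (fromℕ 2))) :*
          (t :* con (fromℕ 2) :- (x :+ con (fromℕ 2)))
          := con (fromℕ 4) :* (t :* ((x :+ con (fromℕ 2)) :- t) :- con 1ℚ)) refl x t)

      cancel-4 : ∀ {p} → 0ℚ < fromℕ 4 * p → 0ℚ < p
      cancel-4 {p} h = *-cancelʳ-<₀ (0≤fromℕ 4) (subst₂ _<_ (sym (ℚP.*-zeroˡ (fromℕ 4))) (ℚP.*-comm (fromℕ 4) p) h)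

    -- The conclusion says that `t` lies strictly between the roots 1/λ and λ of the quadratic.
    -- Being at least δ - 1 makes 2 t - δ nonnegative, so that its comparison with the square root
    -- may be squared.
    lower-λ⇒ : ∀ {t} → δ - 1ℚ ≤ t → lower λ[ d ] t → 1ℚ < t * (δ - t)
    lower-λ⇒ {t} δ-1≤t (s , 0≤s , z<s , s²≤D) = 0<q-p⇒p<q (cancel-4 (subst (0ℚ <_) (discriminant-difference t)
      (p<q⇒0<q-p (ℚP.<-≤-trans (square-mono-< 0≤z z<s) (subst (s * s ≤_) discriminant≡ s²≤D)))))
      where
        0≤z : 0ℚ ≤ t * fromℕ 2 - δ
        0≤z = subst (0ℚ ≤_) (trans (cong (λ z → x + fromℕ 2 * (t - (z - 1ℚ))) δ≡)
                (trans (solve 2 (λ x t → x :+ con (fromℕ 2) :* (t :- ((x :+ con (fromℕ 2)) :- con 1ℚ)) := t :* con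
                  (fromℕ 2) :- (x :+ con (fromℕ 2))) refl x t)
                  (cong (λ z → t * fromℕ 2 - z) (sym δ≡))))
          (0≤+ 0≤x (0≤* (0≤fromℕ 2) (p≤q⇒0≤q-p δ-1≤t)))

    -- The square root of d (d + 4) is at least d, whence s > (d + d + 2) / 2 = δ - 1. The second
    -- part comes from squaring.
    upper-λ⇒ : ∀ s → upper λ[ d ] s → δ - 1ℚ < s × s * (δ - s) < 1ℚ
    upper-λ⇒ s (σ , 0≤σ , σ<z , D≤σ²) = δ-1<s , 0<q-p⇒p<q (cancel-4 (subst (0ℚ <_)
        (trans (solve 3 (λ p q r → q :- p := :- (p :- q)) refl D (z * z) 0ℚ)
          (trans (cong -_ (discriminant-difference s))
          (solve 2 (λ s δ → :- (con (fromℕ 4) :* (s :* (δ :- s) :- con 1ℚ)) := con (fromℕ 4) :*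
            (con 1ℚ :- s :* (δ :- s))) refl s δ)))
        (p<q⇒0<q-p (ℚP.≤-<-trans D≤σ²′ (square-mono-< 0≤σ σ<z)))))
      where
        D z : ℚ
        D = x * (x + fromℕ 4)
        z = s * fromℕ 2 - δ
        D≤σ²′ : D ≤ σ * σ
        D≤σ²′ = subst (_≤ σ * σ) discriminant≡ D≤σ²
        x≤σ : x ≤ σ
        x≤σ = square-cancel-≤ 0≤σ (ℚP.≤-trans (*-monoˡ-≤₀ 0≤x (p≤p+q (0≤fromℕ 4))) D≤σ²′)
        δ-1<s : δ - 1ℚ < s
        δ-1<s = *-cancelʳ-<₀ (0≤fromℕ 2) (<-by-difference (z - x) (p<q⇒0<q-p (ℚP.≤-<-trans x≤σ σ<z))
          (subst (λ δ → s * fromℕ 2 ≡ (δ - 1ℚ) * fromℕ 2 + (s * fromℕ 2 - δ - x)) (sym δ≡)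
            (solve 2 (λ s x → s :* con (fromℕ 2) := ((x :+ con (fromℕ 2)) :- con 1ℚ) :* con (fromℕ 2) :+
              (s :* con (fromℕ 2) :- (x :+ con (fromℕ 2)) :- x)) refl s x)))

    lower-λ-δ-1 : lower λ[ d ] (δ - 1ℚ)
    -- The witness d + 1/2 exceeds 2 (δ - 1) - δ = d, and its square is at most d (d + 4) because d
    -- ≥ 1.
    lower-λ-δ-1 = x + ½ , 0≤+ 0≤x (ℚP.nonNegative⁻¹ ½) ,
      <-by-difference ½ (ℚP.positive⁻¹ ½) (subst (λ δ → x + ½ ≡ ((δ - 1ℚ) * fromℕ 2 - δ) + ½) (sym δ≡)
        (solve 1 (λ x → x :+ con ½ := ((x :+ con (fromℕ 2) :- con 1ℚ) :* con (fromℕ 2) :- (x :+ con (fromℕ 2))) :+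
          con ½) refl x)) ,
      subst ((x + ½) * (x + ½) ≤_) (sym discriminant≡)
        (≤-by-difference (fromℕ 3 * (x - 1ℚ) + (fromℕ 3 - ½ * ½))
          (0≤+ (0≤* (0≤fromℕ 3) (p≤q⇒0≤q-p (1≤fromℕ 1≤d))) (ℚP.nonNegative⁻¹ (fromℕ 3 - ½ * ½)))
          (solve 1 (λ x → x :* (x :+ con (fromℕ 4)) := (x :+ con ½) :* (x :+ con ½) :+
            (con (fromℕ 3) :* (x :- con 1ℚ) :+ con (fromℕ 3 - ½ * ½))) refl x))

    -- An exponent in the shape demanded by `eventual-ratio-≥`: `δ-1≤t` and `t≤δ` place the damping
    -- factor δ - t between 0 and 1. Every r below λ can be raised to such a `t`.
    record Below (r : ℚ) : Set where
      field
        t       : ℚ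
        r<t     : r < t
        lower-t : lower λ[ d ] t
        δ-1≤t   : δ - 1ℚ ≤ t
        t≤δ     : t ≤ δ
        1<t[δ-t] : 1ℚ < t * (δ - t)

    0≤δ-1 : 0ℚ ≤ δ - 1ℚ
    0≤δ-1 = subst (λ δ → 0ℚ ≤ δ - 1ℚ) (sym δ≡)
      (subst (0ℚ ≤_) (solve 1 (λ x → x :+ con 1ℚ := x :+ con (fromℕ 2) :- con 1ℚ) refl x) (0≤+ 0≤x 0≤1))

    below : ∀ r → lower λ[ d ] r → Below r
    below r lr = let (t , r⊔<t , lt) = lower-rounded λ[ d ] {r ⊔ (δ - 1ℚ)} lower-⊔ in record
      { t = t
      ; r<t = ℚP.≤-<-trans (ℚP.p≤p⊔q r (δ - 1ℚ)) r⊔<t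
      ; lower-t = lt
      ; δ-1≤t = δ-1≤ r⊔<t
      ; t≤δ = t≤δ (δ-1≤ r⊔<t) (lower-λ⇒ (δ-1≤ r⊔<t) lt)
      ; 1<t[δ-t] = lower-λ⇒ (δ-1≤ r⊔<t) lt
      }
      where
        lower-⊔ : lower λ[ d ] (r ⊔ (δ - 1ℚ))
        lower-⊔ with ℚP.⊔-sel r (δ - 1ℚ)
        ... | inj₁ e = subst (lower λ[ d ]) (sym e) lr
        ... | inj₂ e = subst (lower λ[ d ]) (sym e) lower-λ-δ-1
        δ-1≤ : ∀ {t} → r ⊔ (δ - 1ℚ) < t → δ - 1ℚ ≤ t
        δ-1≤ h = ℚP.<⇒≤ (ℚP.≤-<-trans (ℚP.p≤q⊔p r (δ - 1ℚ)) h)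
        t≤δ : ∀ {t} → δ - 1ℚ ≤ t → 1ℚ < t * (δ - t) → t ≤ δ
        t≤δ {t} δ-1≤t 1<p with ≤₀⊎>₀ t δ
        ... | inj₁ le = le
        ... | inj₂ gt = ⊥-elim (ℚP.<-irrefl refl (ℚP.<-trans 0<1 (ℚP.<-≤-trans 1<p
              (≤-by-difference (t * (t - δ)) (0≤* (ℚP.≤-trans 0≤δ-1 δ-1≤t) (p≤q⇒0≤q-p (ℚP.<⇒≤ gt)))
                (solve 2 (λ t δ → con 0ℚ := t :* (δ :- t) :+ t :* (t :- δ)) refl t δ)))))

    record Above (r : ℚ) : Set where
      field
        s        : ℚ
        s≤r      : s ≤ r
        δ-1≤s    : δ - 1ℚ ≤ s
        s≤δ      : s ≤ δ
        s[δ-s]<1 : s * (δ - s) < 1ℚ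

    -- Beyond δ the factor δ - s would be negative, so a larger r is replaced by δ itself, where s
    -- (δ - s) is 0.
    above : ∀ r → upper λ[ d ] r → Above r
    above r ur with ≤₀⊎>₀ r δ
    ... | inj₁ r≤δ = let (δ-1<r , h) = upper-λ⇒ r ur in
      record { s = r ; s≤r = ℚP.≤-refl ; δ-1≤s = ℚP.<⇒≤ δ-1<r ; s≤δ = r≤δ ; s[δ-s]<1 = h }
    ... | inj₂ δ<r = record { s = δ ; s≤r = ℚP.<⇒≤ δ<r ; δ-1≤s = δ-1≤δ ; s≤δ = ℚP.≤-refl
      ; s[δ-s]<1 = subst (_< 1ℚ) (solve 1 (λ δ → con 0ℚ := δ :* (δ :- δ)) refl δ) 0<1 }

    0<s-2 : ∀ s → upper λ[ d ] s → 0ℚ < s - fromℕ 2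
    0<s-2 s us = p<q⇒0<q-p {fromℕ 2} {s} (ℚP.≤-<-trans (≤-by-difference (x - 1ℚ) (p≤q⇒0≤q-p (1≤fromℕ 1≤d))
      (trans (cong (_- 1ℚ) δ≡) (solve 1 (λ x → x :+ con (fromℕ 2) :- con 1ℚ := con (fromℕ 2) :+ (x :- con 1ℚ)) refl
        x))) (proj₁ (upper-λ⇒ s us)))

    private
      3≤δ : fromℕ 3 ≤ δ
      3≤δ = ≤-by-difference (x - 1ℚ) (p≤q⇒0≤q-p (1≤fromℕ 1≤d))
        (trans δ≡ (solve 1 (λ x → x :+ con (fromℕ 2) := con (fromℕ 3) :+ (x :- con 1ℚ)) refl x))

      reciprocal : ∀ {y} → 0ℚ < y → ∃[ i ] i * y ≡ 1ℚ × 0ℚ < i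
      reciprocal {y} 0<y = let iy≡1 = trans (ℚP.*-comm (y ⁻¹) y) (⁻¹-inverseʳ y 0<y) in
        y ⁻¹ , iy≡1 , *-cancelʳ-<₀ (ℚP.<⇒≤ 0<y) (subst₂ _<_ (sym (ℚP.*-zeroˡ y)) (sym iy≡1) 0<1)

      -- 2 + y and 1 + 1/y cannot both exceed λ. For f s = 1 - s (δ - s), which is positive above λ,
      -- the identity y² f (1 + i) + f (2 + y) + (δ - 3) (y² + 2 y + 2) = 0 would have nonnegative
      -- summands and a positive first one. Here d ≥ 1 enters as δ ≥ 3.
      no-upper : ∀ {i y} → 0ℚ < y → i * y ≡ 1ℚ → (fromℕ 2 + y) * (δ - (fromℕ 2 + y)) < 1ℚ →
        (1ℚ + i) * (δ - (1ℚ + i)) < 1ℚ → ⊥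
      no-upper {i} {y} 0<y iy≡1 h₁ h₂ = ℚP.<-irrefl refl
        (ℚP.<-≤-trans positive-part (≤-by-difference ((δ - fromℕ 3) * (y * y + fromℕ 2 * y + fromℕ 2))
        (0≤* (p≤q⇒0≤q-p 3≤δ) (0≤+ (0≤+ (0≤* 0≤y 0≤y) (0≤* (0≤fromℕ 2) 0≤y)) (0≤fromℕ 2)))
        (trans (solve 2 (λ y δ → con 0ℚ := (y :* y :- (y :+ con 1ℚ) :* (δ :* y :- y :- con 1ℚ)) :+
          (con 1ℚ :- (con (fromℕ 2) :+ y) :* (δ :- (con (fromℕ 2) :+ y)))
              :+ (δ :- con (fromℕ 3)) :* (y :* y :+ con (fromℕ 2) :* y :+ con (fromℕ 2))) refl y δ)
          (cong (λ z → z + (1ℚ - (fromℕ 2 + y) * (δ - (fromℕ 2 + y))) + (δ - fromℕ 3) *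
            (y * y + fromℕ 2 * y + fromℕ 2)) (sym scaled)))))
        where
          0≤y : 0ℚ ≤ y
          0≤y = ℚP.<⇒≤ 0<y
          scaled : (1ℚ - (1ℚ + i) * (δ - (1ℚ + i))) * (y * y) ≡ y * y - (y + 1ℚ) * (δ * y - y - 1ℚ)
          scaled = trans (solve 3 (λ i y δ → (con 1ℚ :- (con 1ℚ :+ i) :* (δ :- (con 1ℚ :+ i))) :* (y :* y) := y :*
            y :- (y :+ i :* y) :* (δ :* y :- y :- i :* y)) refl i y δ)
            (cong (λ z → y * y - (y + z) * (δ * y - y - z)) iy≡1)
          positive-part : 0ℚ < (1ℚ - (1ℚ + i) * (δ - (1ℚ + i))) * (y * y) + (1ℚ - (fromℕ 2 + y) * (δ - (fromℕ 2 + y)))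
          positive-part = 0<+≤ (0<* (p<q⇒0<q-p h₂) (0<* 0<y 0<y)) (p≤q⇒0≤q-p (ℚP.<⇒≤ h₁))

    -- At s = t = λ this is λ² - 3 λ + 1 = (d - 1) λ ≥ 0; for given s the
    -- condition says t > 1 + 1/(s - 2), which is less than λ.
    balance : ∀ s → upper λ[ d ] s → ∃[ r ] Σ[ b ∈ Below r ] Below.t b < (s - 1ℚ) * (Below.t b - 1ℚ)
    balance s us = decide (located λ[ d ] (ℚP.+-monoʳ-< 1ℚ i<i′))
      where
        -- A second rational between λ and `s` separates 1 + i from 1 + i′, so that locatedness of λ
        -- can decide between them; `no-upper` at s′ excludes the second outcome.
        s′ : ℚ
        s′ = proj₁ (upper-rounded λ[ d ] {s} us)
        s′<s : s′ < s
        s′<s = proj₁ (proj₂ (upper-rounded λ[ d ] {s} us))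
        us′ : upper λ[ d ] s′
        us′ = proj₂ (proj₂ (upper-rounded λ[ d ] {s} us))
        y y′ : ℚ
        y = s - fromℕ 2
        y′ = s′ - fromℕ 2
        0<y : 0ℚ < y
        0<y = 0<s-2 s us
        0<y′ : 0ℚ < y′
        0<y′ = 0<s-2 s′ us′
        i i′ : ℚ
        i = proj₁ (reciprocal {y} 0<y)
        i′ = proj₁ (reciprocal {y′} 0<y′)
        iy≡1 : i * y ≡ 1ℚ
        iy≡1 = proj₁ (proj₂ (reciprocal {y} 0<y))
        i′y′≡1 : i′ * y′ ≡ 1ℚ
        i′y′≡1 = proj₁ (proj₂ (reciprocal {y′} 0<y′))
        i<i′ : i < i′
        i<i′ = <-by-difference (i * i′ * (y - y′))
          (0<* (0<* (proj₂ (proj₂ (reciprocal {y} 0<y))) (proj₂ (proj₂ (reciprocal {y′} 0<y′))))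
          (p<q⇒0<q-p (ℚP.+-monoˡ-< (- fromℕ 2) s′<s)))
          (sym (trans (solve 4 (λ i i′ y y′ → i :+ i :* i′ :* (y :- y′) := i :+ (i :* y) :* i′ :- i :* (i′ :* y′))
            refl i i′ y y′)
            (trans (cong₂ (λ a b → i + a * i′ - i * b) iy≡1 i′y′≡1)
              (solve 2 (λ i i′ → i :+ con 1ℚ :* i′ :- i :* con 1ℚ := i′) refl i i′))))
        decide : lower λ[ d ] (1ℚ + i) ⊎ upper λ[ d ] (1ℚ + i′) → ∃[ r ] Σ[ b ∈ Below r ] Below.t b < (s - 1ℚ) *
          (Below.t b - 1ℚ)
        decide (inj₂ u) = ⊥-elim (no-upper {i′} {y′} 0<y′ i′y′≡1
          (subst (λ z → z * (δ - z) < 1ℚ) (sym (p+[q-p] (fromℕ 2) s′)) (proj₂ (upper-λ⇒ s′ us′)))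
          (proj₂ (upper-λ⇒ (1ℚ + i′) u)))
        -- Since i y = 1, t > 1 + i says (t - 1) (s - 2) > 1, which is the required inequality
        -- rearranged.
        decide (inj₁ l) = 1ℚ + i , below (1ℚ + i) l , <-by-difference ((t - (1ℚ + i)) * y)
          (0<* (p<q⇒0<q-p (Below.r<t (below (1ℚ + i) l))) 0<y)
          (trans (solve 2 (λ s t → (s :- con 1ℚ) :* (t :- con 1ℚ) := t :+
            ((t :- con 1ℚ) :* (s :- con (fromℕ 2)) :- con 1ℚ)) refl s t)
            (trans (cong (λ z → t + ((t - 1ℚ) * y - z)) (sym iy≡1))
              (solve 3 (λ t i y → t :+ ((t :- con 1ℚ) :* y :- i :* y) := t :+ (t :- (con 1ℚ :+ i)) :* y) refl t i y)))
          where
            t : ℚ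
            t = Below.t (below (1ℚ + i) l)

-- Growth of the denominators on a logarithmic scale.

module DenominatorGrowth where

  open NumberLemmas
  open Recurrence
  open Logarithms
  open CriticalExponent
  open import Data.Nat.Base using (_≤_; _<_; _*_; _+_; _^_)
  open Exp using () renaming (_^_ to _^ℚ_)
  open ℚ-Solver using (solve; _:+_; _:*_; :-_; _:-_; _:=_; con)

  2^log₂*≤^ : ∀ {x} k → 1 ≤ x → 2 ^ (log₂ x * k) ≤ x ^ k
  2^log₂*≤^ {x} k 1≤x = subst (_≤ x ^ k) (ℕP.^-*-assoc 2 (log₂ x) k) (ℕP.^-monoˡ-≤ k (2^log₂≤ 1≤x))

  ^≤2^1+log₂* : ∀ {x} k → 1 ≤ x → x ^ k ≤ 2 ^ ((1 + log₂ x) * k)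
  ^≤2^1+log₂* {x} k 1≤x = subst (x ^ k ≤_) (ℕP.^-*-assoc 2 (suc (log₂ x)) k) (ℕP.^-monoˡ-≤ k (ℕP.<⇒≤ (<2^1+log₂ 1≤x)))

  2^≤⇒≤log₂ : ∀ {n x} → 1 ≤ x → 2 ^ n ≤ x → n ≤ log₂ x
  2^≤⇒≤log₂ {n} {x} 1≤x h with n ℕP.≤? log₂ x
  ... | yes n≤l = n≤l
  ... | no n≰l = ⊥-elim (ℕP.<⇒≱ (<2^1+log₂ 1≤x) (ℕP.≤-trans (ℕP.^-monoʳ-≤ 2 (ℕP.≰⇒> n≰l)) h))

  module _ {x₀ x₁ x₂ : ℕ} (1≤x₀ : 1 ≤ x₀) (1≤x₁ : 1 ≤ x₁) (1≤x₂ : 1 ≤ x₂) where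

    -- Of the 3, one pays for the factor 2 and two for rounding the logarithms of `x₂` and `x₀`.
    log₂-recurrence-≥ : ∀ k → x₁ ^ k ≤ 2 * (x₂ * x₀) → k * log₂ x₁ ≤ log₂ x₂ + log₂ x₀ + 3
    log₂-recurrence-≥ k h = subst₂ _≤_ (ℕP.*-comm (log₂ x₁) k)
      (solveℕ 2 (λ a b → nat 1 ⊕ ((nat 1 ⊕ a) ⊕ (nat 1 ⊕ b)) ⊜ a ⊕ b ⊕ nat 3) refl (log₂ x₂) (log₂ x₀))
      (2^-cancel-≤ (ℕP.≤-trans (2^log₂*≤^ k 1≤x₁) (ℕP.≤-trans h (ℕP.*-monoʳ-≤ 2
        (subst (x₂ * x₀ ≤_) (sym (ℕP.^-distribˡ-+-* 2 (suc (log₂ x₂)) (suc (log₂ x₀))))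
          (ℕP.*-mono-≤ (ℕP.<⇒≤ (<2^1+log₂ 1≤x₂)) (ℕP.<⇒≤ (<2^1+log₂ 1≤x₀))))))))

    -- The error collects 2 for the factor 4, 1 for rounding `log₂ V`, and `k` for rounding
    -- `log₂ x₁` in a k-th power.
    log₂-recurrence-≤ : ∀ k {V} → 1 ≤ V → x₂ * x₀ ≤ 4 * (V * x₁ ^ k) → log₂ x₂ + log₂ x₀ ≤ k * log₂ x₁ +
      (log₂ V + (3 + k))
    log₂-recurrence-≤ k {V} 1≤V h = subst (log₂ x₂ + log₂ x₀ ≤_)
      (solveℕ 3 (λ v l k → nat 2 ⊕ ((nat 1 ⊕ v) ⊕ (nat 1 ⊕ l) ⊗ k) ⊜ k ⊗ l ⊕ (v ⊕ (nat 3 ⊕ k))) refl (log₂ V)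
        (log₂ x₁) k)
      (2^-cancel-≤ (begin
        2 ^ (log₂ x₂ + log₂ x₀) ≡⟨ ℕP.^-distribˡ-+-* 2 (log₂ x₂) (log₂ x₀) ⟩
        2 ^ log₂ x₂ * 2 ^ log₂ x₀ ≤⟨ ℕP.*-mono-≤ (2^log₂≤ 1≤x₂) (2^log₂≤ 1≤x₀) ⟩
        x₂ * x₀ ≤⟨ h ⟩
        4 * (V * x₁ ^ k) ≤⟨ ℕP.*-monoʳ-≤ 4 (ℕP.*-mono-≤ (ℕP.<⇒≤ (<2^1+log₂ 1≤V)) (^≤2^1+log₂* k 1≤x₁)) ⟩
        4 * (2 ^ suc (log₂ V) * 2 ^ (suc (log₂ x₁) * k)) ≡⟨ cong (4 *_)
          (sym (ℕP.^-distribˡ-+-* 2 (suc (log₂ V)) (suc (log₂ x₁) * k))) ⟩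
        2 ^ 2 * 2 ^ (suc (log₂ V) + suc (log₂ x₁) * k) ≡⟨ sym
          (ℕP.^-distribˡ-+-* 2 2 (suc (log₂ V) + suc (log₂ x₁) * k)) ⟩
        2 ^ (2 + (suc (log₂ V) + suc (log₂ x₁) * k)) ∎))
      where open ℕP.≤-Reasoning

  module _ (x₀ x₁ x₂ : ℕ) {U V : ℕ} (1≤x₁ : 1 ≤ x₁) (1≤U : 1 ≤ U) (1≤V : 1 ≤ V) (d : ℕ)
    (rec : x₂ * x₀ ≡ x₁ * x₁ * (1 + U * x₁)) where

    private
      x^d+3 : ∀ W → W * x₁ ^ (suc d + 2) ≡ W * x₁ ^ d * (x₁ * x₁ * x₁)
      x^d+3 W = trans (cong (W *_) (ℕP.^-distribˡ-+-* x₁ (suc d) 2))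
        (solveℕ 3 (λ w p x → w ⊗ (x ⊗ p ⊗ (x ⊗ (x ⊗ nat 1))) ⊜ w ⊗ p ⊗ (x ⊗ x ⊗ x)) refl W (x₁ ^ d) x₁)

    -- `V` is dropped through `1 ≤ V`, so the lower growth bound is available before log V is
    -- compared with L.
    power-recurrence-≥ : V * x₁ ^ d ≤ 2 * U → x₁ ^ (suc d + 2) ≤ 2 * (x₂ * x₀)
    power-recurrence-≥ h = begin
      x₁ ^ (suc d + 2) ≡⟨ sym (ℕP.*-identityˡ _) ⟩
      1 * x₁ ^ (suc d + 2) ≤⟨ ℕP.*-monoˡ-≤ (x₁ ^ (suc d + 2)) 1≤V ⟩
      V * x₁ ^ (suc d + 2) ≡⟨ x^d+3 V ⟩
      V * x₁ ^ d * (x₁ * x₁ * x₁) ≤⟨ ℕP.*-monoˡ-≤ (x₁ * x₁ * x₁) h ⟩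
      2 * U * (x₁ * x₁ * x₁) ≡⟨ solveℕ 2 (λ u x → nat 2 ⊗ u ⊗ (x ⊗ x ⊗ x) ⊜ nat 2 ⊗ (x ⊗ x ⊗ (u ⊗ x))) refl U x₁ ⟩
      2 * (x₁ * x₁ * (U * x₁)) ≤⟨ ℕP.*-monoʳ-≤ 2 (ℕP.*-monoʳ-≤ (x₁ * x₁) (ℕP.n≤1+n (U * x₁))) ⟩
      2 * (x₁ * x₁ * (1 + U * x₁)) ≡⟨ cong (2 *_) (sym rec) ⟩
      2 * (x₂ * x₀) ∎
      where open ℕP.≤-Reasoning

    power-recurrence-≤ : U ≤ 2 * (V * x₁ ^ d) → x₂ * x₀ ≤ 4 * (V * x₁ ^ (suc d + 2))
    power-recurrence-≤ h = begin
      x₂ * x₀ ≡⟨ rec ⟩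
      x₁ * x₁ * (1 + U * x₁) ≤⟨ ℕP.*-monoʳ-≤ (x₁ * x₁) (ℕP.+-monoˡ-≤ (U * x₁) (ℕP.*-mono-≤ 1≤U 1≤x₁)) ⟩
      x₁ * x₁ * (U * x₁ + U * x₁) ≤⟨ ℕP.*-monoʳ-≤ (x₁ * x₁) (ℕP.+-mono-≤ (ℕP.*-monoˡ-≤ x₁ h) (ℕP.*-monoˡ-≤ x₁ h)) ⟩
      x₁ * x₁ * (2 * (V * x₁ ^ d) * x₁ + 2 * (V * x₁ ^ d) * x₁)
        ≡⟨ solveℕ 2 (λ w x → x ⊗ x ⊗ (nat 2 ⊗ w ⊗ x ⊕ nat 2 ⊗ w ⊗ x) ⊜ nat 4 ⊗ (w ⊗ (x ⊗ x ⊗ x))) refl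
          (V * x₁ ^ d) x₁ ⟩
      4 * (V * x₁ ^ d * (x₁ * x₁ * x₁)) ≡⟨ cong (4 *_) (sym (x^d+3 V)) ⟩
      4 * (V * x₁ ^ (suc d + 2)) ∎
      where open ℕP.≤-Reasoning

  module Ratios {d : ℕ} {X U V : ℕ → ℕ} (2^n≤X : ∀ n → 2 ^ n ≤ X n) (1≤U : ∀ n → 1 ≤ U n) (1≤V : ∀ n → 1 ≤ V n)
    (rec : ∀ n → X (2 + n) * X n ≡ X (1 + n) * X (1 + n) * (1 + U n * X (1 + n)))
    (coefficients : Eventually (λ n → V n * X (1 + n) ^ d ≤ 2 * U n × U n ≤ 2 * (V n * X (1 + n) ^ d))) where

    1≤1+d : 1 ≤ suc d
    1≤1+d = s≤s z≤n

    L : ℕ → ℚ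
    L n = fromℕ (log₂ (X n))

    private
      1≤X : ∀ n → 1 ≤ X n
      1≤X n = ℕP.≤-trans (ℕP.m^n>0 2 n) (2^n≤X n)

    n≤L : ∀ n → fromℕ n ℚ.≤ L n
    n≤L n = fromℕ-mono-≤ {n} (2^≤⇒≤log₂ {n} (1≤X n) (2^n≤X n))

    log-recurrence-≥ : Eventually (λ n → δ 1≤1+d ℚ.* L (1 + n) ℚ.≤ L (2 + n) ℚ.+ L n ℚ.+ fromℕ 3)
    log-recurrence-≥ = mapᵉ (λ n (h , _) → subst₂ ℚ._≤_ (fromℕ-* (suc d + 2) (log₂ (X (1 + n))))
        (trans (fromℕ-+ (log₂ (X (2 + n)) + log₂ (X n)) 3)
          (cong (ℚ._+ fromℕ 3) (fromℕ-+ (log₂ (X (2 + n))) (log₂ (X n)))))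
        (fromℕ-mono-≤ (log₂-recurrence-≥ (1≤X n) (1≤X (1 + n)) (1≤X (2 + n)) (suc d + 2)
          (power-recurrence-≥ (X n) (X (1 + n)) (X (2 + n)) (1≤X (1 + n)) (1≤U n) (1≤V n) d (rec n) h)))) coefficients

    log-recurrence-≤ : Eventually (λ n → L (2 + n) ℚ.+ L n ℚ.≤ δ 1≤1+d ℚ.* L (1 + n) ℚ.+
      (fromℕ (log₂ (V n)) ℚ.+ fromℕ (3 + (suc d + 2))))
    log-recurrence-≤ = mapᵉ (λ n (_ , h) → subst₂ ℚ._≤_ (fromℕ-+ (log₂ (X (2 + n))) (log₂ (X n)))
        (trans (fromℕ-+ ((suc d + 2) * log₂ (X (1 + n))) (log₂ (V n) + (3 + (suc d + 2))))
          (cong₂ ℚ._+_ (fromℕ-* (suc d + 2) (log₂ (X (1 + n)))) (fromℕ-+ (log₂ (V n)) (3 + (suc d + 2)))))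
        (fromℕ-mono-≤ (log₂-recurrence-≤ (1≤X n) (1≤X (1 + n)) (1≤X (2 + n)) (suc d + 2) (1≤V n)
          (power-recurrence-≤ (X n) (X (1 + n)) (X (2 + n)) (1≤X (1 + n)) (1≤U n) (1≤V n) d (rec n) h)))) coefficients

    ratio-≥ : ∀ {r} (b : Below 1≤1+d r) → Eventually (λ n → Below.t b ℚ.* L n ℚ.≤ L (1 + n))
    ratio-≥ b = eventual-ratio-≥ L n≤L (δ 1≤1+d) t≤δ (δ-t≤1 δ-1≤t) 1<t[δ-t] log-recurrence-≥
      where
        open Below b
        δ-t≤1 : ∀ {t} → δ 1≤1+d ℚ.- 1ℚ ℚ.≤ t → δ 1≤1+d ℚ.- t ℚ.≤ 1ℚ
        δ-t≤1 {t} h = ≤-by-difference (t ℚ.- (δ 1≤1+d ℚ.- 1ℚ)) (p≤q⇒0≤q-p h)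
          (solve 2 (λ d t → con 1ℚ := (d :- t) :+ (t :- (d :- con 1ℚ))) refl (δ 1≤1+d) t)

    module _ {r A : ℚ} (0<r : 0ℚ ℚ.< r) (r<λ : lower λ[ suc d ] r)
      (logV : Eventually (λ n → fromℕ (log₂ (V n)) ℚ.≤ A ℚ.* r ^ℚ n)) where

      -- Since r < λ, `ratio-≥` makes L outgrow every multiple of r^n, and with it log V. Half of
      -- `κ` absorbs `log₂ (V n)`, the other half the constant.
      logV-negligible : ∀ {κ} → 0ℚ ℚ.< κ → Eventually
        (λ n → fromℕ (log₂ (V n)) ℚ.+ fromℕ (3 + (suc d + 2)) ℚ.+ 1ℚ ℚ.≤ κ ℚ.* L n)
      logV-negligible {κ} 0<κ =
        let (k , A<½κk) = archimedean-* A 0<½κ in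
        mapᵉ (λ n (h₁ , h₂ , h₃) → begin
          fromℕ (log₂ (V n)) ℚ.+ fromℕ (3 + (suc d + 2)) ℚ.+ 1ℚ ≡⟨ ℚP.+-assoc (fromℕ (log₂ (V n)))
            (fromℕ (3 + (suc d + 2))) 1ℚ ⟩
          fromℕ (log₂ (V n)) ℚ.+ (fromℕ (3 + (suc d + 2)) ℚ.+ 1ℚ) ≤⟨ ℚP.+-mono-≤ h₁ h₂ ⟩
          A ℚ.* r ^ℚ n ℚ.+ ½ ℚ.* κ ℚ.* L n ≤⟨ ℚP.+-monoˡ-≤ (½ ℚ.* κ ℚ.* L n)
            (*-monoʳ-≤₀ (0≤^ n (ℚP.<⇒≤ 0<r)) (ℚP.<⇒≤ A<½κk)) ⟩
          fromℕ k ℚ.* (½ ℚ.* κ) ℚ.* r ^ℚ n ℚ.+ ½ ℚ.* κ ℚ.* L n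
            ≡⟨ solve 4 (λ k h p l → k :* h :* p :+ h :* l := h :* (k :* p) :+ h :* l) refl (fromℕ k) (½ ℚ.* κ)
              (r ^ℚ n) (L n) ⟩
          ½ ℚ.* κ ℚ.* (fromℕ k ℚ.* r ^ℚ n) ℚ.+ ½ ℚ.* κ ℚ.* L n ≤⟨ ℚP.+-monoˡ-≤ (½ ℚ.* κ ℚ.* L n)
            (*-monoˡ-≤₀ (ℚP.<⇒≤ 0<½κ) h₃) ⟩
          ½ ℚ.* κ ℚ.* L n ℚ.+ ½ ℚ.* κ ℚ.* L n ≡⟨ solve 2 (λ k l → con ½ :* k :* l :+ con ½ :* k :* l := k :* l)
            refl κ (L n) ⟩
          κ ℚ.* L n ∎)
        (logV ⟨&⟩ eventually-≤-* (fromℕ (3 + (suc d + 2)) ℚ.+ 1ℚ) 0<½κ n≤L ⟨&⟩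
          eventually-≥-geometric L n≤L (δ 1≤1+d) (fromℕ k) 0<r (Below.r<t b) (ratio-≥ b))
        where
          open ℚP.≤-Reasoning
          0<½κ : 0ℚ ℚ.< ½ ℚ.* κ
          0<½κ = 0<* (ℚP.positive⁻¹ ½) 0<κ
          b : Below 1≤1+d r
          b = below 1≤1+d r r<λ

      ratio-≤ : ∀ {r} (a : Above 1≤1+d r) → Eventually (λ n → L (1 + n) ℚ.≤ Above.s a ℚ.* L n)
      ratio-≤ a = eventual-ratio-≤ L n≤L (δ 1≤1+d) s≤δ
        (≤-by-difference (s ℚ.- (δ 1≤1+d ℚ.- 1ℚ)) (p≤q⇒0≤q-p δ-1≤s)
          (solve 2 (λ d t → con 1ℚ := (d :- t) :+ (t :- (d :- con 1ℚ))) refl (δ 1≤1+d) s))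
        s[δ-s]<1 logV-negligible log-recurrence-≤
        where open Above a

-- Orders of approximation as inequalities between integer powers.

module Approximation where

  open NumberLemmas
  open Logarithms
  open ContinuedFractions using (↥≡*↧)
  open DenominatorGrowth using (2^log₂*≤^; ^≤2^1+log₂*; 2^≤⇒≤log₂)
  open import Data.Rational.Base using (-_; _+_; _-_; _*_; _<_; _≤_; _/_)
  open Exp using (_^_; ^-homo-*; ^-assocʳ; ^-distrib-*)
  open ℚ-Solver using (solve; _:+_; _:*_; :-_; _:-_; _:=_; con)

  as-fraction : ∀ {t} → 0ℚ ≤ t → ∃[ a ] ∃[ k ] t * fromℕ (suc k) ≡ fromℕ a
  as-fraction {t@(mkℚ (+ a) k _)} _ = a , k , sym (↥≡*↧ t)
  as-fraction {mkℚ -[1+ _ ] _ _} (ℚ.*≤* ())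

  1^n≡1 : ∀ n → 1ℚ ^ n ≡ 1ℚ
  1^n≡1 zero = refl
  1^n≡1 (suc n) = trans (ℚP.*-identityˡ (1ℚ ^ n)) (1^n≡1 n)

  module _ {t : ℚ} (a k : ℕ) (tb≡a : t * fromℕ (suc k) ≡ fromℕ a) where

    private
      -frac*b≡a : - frac 0 a k * fromℕ (suc k) ≡ fromℕ a
      -frac*b≡a = trans (solve 2 (λ f b → :- f :* b := :- (f :* b)) refl (frac 0 a k) (fromℕ (suc k)))
        (trans (cong -_ (frac-* 0 a k)) (solve 1 (λ a → :- (con 0ℚ :- a) := a) refl (fromℕ a)))

      -frac≡t : - frac 0 a k ≡ t
      -frac≡t = ℚP.≤-antisym (cancel (ℚP.≤-reflexive (trans -frac*b≡a (sym tb≡a))))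
        (cancel (ℚP.≤-reflexive (trans tb≡a (sym -frac*b≡a))))
        where
          cancel : ∀ {p q} → p * fromℕ (suc k) ≤ q * fromℕ (suc k) → p ≤ q
          cancel = *-cancelʳ-≤₀ (0<fromℕ-suc k)

    -- With t = a/b and Q the denominator of `r`, the last hypothesis is σ ≤ Q^(-t), and t > x gives
    -- Q^(-t) ≤ Q^(-x).
    lower-power : ∀ r {x q σ} → upper x t → 0ℚ ≤ σ → q < σ → σ ^ suc k * fromℕ (↧ₙ r) ^ a ≤ 1ℚ → lower
      ((↧ₙ r) ^ʳ (-ʳ x)) q
    lower-power r {x} {σ = σ} ut 0≤σ q<σ h = σ , 0 , a , k , 0≤σ , q<σ , subst (upper x) (sym -frac≡t) ut , h

    -- M^b ≤ Q^a reads M ≤ Q^t, so t < x forces Q^(-x) ≤ Q^(-t) ≤ 1/M ≤ q. The cut supplies its own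
    -- witness exponent (n - m)/K above x; both inequalities are raised to powers that clear the
    -- denominators b and K.
    not-lower-power : ∀ r {x q M} → lower x t → lower ((↧ₙ r) ^ʳ (-ʳ x)) q → 1ℚ ≤ q * fromℕ M → M ℕ.^ suc k ℕ.≤
      (↧ₙ r) ℕ.^ a → ⊥
    not-lower-power r {x} {q} {M} lt (σ , m , n , k′ , 0≤σ , q<σ , u , σ^KB^n≤B^m) 1≤qM M^b≤Q^a = ℚP.<-irrefl refl
      (begin-strict
      B ^ (m ℕ.* b) ≡⟨ sym (ℚP.*-identityˡ (B ^ (m ℕ.* b))) ⟩
      1ℚ * B ^ (m ℕ.* b) <⟨ *-monoˡ-<₀ (0<^ (m ℕ.* b) 0<B) 1<power ⟩
      (σ ^ b * B ^ a) ^ K * B ^ (m ℕ.* b) ≡⟨ cong (_* B ^ (m ℕ.* b))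
        (trans (^-distrib-* (σ ^ b) (B ^ a) K) (cong₂ _*_ (^-swap b K) (^-assocʳ B a K))) ⟩
      (σ ^ K) ^ b * B ^ (a ℕ.* K) * B ^ (m ℕ.* b) ≡⟨ trans
        (ℚP.*-assoc ((σ ^ K) ^ b) (B ^ (a ℕ.* K)) (B ^ (m ℕ.* b)))
        (cong ((σ ^ K) ^ b *_) (sym (^-homo-* B (a ℕ.* K) (m ℕ.* b)))) ⟩
      (σ ^ K) ^ b * B ^ (a ℕ.* K ℕ.+ m ℕ.* b) ≤⟨ *-monoˡ-≤₀ (0≤^ b (0≤^ K 0≤σ)) (^-monoʳ-≤ 1≤B exponents) ⟩
      (σ ^ K) ^ b * B ^ (n ℕ.* b) ≡⟨ cong ((σ ^ K) ^ b *_) (sym (^-assocʳ B n b)) ⟩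
      (σ ^ K) ^ b * (B ^ n) ^ b ≡⟨ sym (^-distrib-* (σ ^ K) (B ^ n) b) ⟩
      (σ ^ K * B ^ n) ^ b ≤⟨ ^-mono-≤ b (0≤* (0≤^ K 0≤σ) (0≤^ n 0≤B)) σ^KB^n≤B^m ⟩
      (B ^ m) ^ b ≡⟨ ^-assocʳ B m b ⟩
      B ^ (m ℕ.* b) ∎)
      where
        open ℚP.≤-Reasoning
        b K : ℕ
        b = suc k
        K = suc k′
        B : ℚ
        B = fromℕ (↧ₙ r)
        0<B : 0ℚ < B
        0<B = 0<fromℕ-suc (ℚ.denominator-1 r)
        0≤B : 0ℚ ≤ B
        0≤B = ℚP.<⇒≤ 0<B
        1≤B : 1ℚ ≤ B
        1≤B = 1≤fromℕ-suc (ℚ.denominator-1 r)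
        0<σ*M : 1ℚ < σ * fromℕ M
        0<σ*M = ℚP.≤-<-trans 1≤qM (*-monoˡ-<₀ 0<M q<σ)
          where
            0<M : 0ℚ < fromℕ M
            0<M = nonzero M 1≤qM
              where
                nonzero : ∀ M → 1ℚ ≤ q * fromℕ M → 0ℚ < fromℕ M
                nonzero (suc M) _ = 0<fromℕ-suc M
                nonzero zero h = ⊥-elim (ℚP.<-irrefl refl (ℚP.<-≤-trans 0<1 (subst (1ℚ ≤_) (ℚP.*-zeroʳ q) h)))
        ^-swap : ∀ i j → (σ ^ i) ^ j ≡ (σ ^ j) ^ i
        ^-swap i j = trans (^-assocʳ σ i j) (trans (cong (σ ^_) (ℕP.*-comm i j)) (sym (^-assocʳ σ j i)))
        1<σ^bB^a : 1ℚ < σ ^ b * B ^ a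
        1<σ^bB^a = begin-strict
          1ℚ ≡⟨ sym (1^n≡1 b) ⟩
          1ℚ ^ b <⟨ ^-mono-< k 0≤1 0<σ*M ⟩
          (σ * fromℕ M) ^ b ≡⟨ trans (^-distrib-* σ (fromℕ M) b) (cong (σ ^ b *_) (sym (fromℕ-^ M b))) ⟩
          σ ^ b * fromℕ (M ℕ.^ b) ≤⟨ *-monoˡ-≤₀ (0≤^ b 0≤σ) (fromℕ-mono-≤ M^b≤Q^a) ⟩
          σ ^ b * fromℕ ((↧ₙ r) ℕ.^ a) ≡⟨ cong (σ ^ b *_) (fromℕ-^ (↧ₙ r) a) ⟩
          σ ^ b * B ^ a ∎
        1<power : 1ℚ < (σ ^ b * B ^ a) ^ K
        1<power = subst (_< (σ ^ b * B ^ a) ^ K) (1^n≡1 K) (^-mono-< k′ 0≤1 1<σ^bB^a)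
        exponents : a ℕ.* K ℕ.+ m ℕ.* b ℕ.≤ n ℕ.* b
        exponents = fromℕ-cancel-≤ (subst₂ _≤_
          (trans (cong (λ z → z * fromℕ K + fromℕ m * fromℕ b) tb≡a)
            (sym (trans (fromℕ-+ (a ℕ.* K) (m ℕ.* b)) (cong₂ _+_ (fromℕ-* a K) (fromℕ-* m b)))))
          (sym (fromℕ-* n b))
          (≤-by-difference ((- frac m n k′ - t) * (fromℕ b * fromℕ K))
            (0≤* (p≤q⇒0≤q-p (ℚP.<⇒≤ (lower<upper x lt u))) (0≤* (0≤fromℕ b) (0≤fromℕ K)))
            (trans (solve 3 (λ n m b → n :* b := (:- (m :- n)) :* b :+ m :* b) refl (fromℕ n) (fromℕ m) (fromℕ b))
              (trans (cong (λ z → - z * fromℕ b + fromℕ m * fromℕ b) (sym (frac-* m n k′)))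
                (solve 5 (λ f t m b K → :- (f :* K) :* b :+ m :* b := (t :* b :* K :+ m :* b) :+ (:- f :- t) :*
                  (b :* K)) refl (frac m n k′) t (fromℕ m) (fromℕ b) (fromℕ K))))))

  denominator-bound : ∀ l → ∃[ M ] ∀ {r} → r ∈ l → ↧ₙ r ℕ.≤ M
  denominator-bound [] = 0 , λ ()
  denominator-bound (r ∷ l) with denominator-bound l
  ... | M , h = ↧ₙ r ℕ.+ M , λ { (here refl) → ℕP.m≤m+n (↧ₙ r) M ; (there r∈l) → ℕP.≤-trans (h r∈l)
    (ℕP.m≤n+m M (↧ₙ r)) }

  -- Infinitude is stated as escaping every finite list, so refuting it requires a concrete list:
  -- the rationals of bounded height.
  fractions : ℕ → ℕ → List ℚ
  fractions A B = cartesianProductWith (λ i k → i / suc k) (map +_ (upTo A) ++ map -[1+_] (upTo A)) (upTo B)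

  ∈-fractions : ∀ {A B} r → ∣ ↥ r ∣ ℕ.< A → ↧ₙ r ℕ.≤ B → r ∈ fractions A B
  ∈-fractions {A} {B} r@(mkℚ i k _) i<A k<B = subst (_∈ fractions A B) (ℚP.↥p/↧p≡p r)
    (∈-cartesianProductWith⁺ (λ i k → i / suc k) (numerator i i<A) (∈-upTo⁺ k<B))
    where
      numerator : ∀ i → ∣ i ∣ ℕ.< A → i ∈ map +_ (upTo A) ++ map -[1+_] (upTo A)
      numerator (+ n) h = ∈-++⁺ˡ (∈-map⁺ +_ (∈-upTo⁺ h))
      numerator -[1+ n ] h = ∈-++⁺ʳ (map +_ (upTo A)) (∈-map⁺ -[1+_] (∈-upTo⁺ (ℕP.<⇒≤ h)))

  numerator-bound : ∀ r {g} → r ≤ fromℕ g → - r ≤ fromℕ g → ∣ ↥ r ∣ ℕ.≤ g ℕ.* ↧ₙ r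
  numerator-bound r {g} r≤g -r≤g = fromℕ-cancel-≤
    (subst (fromℕ ∣ ↥ r ∣ ≤_) (sym (fromℕ-* g (↧ₙ r))) (by-sign (↥ r) (↥≡*↧ r)))
    where
      by-sign : ∀ i → fromℤ i ≡ r * fromℕ (↧ₙ r) → fromℕ ∣ i ∣ ≤ fromℕ g * fromℕ (↧ₙ r)
      by-sign (+ n) eq = subst (_≤ fromℕ g * fromℕ (↧ₙ r)) (sym eq) (*-monoʳ-≤₀ (0≤fromℕ (↧ₙ r)) r≤g)
      by-sign -[1+ n ] eq = subst (_≤ fromℕ g * fromℕ (↧ₙ r))
        (trans (solve 2 (λ r b → :- r :* b := :- (r :* b)) refl r (fromℕ (↧ₙ r)))
          (trans (cong -_ (sym eq)) (neg-neg (fromℕ (suc n)))))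
        (*-monoʳ-≤₀ (0≤fromℕ (↧ₙ r)) -r≤g)

  fromℤ-positive⇒1≤ : ∀ i → 0ℚ < fromℤ i → 1ℚ ≤ fromℤ i
  fromℤ-positive⇒1≤ (+ suc n) _ = 1≤fromℕ-suc n
  fromℤ-positive⇒1≤ (+ zero) h = ⊥-elim (ℚP.<-irrefl refl h)
  fromℤ-positive⇒1≤ -[1+ n ] h = ⊥-elim (ℚP.<-asym h (ℚP.neg-antimono-< (0<fromℕ-suc n)))

  distance-≥ : ∀ r s → s < r → 1ℚ ≤ (r - s) * (fromℕ (↧ₙ r) * fromℕ (↧ₙ s))
  distance-≥ r s s<r = subst (1ℚ ≤_) (sym eq) (fromℤ-positive⇒1≤ z (subst (0ℚ <_) eq
      (0<* (p<q⇒0<q-p s<r) (0<* (0<fromℕ-suc (ℚ.denominator-1 r)) (0<fromℕ-suc (ℚ.denominator-1 s))))))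
    where
      z : ℤ
      z = ↥ r ℤ.* + ↧ₙ s ℤ.+ (ℤ.- ↥ s) ℤ.* + ↧ₙ r
      eq : (r - s) * (fromℕ (↧ₙ r) * fromℕ (↧ₙ s)) ≡ fromℤ z
      eq = trans (solve 4 (λ r s p q → (r :- s) :* (p :* q) := r :* p :* q :+ (:- (s :* q)) :* p) refl r s
        (fromℕ (↧ₙ r)) (fromℕ (↧ₙ s)))
        (trans (cong₂ (λ x y → x * fromℕ (↧ₙ s) + (- y) * fromℕ (↧ₙ r)) (sym (↥≡*↧ r)) (sym (↥≡*↧ s)))
          (trans (cong (λ z → fromℤ (↥ r) * fromℕ (↧ₙ s) + z * fromℕ (↧ₙ r)) (sym (fromℤ-neg (↥ s))))
            (sym (trans (fromℤ-+ (↥ r ℤ.* + ↧ₙ s) ((ℤ.- ↥ s) ℤ.* + ↧ₙ r))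
              (cong₂ _+_ (fromℤ-* (↥ r) (+ ↧ₙ s)) (fromℤ-* (ℤ.- ↥ s) (+ ↧ₙ r)))))))
        where
          fromℤ-neg : ∀ i → fromℤ (ℤ.- i) ≡ - fromℤ i
          fromℤ-neg (+ zero) = refl
          fromℤ-neg (+ suc n) = refl
          fromℤ-neg -[1+ n ] = sym (neg-neg (fromℕ (suc n)))

  first-after : ∀ {P : ℕ → Set} → (∀ n → Dec (P n)) → ∀ N k → ¬ P N → P (k ℕ.+ N) → ∃[ n ] N ℕ.≤ n × ¬ P n × P (suc n)
  first-after P? N zero ¬p p = ⊥-elim (¬p p)
  first-after {P} P? N (suc k) ¬p p with P? (suc N)
  ... | yes q = N , ℕP.≤-refl , ¬p , q
  ... | no ¬q with first-after P? (suc N) k ¬q (subst P (sym (ℕP.+-suc k N)) p)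
  ...   | n , N<n , h = n , ℕP.<⇒≤ N<n , h

  module Exponents {α : ℝ} {S : ℕ → ℚ} {X : ℕ → ℕ} (2^n≤X : ∀ n → 2 ℕ.^ n ℕ.≤ X n) (↧S≡X : ∀ n → ↧ₙ (S n) ≡ X n)
    {1/X : ℕ → ℚ} (X*1/X : ∀ n → fromℕ (X n) * 1/X n ≡ 1ℚ) (0<1/X : ∀ n → 0ℚ < 1/X n)
    (upper-error : ∀ n → upper ∣ α -ʳ S n ∣ʳ (fromℕ 2 * 1/X (1 ℕ.+ n)))
    (lower-error : ∀ n → lower ∣ α -ʳ S n ∣ʳ (½ * ½ * 1/X (1 ℕ.+ n))) where

    private
      1≤X : ∀ n → 1 ℕ.≤ X n
      1≤X n = ℕP.≤-trans (ℕP.m^n>0 2 n) (2^n≤X n)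

      ℓ : ℕ → ℕ
      ℓ n = log₂ (X n)

      L : ℕ → ℚ
      L n = fromℕ (ℓ n)

      n≤L : ∀ n → fromℕ n ≤ L n
      n≤L n = fromℕ-mono-≤ {n} (2^≤⇒≤log₂ {n} (1≤X n) (2^n≤X n))

      ^-distrib : ∀ m n k → (m ℕ.* n) ℕ.^ k ≡ m ℕ.^ k ℕ.* n ℕ.^ k
      ^-distrib m n zero = refl
      ^-distrib m n (suc k) = trans (cong (m ℕ.* n ℕ.*_) (^-distrib m n k))
        (solveℕ 4 (λ m n x y → m ⊗ n ⊗ (x ⊗ y) ⊜ m ⊗ x ⊗ (n ⊗ y)) refl m n (m ℕ.^ k) (n ℕ.^ k))

    -- By `upper-error` it suffices that 4 / X (n+1) ≤ X n ^ (-t), that is, 4^b X n ^ a ≤ X (n+1) ^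
    -- b with t = a/b. `S n` escapes the given list because its denominator, at least 2^n, exceeds
    -- all denominators there.
    approximable : ∀ {r t t′} → 0ℚ ≤ t → r < t → t < t′ → Eventually (λ n → t′ * L n ≤ L (1 ℕ.+ n)) →
      ApproximableToOrder α (fromℚ r)
    approximable {r} {t} {t′} 0≤t r<t t<t′ ratio l =
      let (M , ↧≤M) = denominator-bound l
          (a , k , tb≡a) = as-fraction 0≤t
          -- After division by b, the factor 4^b costs 2 and rounding up the logarithm of `X n`
          -- costs t.
          (N , h) = ratio ⟨&⟩ eventually-≤-* (t + fromℕ 2) (p<q⇒0<q-p t<t′) n≤L
          n = N ℕ.+ M
      in S n ,
         (λ S∈l → ℕP.<⇒≱ (ℕP.≤-trans (n<2^n n) (2^n≤X n))
           (ℕP.≤-trans (subst (ℕ._≤ M) (↧S≡X n) (↧≤M S∈l)) (ℕP.m≤n+m M N))) ,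
         (½ * ½ * 1/X (1 ℕ.+ n) , 0<* (ℚP.positive⁻¹ (½ * ½)) (0<1/X (1 ℕ.+ n)) , lower-error n) ,
         fromℕ 2 * 1/X (1 ℕ.+ n) , upper-error n ,
         -- 4 in place of 2 leaves the strict room that the cut requires.
         lower-power a k tb≡a (S n) {fromℚ r} {fromℕ 2 * 1/X (1 ℕ.+ n)} {fromℕ 4 * 1/X (1 ℕ.+ n)} r<t
           (0≤* (0≤fromℕ 4) (ℚP.<⇒≤ (0<1/X (1 ℕ.+ n))))
           (*-monoˡ-<₀ (0<1/X (1 ℕ.+ n)) (fromℕ-mono-< {2} {4} (s≤s (s≤s (s≤s z≤n)))))
           (subst (λ Q → (fromℕ 4 * 1/X (1 ℕ.+ n)) ^ suc k * fromℕ Q ^ a ≤ 1ℚ) (sym (↧S≡X n))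
             (small n a k tb≡a (h n (ℕP.m≤m+n N M))))
      where
        small : ∀ n a k → t * fromℕ (suc k) ≡ fromℕ a → t′ * L n ≤ L (1 ℕ.+ n) × t + fromℕ 2 ≤ (t′ - t) * L n →
          (fromℕ 4 * 1/X (1 ℕ.+ n)) ^ suc k * fromℕ (X n) ^ a ≤ 1ℚ
        small n a k tb≡a (h₁ , h₂) = begin
          (fromℕ 4 * i) ^ b * fromℕ (X n) ^ a ≡⟨ cong₂ _*_ (^-distrib-* (fromℕ 4) i b) (sym (fromℕ-^ (X n) a)) ⟩
          fromℕ 4 ^ b * i ^ b * fromℕ (X n ℕ.^ a) ≡⟨ solve 3 (λ x y z → x :* y :* z := (x :* z) :* y) refl
            (fromℕ 4 ^ b) (i ^ b) (fromℕ (X n ℕ.^ a)) ⟩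
          fromℕ 4 ^ b * fromℕ (X n ℕ.^ a) * i ^ b ≡⟨ cong (_* i ^ b)
            (trans (cong (_* fromℕ (X n ℕ.^ a)) (sym (fromℕ-^ 4 b))) (sym (fromℕ-* (4 ℕ.^ b) (X n ℕ.^ a)))) ⟩
          fromℕ (4 ℕ.^ b ℕ.* X n ℕ.^ a) * i ^ b ≤⟨ *-monoʳ-≤₀ (0≤^ b (ℚP.<⇒≤ (0<1/X (1 ℕ.+ n))))
            (fromℕ-mono-≤ powers) ⟩
          fromℕ (X (1 ℕ.+ n) ℕ.^ b) * i ^ b ≡⟨ cong (_* i ^ b) (fromℕ-^ (X (1 ℕ.+ n)) b) ⟩
          fromℕ (X (1 ℕ.+ n)) ^ b * i ^ b ≡⟨ sym (^-distrib-* (fromℕ (X (1 ℕ.+ n))) i b) ⟩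
          (fromℕ (X (1 ℕ.+ n)) * i) ^ b ≡⟨ trans (cong (_^ b) (X*1/X (1 ℕ.+ n))) (1^n≡1 b) ⟩
          1ℚ ∎
          where
            open ℚP.≤-Reasoning
            b : ℕ
            b = suc k
            i : ℚ
            i = 1/X (1 ℕ.+ n)
            exponents : 2 ℕ.* b ℕ.+ (1 ℕ.+ ℓ n) ℕ.* a ℕ.≤ ℓ (1 ℕ.+ n) ℕ.* b
            exponents = fromℕ-cancel-≤ (subst₂ _≤_
              (trans (cong (λ z → fromℕ 2 * fromℕ b + (1ℚ + L n) * z) tb≡a)
                (sym (trans (fromℕ-+ (2 ℕ.* b) ((1 ℕ.+ ℓ n) ℕ.* a))
                  (cong₂ _+_ (fromℕ-* 2 b) (trans (fromℕ-* (1 ℕ.+ ℓ n) a) (cong (_* fromℕ a) (fromℕ-suc (ℓ n))))))))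
              (sym (fromℕ-* (ℓ (1 ℕ.+ n)) b))
              (≤-by-difference (((L (1 ℕ.+ n) - t′ * L n) + ((t′ - t) * L n - (t + fromℕ 2))) * fromℕ b)
                (0≤* (0≤+ (p≤q⇒0≤q-p h₁) (p≤q⇒0≤q-p h₂)) (0≤fromℕ b))
                (solve 5 (λ x y t t′ b → y :* b := (con (fromℕ 2) :* b :+ (con 1ℚ :+ x) :* (t :* b)) :+
                  ((y :- t′ :* x) :+ ((t′ :- t) :* x :- (t :+ con (fromℕ 2)))) :* b)
                  refl (L n) (L (1 ℕ.+ n)) t t′ (fromℕ b))))
            powers : 4 ℕ.^ b ℕ.* X n ℕ.^ a ℕ.≤ X (1 ℕ.+ n) ℕ.^ b
            powers = ℕP.≤-trans (ℕP.*-mono-≤ (ℕP.≤-reflexive (ℕP.^-*-assoc 2 2 b)) (^≤2^1+log₂* a (1≤X n)))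
              (subst (ℕ._≤ X (1 ℕ.+ n) ℕ.^ b) (ℕP.^-distribˡ-+-* 2 (2 ℕ.* b) ((1 ℕ.+ ℓ n) ℕ.* a))
                (ℕP.≤-trans (ℕP.^-monoʳ-≤ 2 exponents) (2^log₂*≤^ b (1≤X (1 ℕ.+ n)))))

    module _ {s s′ t : ℚ} (2<s : fromℕ 2 < s) (s′<s : s′ < s) (t<[s-1][t-1] : t < (s - 1ℚ) * (t - 1ℚ))
      (ratio-≥ : Eventually (λ n → t * L n ≤ L (1 ℕ.+ n))) (ratio-≤ : Eventually (λ n → L (1 ℕ.+ n) ≤ s′ * L n))
      {u : ℕ → ℕ} (X-suc : ∀ n → X (1 ℕ.+ n) ≡ X n ℕ.* u n) (X≤u : ∀ n → X n ℕ.≤ u n) where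

      private
        1≤s : 1ℚ ≤ s
        1≤s = ℚP.≤-trans (fromℕ-mono-≤ {1} {2} (s≤s z≤n)) (ℚP.<⇒≤ 2<s)

        0≤s : 0ℚ ≤ s
        0≤s = ℚP.≤-trans 0≤1 1≤s

        a k b : ℕ
        a = proj₁ (as-fraction 0≤s)
        k = proj₁ (proj₂ (as-fraction 0≤s))
        b = suc k

        sb≡a : s * fromℕ b ≡ fromℕ a
        sb≡a = proj₂ (proj₂ (as-fraction 0≤s))

        b≤a : b ℕ.≤ a
        b≤a = fromℕ-cancel-≤ (subst₂ _≤_ (ℚP.*-identityˡ (fromℕ b)) sb≡a (*-monoʳ-≤₀ (0≤fromℕ b) 1≤s))

        c : ℕ
        c = a ℕ.∸ b

        c+b≡a : c ℕ.+ b ≡ a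
        c+b≡a = ℕP.m∸n+n≡m b≤a

        [s-1]b≡c : (s - 1ℚ) * fromℕ b ≡ fromℕ c
        [s-1]b≡c = trans (solve 2 (λ s b → (s :- con 1ℚ) :* b := s :* b :- b) refl s (fromℕ b))
          (trans (cong (_- fromℕ b) (trans sb≡a (trans (cong fromℕ (sym c+b≡a)) (fromℕ-+ c b))))
            (p+q-q (fromℕ c) (fromℕ b)))

        -- With x = L n and y = L (n+1), up to constants this asks for (s - 1) x ≤ (s - 2) y. It
        -- follows from y ≥ t x, because t < (s - 1) (t - 1) is the same as s - 1 < (s - 2) t.
        exponents-distinct : Eventually (λ n → b ℕ.* (2 ℕ.+ ℓ (1 ℕ.+ n)) ℕ.+ c ℕ.* (3 ℕ.+ ℓ n) ℕ.≤ c ℕ.* ℓ (1 ℕ.+ n))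
        exponents-distinct = mapᵉ (λ n (h₁ , h₂) → fromℕ-cancel-≤ (subst₂ _≤_
            (sym (trans (fromℕ-+ (b ℕ.* (2 ℕ.+ ℓ (1 ℕ.+ n))) (c ℕ.* (3 ℕ.+ ℓ n))) (cong₂ _+_
              (trans (fromℕ-* b (2 ℕ.+ ℓ (1 ℕ.+ n))) (cong (fromℕ b *_) (fromℕ-+ 2 (ℓ (1 ℕ.+ n)))))
              (trans (fromℕ-* c (3 ℕ.+ ℓ n)) (cong₂ _*_ (sym [s-1]b≡c) (fromℕ-+ 3 (ℓ n)))))))
            (trans (cong (_* L (1 ℕ.+ n)) [s-1]b≡c) (sym (fromℕ-* c (ℓ (1 ℕ.+ n)))))
            (≤-by-difference (fromℕ b * ((s - fromℕ 2) * (L (1 ℕ.+ n) - t * L n) +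
              (((s - 1ℚ) * (t - 1ℚ) - t) * L n - (fromℕ 3 * (s - 1ℚ) + fromℕ 2))))
              (0≤* (0≤fromℕ b) (0≤+ (0≤* (p≤q⇒0≤q-p (ℚP.<⇒≤ 2<s)) (p≤q⇒0≤q-p h₁)) (p≤q⇒0≤q-p h₂)))
              (solve 5 (λ s t b x y → (s :- con 1ℚ) :* b :* y :=
                (b :* (con (fromℕ 2) :+ y) :+ (s :- con 1ℚ) :* b :* (con (fromℕ 3) :+ x)) :+
                  b :* ((s :- con (fromℕ 2)) :* (y :- t :* x) :+
                    (((s :- con 1ℚ) :* (t :- con 1ℚ) :- t) :* x :-
                    (con (fromℕ 3) :* (s :- con 1ℚ) :+ con (fromℕ 2)))))
                refl s t (fromℕ b) (L n) (L (1 ℕ.+ n))))))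
          (ratio-≥ ⟨&⟩ eventually-≤-* (fromℕ 3 * (s - 1ℚ) + fromℕ 2) (p<q⇒0<q-p t<[s-1][t-1]) n≤L)

        exponents-equal : Eventually (λ n → b ℕ.* (3 ℕ.+ ℓ (1 ℕ.+ n)) ℕ.≤ a ℕ.* ℓ n)
        exponents-equal = mapᵉ (λ n (h₁ , h₂) → fromℕ-cancel-≤ (subst₂ _≤_
            (sym (trans (fromℕ-* b (3 ℕ.+ ℓ (1 ℕ.+ n))) (cong (fromℕ b *_) (fromℕ-+ 3 (ℓ (1 ℕ.+ n))))))
            (trans (cong (_* L n) sb≡a) (sym (fromℕ-* a (ℓ n))))
            (≤-by-difference (fromℕ b * ((s′ * L n - L (1 ℕ.+ n)) + ((s - s′) * L n - fromℕ 3)))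
              (0≤* (0≤fromℕ b) (0≤+ (p≤q⇒0≤q-p h₁) (p≤q⇒0≤q-p h₂)))
              (solve 5 (λ s s′ b x y → s :* b :* x := b :* (con (fromℕ 3) :+ y) :+ b :*
                ((s′ :* x :- y) :+ ((s :- s′) :* x :- con (fromℕ 3))))
                refl s s′ (fromℕ b) (L n) (L (1 ℕ.+ n))))))
          (ratio-≤ ⟨&⟩ eventually-≤-* (fromℕ 3) (p<q⇒0<q-p s′<s) n≤L)

        -- Q is at least X (n+1) / (4 X n), which is large enough for Q^c ≥ (2 X (n+1))^b, where c/b
        -- = s - 1. A further factor Q^b gives the claim.
        power-distinct : ∀ {n Q} → b ℕ.* (2 ℕ.+ ℓ (1 ℕ.+ n)) ℕ.+ c ℕ.* (3 ℕ.+ ℓ n) ℕ.≤ c ℕ.* ℓ (1 ℕ.+ n) →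
          X (1 ℕ.+ n) ℕ.≤ 4 ℕ.* X n ℕ.* Q → (2 ℕ.* Q ℕ.* X (1 ℕ.+ n)) ℕ.^ b ℕ.≤ Q ℕ.^ a
        power-distinct {n} {Q} h X≤4XQ = subst₂ ℕ._≤_
            (trans (sym (^-distrib (2 ℕ.* X (1 ℕ.+ n)) Q b))
              (cong (ℕ._^ b) (solveℕ 2 (λ x q → nat 2 ⊗ x ⊗ q ⊜ nat 2 ⊗ q ⊗ x) refl (X (1 ℕ.+ n)) Q)))
            (trans (sym (ℕP.^-distribˡ-+-* Q c b)) (cong (Q ℕ.^_) c+b≡a))
            (ℕP.*-monoˡ-≤ (Q ℕ.^ b) [2X]^b≤Q^c)
          where
            open ℕP.≤-Reasoning
            D : ℕ
            D = 2 ℕ.^ (c ℕ.* (3 ℕ.+ ℓ n))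
            [4X]^c≤D : (4 ℕ.* X n) ℕ.^ c ℕ.≤ D
            [4X]^c≤D = subst ((4 ℕ.* X n) ℕ.^ c ℕ.≤_)
              (trans (ℕP.^-*-assoc 2 (3 ℕ.+ ℓ n) c) (cong (2 ℕ.^_) (ℕP.*-comm (3 ℕ.+ ℓ n) c)))
              (ℕP.^-monoˡ-≤ c (subst (4 ℕ.* X n ℕ.≤_) (sym (ℕP.^-distribˡ-+-* 2 2 (1 ℕ.+ ℓ n)))
                (ℕP.*-monoʳ-≤ 4 (ℕP.<⇒≤ (<2^1+log₂ (1≤X n))))))
            [2X]^b≤Q^c : (2 ℕ.* X (1 ℕ.+ n)) ℕ.^ b ℕ.≤ Q ℕ.^ c
            [2X]^b≤Q^c = ℕP.*-cancelʳ-≤ ((2 ℕ.* X (1 ℕ.+ n)) ℕ.^ b) (Q ℕ.^ c) D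
              {{ℕP.m^n≢0 2 (c ℕ.* (3 ℕ.+ ℓ n))}} (begin
              (2 ℕ.* X (1 ℕ.+ n)) ℕ.^ b ℕ.* D ≤⟨ ℕP.*-monoˡ-≤ D
                (ℕP.^-monoˡ-≤ b (ℕP.*-monoʳ-≤ 2 (ℕP.<⇒≤ (<2^1+log₂ (1≤X (1 ℕ.+ n)))))) ⟩
              (2 ℕ.^ (2 ℕ.+ ℓ (1 ℕ.+ n))) ℕ.^ b ℕ.* D ≡⟨ cong (ℕ._* D)
                (trans (ℕP.^-*-assoc 2 (2 ℕ.+ ℓ (1 ℕ.+ n)) b) (cong (2 ℕ.^_) (ℕP.*-comm (2 ℕ.+ ℓ (1 ℕ.+ n)) b))) ⟩
              2 ℕ.^ (b ℕ.* (2 ℕ.+ ℓ (1 ℕ.+ n))) ℕ.* D ≡⟨ sym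
                (ℕP.^-distribˡ-+-* 2 (b ℕ.* (2 ℕ.+ ℓ (1 ℕ.+ n))) (c ℕ.* (3 ℕ.+ ℓ n))) ⟩
              2 ℕ.^ (b ℕ.* (2 ℕ.+ ℓ (1 ℕ.+ n)) ℕ.+ c ℕ.* (3 ℕ.+ ℓ n)) ≤⟨ ℕP.^-monoʳ-≤ 2 h ⟩
              2 ℕ.^ (c ℕ.* ℓ (1 ℕ.+ n)) ≡⟨ cong (2 ℕ.^_) (ℕP.*-comm c (ℓ (1 ℕ.+ n))) ⟩
              2 ℕ.^ (ℓ (1 ℕ.+ n) ℕ.* c) ≤⟨ 2^log₂*≤^ c (1≤X (1 ℕ.+ n)) ⟩
              X (1 ℕ.+ n) ℕ.^ c ≤⟨ ℕP.^-monoˡ-≤ c X≤4XQ ⟩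
              (4 ℕ.* X n ℕ.* Q) ℕ.^ c ≡⟨ ^-distrib (4 ℕ.* X n) Q c ⟩
              (4 ℕ.* X n) ℕ.^ c ℕ.* Q ℕ.^ c ≤⟨ ℕP.*-monoˡ-≤ (Q ℕ.^ c) [4X]^c≤D ⟩
              D ℕ.* Q ℕ.^ c ≡⟨ ℕP.*-comm D (Q ℕ.^ c) ⟩
              Q ℕ.^ c ℕ.* D ∎)

        power-equal : ∀ {n} → b ℕ.* (3 ℕ.+ ℓ (1 ℕ.+ n)) ℕ.≤ a ℕ.* ℓ n → (4 ℕ.* X (1 ℕ.+ n)) ℕ.^ b ℕ.≤ X n ℕ.^ a
        power-equal {n} h = begin
          (4 ℕ.* X (1 ℕ.+ n)) ℕ.^ b ≤⟨ ℕP.^-monoˡ-≤ b (ℕP.*-monoʳ-≤ 4 (ℕP.<⇒≤ (<2^1+log₂ (1≤X (1 ℕ.+ n))))) ⟩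
          (4 ℕ.* 2 ℕ.^ (1 ℕ.+ ℓ (1 ℕ.+ n))) ℕ.^ b ≡⟨ cong (ℕ._^ b) (sym (ℕP.^-distribˡ-+-* 2 2 (1 ℕ.+ ℓ (1 ℕ.+ n)))) ⟩
          (2 ℕ.^ (3 ℕ.+ ℓ (1 ℕ.+ n))) ℕ.^ b ≡⟨ trans (ℕP.^-*-assoc 2 (3 ℕ.+ ℓ (1 ℕ.+ n)) b)
            (cong (2 ℕ.^_) (ℕP.*-comm (3 ℕ.+ ℓ (1 ℕ.+ n)) b)) ⟩
          2 ℕ.^ (b ℕ.* (3 ℕ.+ ℓ (1 ℕ.+ n))) ≤⟨ ℕP.^-monoʳ-≤ 2 h ⟩
          2 ℕ.^ (a ℕ.* ℓ n) ≡⟨ cong (2 ℕ.^_) (ℕP.*-comm a (ℓ n)) ⟩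
          2 ℕ.^ (ℓ n ℕ.* a) ≤⟨ 2^log₂*≤^ a (1≤X n) ⟩
          X n ℕ.^ a ∎
          where open ℕP.≤-Reasoning

        error-equal : ∀ {n q} → upper ∣ α -ʳ S n ∣ʳ q → 1ℚ ≤ q * fromℕ (4 ℕ.* X (1 ℕ.+ n))
        error-equal {n} {q} uq = subst (_≤ q * fromℕ (4 ℕ.* X (1 ℕ.+ n)))
          (trans (cong (½ * ½ * i *_) (fromℕ-* 4 (X (1 ℕ.+ n))))
            (trans (solve 2 (λ x i → con (½ * ½) :* i :* (con (fromℕ 4) :* x) := x :* i) refl
            (fromℕ (X (1 ℕ.+ n))) i) (X*1/X (1 ℕ.+ n))))
          (*-monoʳ-≤₀ (0≤fromℕ (4 ℕ.* X (1 ℕ.+ n)))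
            (ℚP.<⇒≤ (lower<upper ∣ α -ʳ S n ∣ʳ {½ * ½ * i} {q} (lower-error n) uq)))
          where
            i : ℚ
            i = 1/X (1 ℕ.+ n)

        distance-< : ∀ {n r q} → upper ∣ α -ʳ r ∣ʳ q →
          r - S n < q + fromℕ 2 * 1/X (1 ℕ.+ n) × S n - r < q + fromℕ 2 * 1/X (1 ℕ.+ n)
        distance-< {n} {r} {q} (u , l) = let (u′ , l′) = upper-error n ; e = fromℕ 2 * 1/X (1 ℕ.+ n) in
          <-by-difference ((e - (- S n)) - (- q - (- r))) (p<q⇒0<q-p (lower<upper α l u′))
            (solve 4 (λ r s q e → q :+ e := (r :- s) :+ ((e :- (:- s)) :- (:- q :- (:- r)))) refl r (S n) q e) ,
          <-by-difference ((q - (- r)) - (- e - (- S n))) (p<q⇒0<q-p (lower<upper α l′ u))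
            (solve 4 (λ r s q e → q :+ e := (s :- r) :+ ((q :- (:- r)) :- (:- e :- (:- s)))) refl r (S n) q e)

        -- Distinct fractions with denominators Q and X n are at least 1 / (Q X n) apart; by the
        -- size condition the error 2 / X (n+1) of `S n` consumes at most half of this.
        error-distinct : ∀ {n r q} → ¬ r ≡ S n → upper ∣ α -ʳ r ∣ʳ q → 4 ℕ.* X n ℕ.* ↧ₙ r ℕ.≤ X (1 ℕ.+ n) →
          1ℚ ≤ q * fromℕ (2 ℕ.* ↧ₙ r ℕ.* X n)
        error-distinct {n} {r} {q} r≢S uq h = subst (1ℚ ≤_) (cong (q *_) (sym casts))
            (≤-by-difference (fromℕ 2 * ((q + fromℕ 2 * i) * (Q * x) - 1ℚ) + (1ℚ - fromℕ 4 * x * Q * i))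
              (0≤+ (0≤* (0≤fromℕ 2) (p≤q⇒0≤q-p far)) (p≤q⇒0≤q-p small))
              (solve 4 (λ q i Q x → q :* (con (fromℕ 2) :* Q :* x) := con 1ℚ :+
                (con (fromℕ 2) :* ((q :+ con (fromℕ 2) :* i) :* (Q :* x) :- con 1ℚ) :+
                (con 1ℚ :- con (fromℕ 4) :* x :* Q :* i)))
                refl q i Q x))
          where
            Q x i : ℚ
            Q = fromℕ (↧ₙ r)
            x = fromℕ (X n)
            i = 1/X (1 ℕ.+ n)
            0≤Qx : 0ℚ ≤ Q * x
            0≤Qx = 0≤* (0≤fromℕ (↧ₙ r)) (0≤fromℕ (X n))
            casts : fromℕ (2 ℕ.* ↧ₙ r ℕ.* X n) ≡ fromℕ 2 * Q * x
            casts = trans (fromℕ-* (2 ℕ.* ↧ₙ r) (X n)) (cong (_* x) (fromℕ-* 2 (↧ₙ r)))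
            small : fromℕ 4 * x * Q * i ≤ 1ℚ
            small = subst₂ _≤_ (cong (_* i) (trans (fromℕ-* (4 ℕ.* X n) (↧ₙ r)) (cong (_* Q) (fromℕ-* 4 (X n)))))
              (X*1/X (1 ℕ.+ n))
              (*-monoʳ-≤₀ (ℚP.<⇒≤ (0<1/X (1 ℕ.+ n))) (fromℕ-mono-≤ h))
            far : 1ℚ ≤ (q + fromℕ 2 * i) * (Q * x)
            far with ℚP.<-cmp r (S n)
            ... | tri< r<S _ _ = ℚP.≤-trans
              (subst (λ d → 1ℚ ≤ (S n - r) * d)
              (trans (ℚP.*-comm (fromℕ (↧ₙ (S n))) Q) (cong (λ m → Q * fromℕ m) (↧S≡X n))) (distance-≥ (S n) r r<S))
                  (*-monoʳ-≤₀ 0≤Qx (ℚP.<⇒≤ (proj₂ (distance-< {n} {r} {q} uq))))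
            ... | tri≈ _ r≡S _ = ⊥-elim (r≢S r≡S)
            ... | tri> _ _ S<r = ℚP.≤-trans
              (subst (λ m → 1ℚ ≤ (r - S n) * (Q * fromℕ m)) (↧S≡X n) (distance-≥ r (S n) S<r))
                  (*-monoʳ-≤₀ 0≤Qx (ℚP.<⇒≤ (proj₁ (distance-< {n} {r} {q} uq))))

        N : ℕ
        N = proj₁ (exponents-distinct ⟨&⟩ exponents-equal)

        -- The `M` found satisfies 1/M ≤ q and M ≤ Q^s, as `not-lower-power` requires. The index n
        -- is a change of `Good` from failure to success: failure at n bounds Q from below for
        -- `power-distinct`, success at n+1 serves `error-distinct` for `S (1 + n)`.
        bad : ∀ r {q} → X (1 ℕ.+ N) ℕ.≤ ↧ₙ r → upper ∣ α -ʳ r ∣ʳ q → ∃[ M ] 1ℚ ≤ q * fromℕ M × M ℕ.^ b ℕ.≤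
          (↧ₙ r) ℕ.^ a
        bad r {q} X≤Q uq = by-case (r ℚP.≟ S (1 ℕ.+ n))
          where
            Q : ℕ
            Q = ↧ₙ r
            Good : ℕ → Set
            Good n = 4 ℕ.* X n ℕ.* Q ℕ.≤ X (1 ℕ.+ n)
            ¬Good-N : ¬ Good N
            ¬Good-N h = ℕP.<⇒≱ (ℕP.m<m+n Q {Q} (s≤s z≤n)) (ℕP.≤-trans (ℕP.≤-trans 2Q≤4XQ h) X≤Q)
              where
                2Q≤4XQ : Q ℕ.+ Q ℕ.≤ 4 ℕ.* X N ℕ.* Q
                2Q≤4XQ = ℕP.≤-trans (ℕP.+-monoʳ-≤ Q (ℕP.m≤m+n Q (2 ℕ.* Q)))
                  (ℕP.≤-trans (ℕP.≤-reflexive (solveℕ 1 (λ q → q ⊕ (q ⊕ nat 2 ⊗ q) ⊜ nat 4 ⊗ q) refl Q))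
                    (ℕP.*-monoˡ-≤ Q (ℕP.*-monoʳ-≤ 4 (1≤X N))))
            -- For m = 4 Q + N the quotient X (m+1) / X m is at least X m ≥ 2^m > 4 Q.
            Good-large : Good (4 ℕ.* Q ℕ.+ N)
            Good-large = let m = 4 ℕ.* Q ℕ.+ N in subst (4 ℕ.* X m ℕ.* Q ℕ.≤_) (sym (X-suc m))
              (subst (ℕ._≤ X m ℕ.* u m) (solveℕ 2 (λ x q → x ⊗ (nat 4 ⊗ q) ⊜ nat 4 ⊗ x ⊗ q) refl (X m) Q)
                (ℕP.*-monoʳ-≤ (X m) (ℕP.≤-trans (ℕP.≤-trans (ℕP.m≤m+n (4 ℕ.* Q) N) (ℕP.<⇒≤ (n<2^n m)))
                  (ℕP.≤-trans (2^n≤X m) (X≤u m)))))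
            found : ∃[ n ] N ℕ.≤ n × ¬ Good n × Good (suc n)
            found = first-after (λ n → 4 ℕ.* X n ℕ.* Q ℕP.≤? X (1 ℕ.+ n)) N (4 ℕ.* Q) ¬Good-N Good-large
            n : ℕ
            n = proj₁ found
            N≤n : N ℕ.≤ n
            N≤n = proj₁ (proj₂ found)
            exponents : ∀ m → N ℕ.≤ m → _
            exponents = proj₂ (exponents-distinct ⟨&⟩ exponents-equal)
            by-case : Dec (r ≡ S (1 ℕ.+ n)) → ∃[ M ] 1ℚ ≤ q * fromℕ M × M ℕ.^ b ℕ.≤ Q ℕ.^ a
            by-case (yes r≡S) = 4 ℕ.* X (2 ℕ.+ n) , error-equal {1 ℕ.+ n} {q}
              (subst (λ r → upper ∣ α -ʳ r ∣ʳ q) r≡S uq) ,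
              subst (λ m → (4 ℕ.* X (2 ℕ.+ n)) ℕ.^ b ℕ.≤ m ℕ.^ a) (sym (trans (cong ↧ₙ_ r≡S) (↧S≡X (1 ℕ.+ n))))
                (power-equal {1 ℕ.+ n} (proj₂ (exponents (1 ℕ.+ n) (ℕP.m≤n⇒m≤1+n N≤n))))
            by-case (no r≢S) = 2 ℕ.* Q ℕ.* X (1 ℕ.+ n) , error-distinct {1 ℕ.+ n} {r} {q} r≢S uq
              (proj₂ (proj₂ (proj₂ found))) ,
              power-distinct {n} {Q} (proj₁ (exponents n N≤n)) (ℕP.<⇒≤ (ℕP.≰⇒> (proj₁ (proj₂ (proj₂ found)))))

      -- An approximant lies within 1 of `α` by `close`, so a bounded denominator would bound its
      -- numerator too and place it in the list. One outside the list therefore has a large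
      -- denominator and is refuted by `bad`.
      not-approximable : ∀ {x} → lower x s → ¬ ApproximableToOrder α x
      not-approximable {x} ls approx =
        let (l₀ , hl₀) = lower-inhabited α
            (u₀ , hu₀) = upper-inhabited α
            (g , u₀+1<g) = archimedean (u₀ + 1ℚ)
            (g′ , 1-l₀<g′) = archimedean (1ℚ - l₀)
            G = g ℕ.+ g′
            (r , r∉ , _ , q , uq , lq) = approx (fractions (suc (G ℕ.* X (1 ℕ.+ N))) (X (1 ℕ.+ N)))
            q<1 = close r {q} lq
            g≤G = ℚP.≤-trans (ℚP.<⇒≤ u₀+1<g) (fromℕ-mono-≤ (ℕP.m≤m+n g g′))
            g′≤G = ℚP.≤-trans (ℚP.<⇒≤ 1-l₀<g′) (fromℕ-mono-≤ (ℕP.m≤n+m g′ g))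
            r<G = ℚP.≤-trans (ℚP.<⇒≤ (<-by-difference ((u₀ - (- q - (- r))) + (1ℚ - q))
              (0<+≤ (p<q⇒0<q-p (lower<upper α (proj₂ uq) hu₀)) (p≤q⇒0≤q-p (ℚP.<⇒≤ q<1)))
              (solve 3 (λ u q r → u :+ con 1ℚ := r :+ ((u :- (:- q :- (:- r))) :+ (con 1ℚ :- q))) refl u₀ q r))) g≤G
            -r<G = ℚP.≤-trans (ℚP.<⇒≤ (<-by-difference (((q - (- r)) - l₀) + (1ℚ - q))
              (0<+≤ (p<q⇒0<q-p (lower<upper α hl₀ (proj₁ uq))) (p≤q⇒0≤q-p (ℚP.<⇒≤ q<1)))
              (solve 3 (λ l q r → con 1ℚ :- l := (:- r) :+ (((q :- (:- r)) :- l) :+ (con 1ℚ :- q))) refl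
                l₀ q r))) g′≤G
        in by-size r {q} {G} r∉ uq lq (numerator-bound r {G} r<G -r<G) (↧ₙ r ℕP.≤? X (1 ℕ.+ N))
        where
          contradict : ∀ r {q} M → lower ((↧ₙ r) ^ʳ (-ʳ x)) q → 1ℚ ≤ q * fromℕ M → M ℕ.^ b ℕ.≤ (↧ₙ r) ℕ.^ a → ⊥
          contradict r {q} M = not-lower-power a k sb≡a r {x} {q} {M} ls
          -- The refutation with M = 1, as 1 ≤ Q^a.
          close : ∀ r {q} → lower ((↧ₙ r) ^ʳ (-ʳ x)) q → q < 1ℚ
          close r {q} lq with ≤₀⊎>₀ 1ℚ q
          ... | inj₂ q<1 = q<1
          ... | inj₁ 1≤q = ⊥-elim (contradict r {q} 1 lq (subst (1ℚ ≤_) (sym (ℚP.*-identityʳ q)) 1≤q)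
                (subst (ℕ._≤ (↧ₙ r) ℕ.^ a) (sym (ℕP.^-zeroˡ b)) (ℕP.m^n>0 (↧ₙ r) a)))
          by-size : ∀ r {q G} → r ∉ fractions (suc (G ℕ.* X (1 ℕ.+ N))) (X (1 ℕ.+ N)) → upper ∣ α -ʳ r ∣ʳ q →
            lower ((↧ₙ r) ^ʳ (-ʳ x)) q → ∣ ↥ r ∣ ℕ.≤ G ℕ.* ↧ₙ r → Dec (↧ₙ r ℕ.≤ X (1 ℕ.+ N)) → ⊥
          by-size r {G = G} r∉ _ _ ↥≤ (yes ↧≤X) = r∉ (∈-fractions r (s≤s (ℕP.≤-trans ↥≤ (ℕP.*-monoʳ-≤ G ↧≤X))) ↧≤X)
          by-size r {q} r∉ uq lq _ (no ↧≰X) = let (M , h₁ , h₂) = bad r {q} (ℕP.<⇒≤ (ℕP.≰⇒> ↧≰X)) uq in contradict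
            r {q} M lq h₁ h₂

-- The irrationality exponent.

module Theorem where

  open NumberLemmas
  open ContinuedFractions using (IsSign)
  open Series
  open Tails
  open Coefficients
  open Logarithms
  open CriticalExponent
  open DenominatorGrowth
  open Approximation
  open import Data.Nat.Base using (_≤_; _<_; _*_; _+_; _^_)
  open Exp using () renaming (_^_ to _^ℚ_)
  open ℚ-Solver using (solve; _:*_; _:=_)

  module Conclusion {d : ℕ} {X Y U V : ℕ → ℕ} (2^n≤X : ∀ n → 2 ^ n ≤ X n) (4X≤X : ∀ n → 4 * X (1 + n) ≤ X (2 + n))
    (X-suc : ∀ n → X (1 + n) ≡ X n * Y n) (X≤Y : ∀ n → X n ≤ Y n)
    (1≤U : ∀ n → 1 ≤ U n) (1≤V : ∀ n → 1 ≤ V n)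
    (X-recurrence : ∀ n → X (2 + n) * X n ≡ X (1 + n) * X (1 + n) * (1 + U n * X (1 + n)))
    (coefficients : Eventually (λ n → V n * X (1 + n) ^ d ≤ 2 * U n × U n ≤ 2 * (V n * X (1 + n) ^ d)))
    {r A : ℚ} (0<r : 0ℚ ℚ.< r) (r<λ : lower λ[ suc d ] r)
      (log-V : Eventually (λ n → fromℕ (log₂ (V n)) ℚ.≤ A ℚ.* r ^ℚ n))
    {ρ : ℚ} {ε : ℕ → ℤ} (ε-sign : ∀ j → IsSign (ε j)) {x : ℕ → ℕ} (x≡X : ∀ n → x (suc n) ≡ X n)
    (↧S≡X : ∀ n → ↧ₙ (partialSum ρ ε x n) ≡ X n) {α : ℝ} (converges : partialSum ρ ε x ConvergesTo α) where

    private
      1≤d : 1 ≤ suc d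
      1≤d = s≤s z≤n

      open Errors {X} (λ n → ℕP.≤-trans (ℕP.m^n>0 2 n) (2^n≤X n)) 4X≤X {ρ} {ε} ε-sign {x} x≡X
      open Ratios {d} {X} {U} {V} 2^n≤X 1≤U 1≤V X-recurrence coefficients using (ratio-≥; ratio-≤)
      open Exponents {α} {S} {X} 2^n≤X ↧S≡X {1/X} X*1/X 0<1/X (upper-error {α} converges) (lower-error {α} converges)

      -- `below` is applied twice because `approximable` needs two exponents above `p`, whose gap
      -- absorbs the rounding.
      approximable-below : ∀ {p} → lower λ[ suc d ] p → ApproximableToOrder α (fromℚ p)
      approximable-below {p} p<λ = approximable (ℚP.≤-trans (0≤δ-1 1≤d) (Below.δ-1≤t b)) (Below.r<t b)
        (Below.r<t b′) (ratio-≥ b′)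
        where
          b : Below 1≤d p
          b = below 1≤d p p<λ
          b′ : Below 1≤d (Below.t b)
          b′ = below 1≤d (Below.t b) (Below.lower-t b)

      refute : ∀ {x s s′ p} → s′ ℚ.< s → Above 1≤d s′ → fromℕ 2 ℚ.< s → (b : Below 1≤d p) → Below.t b ℚ.<
        (s ℚ.- 1ℚ) ℚ.* (Below.t b ℚ.- 1ℚ) →
        lower x s → ¬ ApproximableToOrder α x
      refute {x} {s} s′<s a 2<s b balanced s<x = not-approximable {s} {Above.s a} {Below.t b} 2<s
        (ℚP.≤-<-trans (Above.s≤r a) s′<s) balanced
        (ratio-≥ b) (ratio-≤ {A = A} 0<r r<λ log-V a) {Y} X-suc X≤Y {x} s<x

      λ-upper⇒¬approximable : ∀ {x} s → upper λ[ suc d ] s → lower x s → ¬ ApproximableToOrder α x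
      λ-upper⇒¬approximable {x} s λ<s s<x =
        let (s′ , s′<s , λ<s′) = upper-rounded λ[ suc d ] {s} λ<s
            (p , b , balanced) = balance 1≤d s λ<s
        in refute {x} {s} {s′} {p} s′<s (above 1≤d s′ λ<s′) (0<q-p⇒p<q {fromℕ 2} {s} (0<s-2 1≤d s λ<s)) b balanced s<x

      -- For p < s < x, locatedness of λ gives p < λ or λ < s; in the second case x would be an
      -- order of approximation beyond λ.
      approximable⇒≤λ : ∀ x → ApproximableToOrder α x → x ≤ʳ λ[ suc d ]
      approximable⇒≤λ x approx {p} p<x =
        let (s , p<s , s<x) = lower-rounded x p<x
        in [ (λ p<λ → p<λ) , (λ λ<s → ⊥-elim (λ-upper⇒¬approximable {x} s λ<s s<x approx)) ]′
          (located λ[ suc d ] {p} {s} p<s)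

    irrationality-exponent : IrrationalityExponent α λ[ suc d ]
    irrationality-exponent = record
      { isUpperBound = approximable⇒≤λ
      -- The rational order `p′` between `p` and λ is attained, and `p` separates it from `t`.
      ; isLeast = λ t (p , t<p , p<λ) → let (p′ , p<p′ , p′<λ) = lower-rounded λ[ suc d ] {p} p<λ in
          fromℚ p′ , approximable-below p′<λ , p , t<p , p<p′
      }

  module _ {d : ℕ} {ρ : ℚ} {y₀ : ℕ} {ε : ℕ → ℤ} (construction : Construction ρ y₀ ε)
    {u : ℕ → ℕ} (1≤u : ∀ n → 1 ≤ n → 1 ≤ u n)
    {v : ℕ → ℕ → ℤ} (u≡∑v : ∀ n → 1 ≤ n → + u n ≡ ∑v (suc d) (λ j → v j n) (xSeq (↧ₙ ρ) y₀ u n))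
    (0<v₀ : ∀ n → 1 ≤ n → 0ℤ ℤ.< v 0 n)
    {ν : ℝ} (0<ν : fromℚ 0ℚ <ʳ ν) (ν<λ : ν <ʳ λ[ suc d ])
    (log-v₀ : (λ n → log ∣ v 0 n ∣) =O (λ n → pow ν 0<ν n))
    (v≪v₀ : ∀ j → 1 ≤ j → j < suc d → (λ n → fromℚ (fromℤ (v j n))) =O (λ n → fromℚ (fromℤ (v 0 n))))
    {α : ℝ} (converges : partialSum ρ ε (xSeq (↧ₙ ρ) y₀ u) ConvergesTo α) where

    private
      signs : _
      signs = construction-signs construction

      1≤q : 1 ≤ ↧ₙ ρ
      1≤q = s≤s z≤n

      open Sequences (↧ₙ ρ) y₀ u
      open Growth 1≤q (proj₁ signs) 1≤u
      open Denominators {ρ} refl 1≤q (proj₁ signs) 1≤u {ε} (proj₁ (proj₂ signs)) {proj₁ (proj₂ (proj₂ signs))}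
        (proj₁ (proj₂ (proj₂ (proj₂ signs)))) (proj₁ (proj₂ (proj₂ (proj₂ (proj₂ signs)))))
          (proj₂ (proj₂ (proj₂ (proj₂ (proj₂ signs))))) using (↧S≡X)

      V : ℕ → ℕ
      V n = ∣ v 0 n ∣

      v₀≡V : ∀ n → 1 ≤ n → v 0 n ≡ + V n
      v₀≡V n 1≤n = sym (ℤP.0≤i⇒+∣i∣≡i (ℤP.<⇒≤ (0<v₀ n 1≤n)))

      1≤V : ∀ n → 1 ≤ n → 1 ≤ V n
      1≤V n 1≤n = ℤP.drop‿+<+ (subst (0ℤ ℤ.<_) (v₀≡V n 1≤n) (0<v₀ n 1≤n))

      -- x_(n+2) is `X (1 + n)`, so u and v are read at index n + 2 and their eventual bounds are
      -- shifted twice.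
      coefficients : Eventually (λ n → V (2 + n) * X (1 + n) ^ d ≤ 2 * u (2 + n) × u (2 + n) ≤ 2 *
        (V (2 + n) * X (1 + n) ^ d))
      coefficients = let (c , v≤cV) = uniform-bound d v V (λ j 1≤j j<d → =O⇒≤ {v j} {v 0} (v≪v₀ j 1≤j j<d)) in
        leading-term d c (λ j n → v j (2 + n)) (λ n → v₀≡V (2 + n) (s≤s z≤n)) (shift (shift v≤cV))
          (λ n → X (1 + n)) (λ n → 2^n≤X (1 + n)) (λ n → u≡∑v (2 + n) (s≤s z≤n))

      r : ℚ
      r = proj₁ ν<λ

      ν<r : upper ν r
      ν<r = proj₁ (proj₂ ν<λ)

      0<r : 0ℚ ℚ.< r
      0<r = let (_ , 0<s , s<ν) = 0<ν in ℚP.<-trans 0<s (lower<upper ν s<ν ν<r)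

      log-V : ∃[ A ] Eventually (λ n → fromℕ (log₂ (V (2 + n))) ℚ.≤ A ℚ.* r ^ℚ n)
      log-V = let (A , h) = log₂-growth {V} {ν} {0<ν} 1≤V log-v₀ (ℚP.<⇒≤ 0<r) ν<r in
        -- The double shift of the index turns r^(n+2) into r² r^n.
        A ℚ.* r ℚ.* r , mapᵉ (λ n → subst (fromℕ (log₂ (V (2 + n))) ℚ.≤_)
          (solve 3 (λ A r p → A :* (r :* (r :* p)) := A :* r :* r :* p) refl A r (r ^ℚ n)))
          (shift (shift h))

      X≤Y : ∀ n → X n ≤ Y (suc n)
      X≤Y n = ℕP.≤-trans (ℕP.n≤1+n (X n))
        (ℕP.≤-trans (subst (_≤ Y n * (1 + X n)) (ℕP.*-identityˡ (1 + X n))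
        (ℕP.*-monoˡ-≤ (1 + X n) (1≤Y n))) (1+X≤Y n))

    irrationality-exponent : IrrationalityExponent α λ[ suc d ]
    irrationality-exponent = Conclusion.irrationality-exponent {d} {X} {λ n → Y (suc n)} {λ n → u (2 + n)}
      {λ n → V (2 + n)} 2^n≤X 4X≤X (λ _ → refl) X≤Y
      (λ n → 1≤u (2 + n) (s≤s z≤n)) (λ n → 1≤V (2 + n) (s≤s z≤n)) X-recurrence coefficients {r} {proj₁ log-V} 0<r
        (proj₂ (proj₂ ν<λ)) (proj₂ log-V)
      {ρ} {ε} (proj₁ (proj₂ signs)) {xSeq (↧ₙ ρ) y₀ u} (λ _ → refl) ↧S≡X {α} converges

open import Data.Integer.Base using (ℤ; +_; 0ℤ; ∣_∣) renaming (_<_ to _<ᶻ_)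
open import Data.Nat.Base using (ℕ; _≤_; _<_)
open import Data.Rational.Base using (ℚ; 0ℚ; ↧ₙ_)
open import Relation.Binary.PropositionalEquality.Core using (_≡_)

theorem3p3 : (d : ℕ) → 1 ≤ d →
    (ρ : ℚ) (y₀ : ℕ) (ε : ℕ → ℤ) → Construction ρ y₀ ε →
    (u : ℕ → ℕ) → (∀ n → 1 ≤ n → 1 ≤ u n) →
    (v : ℕ → ℕ → ℤ) →
    (∀ n → 1 ≤ n → + u n ≡ ∑v d (λ j → v j n) (xSeq (↧ₙ ρ) y₀ u n)) →
    (∀ n → 1 ≤ n → 0ℤ <ᶻ v 0 n) →
    (ν : ℝ) (0<ν : fromℚ 0ℚ <ʳ ν) → ν <ʳ λ[ d ] →
    (λ n → log ∣ v 0 n ∣) =O (λ n → pow ν 0<ν n) →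
    (∀ j → 1 ≤ j → j < d → (λ n → fromℚ (fromℤ (v j n))) =O (λ n → fromℚ (fromℤ (v 0 n)))) →
    (α : ℝ) → partialSum ρ ε (xSeq (↧ₙ ρ) y₀ u) ConvergesTo α →
    IrrationalityExponent α λ[ d ]
theorem3p3 (suc d) _ ρ y₀ ε construction u 1≤u v u≡∑v 0<v₀ ν 0<ν ν<λ log-v₀ v≪v₀ α converges =
  Theorem.irrationality-exponent {d} {ρ} {y₀} {ε} construction {u} 1≤u {v} u≡∑v 0<v₀ {ν} 0<ν ν<λ log-v₀ v≪v₀
    {α} converges
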